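{- Let $G$ be a finite group that admits a five-product-avoiding generating set $T=\{a_1,\ldots,a_\ell\}$ such that (i) $|t|>2$ for every $t\in T$, and (ii) $|a_{i+1}a_i^{ -1}|>2$ for every $i\in\{1,\ldots,\ell-1\}$. Then $G$ admits an ORR if and only if $G\not\cong Q_8$, $G\not\cong C_3\times C_2^3$ and $G\not\cong C_3\times C_3$.
   Context: $|g|$ denotes the order of $g$; $Q_8$ is the quaternion group of order 8. A generating set $T$ of a group $G$ is five-product-avoiding if $T\cap T^{ -1}=\emptyset$ and for all $x,y,z,w,v\in T\cup T^{ -1}\cup\{1\}$ we have $xyzwv\notin T\setminus\{x^{\pm1},y^{\pm1},z^{\pm1},w^{\pm1},v^{\pm1}\}$. The Cayley digraph $\mathrm{Cay}(G,S)$ has vertex set $G$ and arcs $(x,y)$ with $yx^{ -1}\in S$. $G$ admits an ORR (oriented regular representation) if there is $S\subseteq G$ with $S\cap S^{ -1}=\emptyset$ and the full automorphism group of $\mathrm{Cay}(G,S)$ equal to the right regular representation of $G$. -}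

module Defs where

open import Level using (0ℓ)
open import Data.Nat as ℕ using (ℕ; zero; suc; _<_; _∸_)
open import Data.Nat.DivMod using (_mod_)
open import Data.Fin as Fin using (Fin; toℕ)
open import Data.Fin.Properties using (all?; *↔×)
open import Data.Product using (Σ; ∃; _×_; _,_; proj₁; proj₂)
open import Data.Product.Properties using (≡-dec)
open import Data.Product.Function.NonDependent.Propositional using (_×-↔_)
open import Data.Sum using (_⊎_)
open import Data.Bool using (Bool; true)
open import Data.List using (List; []; _∷_)
open import Data.List.Relation.Unary.Any using (Any)
open import Relation.Nullary using (¬_; Dec)
open import Relation.Nullary.Decidable using (toWitness; True; _×-dec_; map′)
open import Relation.Unary using (Decidable)
open import Relation.Binary.Definitions using (DecidableEquality)
open import Function.Construct.Identity using (↔-id)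
open import Relation.Binary.PropositionalEquality
  using (_≡_; _≢_; refl; cong; cong₂; isEquivalence)
open import Algebra.Core using (Op₁; Op₂)
open import Algebra.Structures using (IsGroup)
open import Algebra.Definitions using (Associative; Identity; Inverse)
open import Function.Bundles using (_↔_; _⇔_)
open import Function.Construct.Composition using (_↔-∘_)
open import Function.Definitions using (Bijective; Injective)

record FiniteGroup : Set₁ where
  infixl 7 _∙_
  infix 8 _⁻¹
  field
    Carrier : Set
    _∙_     : Op₂ Carrier
    ε       : Carrier
    _⁻¹     : Op₁ Carrier
    isGroup : IsGroup _≡_ _∙_ ε _⁻¹
    size    : ℕ
    enum    : Fin size ↔ Carrier

  pow : Carrier → ℕ → Carrier
  pow g zero    = ε
  pow g (suc k) = g ∙ pow g k

  HasOrder : Carrier → ℕ → Set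
  HasOrder g k = 0 < k × pow g k ≡ ε × (∀ j → 0 < j → j < k → pow g j ≢ ε)

  OrderGT2 : Carrier → Set
  OrderGT2 g = ∀ k → HasOrder g k → 2 < k


_≅_ : FiniteGroup → FiniteGroup → Set
G ≅ H = Σ (FiniteGroup.Carrier G → FiniteGroup.Carrier H) λ f →
          Bijective _≡_ _≡_ f ×
          (∀ x y → f (FiniteGroup._∙_ G x y) ≡ FiniteGroup._∙_ H (f x) (f y))

module _ (G : FiniteGroup) {ℓ : ℕ} (a : Fin ℓ → FiniteGroup.Carrier G) where
  open FiniteGroup G

  InT : Carrier → Set
  InT t = ∃ λ i → a i ≡ t

  data Gen : Carrier → Set where
    gen-ε   : Gen ε
    gen-t   : ∀ {t x} → InT t → Gen x → Gen (t ∙ x)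
    gen-t⁻¹ : ∀ {t x} → InT t → Gen x → Gen (t ⁻¹ ∙ x)

  Generates : Set
  Generates = ∀ g → Gen g

  InT±1 : Carrier → Set
  InT±1 x = x ≡ ε ⊎ InT x ⊎ InT (x ⁻¹)

  FiveProductAvoiding : Set
  FiveProductAvoiding =
    (∀ x → InT x → ¬ InT (x ⁻¹)) ×
    (∀ x y z w v → InT±1 x → InT±1 y → InT±1 z → InT±1 w → InT±1 v →
       ∀ t → InT t → x ∙ y ∙ z ∙ w ∙ v ≡ t →
       Any (λ u → t ≡ u ⊎ t ≡ u ⁻¹) (x ∷ y ∷ z ∷ w ∷ v ∷ []))

module _ (G : FiniteGroup) where
  open FiniteGroup G

  Arc : (Carrier → Bool) → Carrier → Carrier → Set
  Arc S x y = S (y ∙ x ⁻¹) ≡ true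

  IsCayAut : (Carrier → Bool) → (Carrier → Carrier) → Set
  IsCayAut S f = Bijective _≡_ _≡_ f × (∀ x y → Arc S x y ⇔ Arc S (f x) (f y))

  AutIsRegular : (Carrier → Bool) → Set
  AutIsRegular S =
    (∀ g → IsCayAut S (λ x → x ∙ g)) ×
    (∀ f → IsCayAut S f → ∃ λ g → ∀ x → f x ≡ x ∙ g)

  AdmitsORR : Set
  AdmitsORR = Σ (Carrier → Bool) λ S →
    (∀ s → S s ≡ true → ¬ (S (s ⁻¹) ≡ true)) × AutIsRegular S

≡-isGroup : {A : Set} {_∙_ : Op₂ A} {ε : A} {_⁻¹ : Op₁ A} →
            Associative _≡_ _∙_ → Identity _≡_ ε _∙_ → Inverse _≡_ ε _⁻¹ _∙_ →
            IsGroup _≡_ _∙_ ε _⁻¹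
≡-isGroup {_∙_ = _∙_} {_⁻¹ = _⁻¹} as id inv = record
  { isMonoid = record
    { isSemigroup = record
      { isMagma = record { isEquivalence = isEquivalence ; ∙-cong = cong₂ _∙_ }
      ; assoc = as }
    ; identity = id }
  ; inverse = inv
  ; ⁻¹-cong = cong _⁻¹ }

module Cyc (m : ℕ) where
  _+c_ : Op₂ (Fin (suc m))
  x +c y = (toℕ x ℕ.+ toℕ y) mod (suc m)
  -c_ : Op₁ (Fin (suc m))
  -c x = (suc m ∸ toℕ x) mod (suc m)

module _ {A : Set} (_≟_ : DecidableEquality A)
         (all?ᴬ : ∀ {P : A → Set} → Decidable P → Dec (∀ x → P x))
         (_∙_ : Op₂ A) (ε : A) (_⁻¹ : Op₁ A) where
  laws? : Dec (Associative _≡_ _∙_ × Identity _≡_ ε _∙_ × Inverse _≡_ ε _⁻¹ _∙_)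
  laws? = (all?ᴬ λ x → all?ᴬ λ y → all?ᴬ λ z → ((x ∙ y) ∙ z) ≟ (x ∙ (y ∙ z)))
      ×-dec ((all?ᴬ λ x → (ε ∙ x) ≟ x) ×-dec (all?ᴬ λ x → (x ∙ ε) ≟ x))
      ×-dec ((all?ᴬ λ x → ((x ⁻¹) ∙ x) ≟ ε) ×-dec (all?ᴬ λ x → (x ∙ (x ⁻¹)) ≟ ε))

  decGroup : (n : ℕ) → Fin n ↔ A → {True laws?} → FiniteGroup
  decGroup n e {p} = record
    { Carrier = A ; _∙_ = _∙_ ; ε = ε ; _⁻¹ = _⁻¹
    ; isGroup = let (as , id , inv) = toWitness p in ≡-isGroup as id inv
    ; size = n ; enum = e }

C₂ : FiniteGroup
C₂ = decGroup Fin._≟_ all? _+c_ Fin.zero -c_ 2 (↔-id _)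
  where open Cyc 1

C₃ : FiniteGroup
C₃ = decGroup Fin._≟_ all? _+c_ Fin.zero -c_ 3 (↔-id _)
  where open Cyc 2

_⊗_ : FiniteGroup → FiniteGroup → FiniteGroup
G ⊗ H = record
  { Carrier = G.Carrier × H.Carrier
  ; _∙_ = λ (g , h) (g′ , h′) → (g G.∙ g′ , h H.∙ h′)
  ; ε = (G.ε , H.ε)
  ; _⁻¹ = λ (g , h) → (g G.⁻¹ , h H.⁻¹)
  ; isGroup = ≡-isGroup
      (λ (x , x′) (y , y′) (z , z′) → cong₂ _,_ (G.assoc x y z) (H.assoc x′ y′ z′))
      ( (λ (x , x′) → cong₂ _,_ (G.identityˡ x) (H.identityˡ x′))
      , (λ (x , x′) → cong₂ _,_ (G.identityʳ x) (H.identityʳ x′)))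
      ( (λ (x , x′) → cong₂ _,_ (G.inverseˡ x) (H.inverseˡ x′))
      , (λ (x , x′) → cong₂ _,_ (G.inverseʳ x) (H.inverseʳ x′)))
  ; size = G.size ℕ.* H.size
  ; enum = (G.enum ×-↔ H.enum) ↔-∘ *↔×
  }
  where
  module G where
    open FiniteGroup G public
    open IsGroup isGroup public using (assoc; identityˡ; identityʳ; inverseˡ; inverseʳ)
  module H where
    open FiniteGroup H public
    open IsGroup isGroup public using (assoc; identityˡ; identityʳ; inverseˡ; inverseʳ)

C₃×C₂³ : FiniteGroup
C₃×C₂³ = C₃ ⊗ (C₂ ⊗ (C₂ ⊗ C₂))

C₃×C₃ : FiniteGroup
C₃×C₃ = C₃ ⊗ C₃

-- Quaternion group Q₈ = {±1, ±i, ±j, ±k}: an element is (s , u) with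
-- sign s (0 = +, 1 = −) and unit u (0 = 1, 1 = i, 2 = j, 3 = k).
module Quat where
  Sign = Fin 2
  Unit = Fin 4

  _⊕_ : Sign → Sign → Sign
  Fin.zero ⊕ s = s
  Fin.suc Fin.zero ⊕ Fin.zero = Fin.suc Fin.zero
  Fin.suc Fin.zero ⊕ Fin.suc Fin.zero = Fin.zero

  pattern ₁ = Fin.zero
  pattern ᵢ = Fin.suc Fin.zero
  pattern ⱼ = Fin.suc (Fin.suc Fin.zero)
  pattern ₖ = Fin.suc (Fin.suc (Fin.suc Fin.zero))
  pattern + = Fin.zero
  pattern - = Fin.suc Fin.zero

  unitMul : Unit → Unit → Sign × Unit
  unitMul ₁ v = (+ , v)
  unitMul ᵢ ₁ = (+ , ᵢ)
  unitMul ᵢ ᵢ = (- , ₁)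
  unitMul ᵢ ⱼ = (+ , ₖ)
  unitMul ᵢ ₖ = (- , ⱼ)
  unitMul ⱼ ₁ = (+ , ⱼ)
  unitMul ⱼ ᵢ = (- , ₖ)
  unitMul ⱼ ⱼ = (- , ₁)
  unitMul ⱼ ₖ = (+ , ᵢ)
  unitMul ₖ ₁ = (+ , ₖ)
  unitMul ₖ ᵢ = (+ , ⱼ)
  unitMul ₖ ⱼ = (- , ᵢ)
  unitMul ₖ ₖ = (- , ₁)

  Q : Set
  Q = Sign × Unit

  _·_ : Q → Q → Q
  (s , u) · (t , v) = ((s ⊕ t) ⊕ proj₁ (unitMul u v) , proj₂ (unitMul u v))

  one : Q
  one = (+ , ₁)

  inv : Q → Q
  inv (s , ₁) = (s , ₁)
  inv (s , u) = (s ⊕ - , u)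

  all?Q : ∀ {P : Q → Set} → Decidable P → Dec (∀ x → P x)
  all?Q P? = map′ (λ f (s , u) → f s u) (λ f s u → f (s , u))
                  (all? λ s → all? λ u → P? (s , u))

Q₈ : FiniteGroup
Q₈ = decGroup (≡-dec Fin._≟_ Fin._≟_) all?Q _·_ one inv 8 *↔×
  where open Quat

{-# OPTIONS --safe #-}

-- Let S consist of the generators aᵢ and the quotients bᵢ = aᵢ₊₁ aᵢ⁻¹. By five-product avoidance a word
-- of length at most six in the generators is nontrivial as soon as some generator occurs in it exactly
-- once. Hence u s = t with u, s, t ∈ S forces all three to lie over one edge of the path a₁ – … – aₗ, and
-- the subdigraph induced on S is the directed path with each bᵢ attached to aᵢ and aᵢ₊₁ in a few ways.
-- An automorphism fixing 1 acts on this subdigraph. The g with φ(g h) = g φ(h) for all automorphisms φ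
-- and all h form a subgroup, so it suffices that the generators are such; once a₁ is, the others follow
-- along the path, since bᵢ is then fixed together with aᵢ and aᵢ₊₁.
--
-- The start a₁ can be moved only if it commutes with a₂ or if the path is short. If ℓ ≥ 4 and a₁, a₂
-- commute, reversing the first edge makes a₂ the unique vertex with two non-adjacent successors of which
-- one is a sink. For ℓ ≤ 3 one reorders the generators or takes a few other short words, which works
-- except in the three groups; there every S with S ∩ S⁻¹ = ∅ is preserved by a nontrivial group
-- automorphism.

module Submission where

open import Defs
open import Level using (0ℓ)
open import Data.Nat as ℕ using (ℕ; zero; suc; _<_; _≤_; z≤n; s≤s; z<s; s<s; _+_)
import Data.Nat.Properties as ℕₚ
open import Data.Fin as Fin using (Fin; toℕ; zero; suc)
import Data.Fin.Properties as Finₚ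
open import Data.Bool using (Bool; true; false; _∧_; _∨_; not; if_then_else_; T)
open import Data.List as List using (List; []; _∷_; _++_; length; map)
import Data.List.Properties as Listₚ
open import Data.List.Membership.Propositional using (_∈_)
open import Data.List.Membership.Propositional.Properties using (∈-++⁻; ∈-++⁺ˡ; ∈-++⁺ʳ; ∈-map⁻; ∈-allFin)
open import Data.List.Relation.Unary.Any using (here; there)
open import Data.List.Relation.Unary.All as All using (All; []; _∷_)
open import Data.Maybe using (Maybe; just; nothing)
open import Data.Vec as Vec using (Vec; []; _∷_)
import Data.Vec.Properties as Vecₚ
open import Data.Product using (Σ; ∃; _×_; _,_; proj₁; proj₂)
open import Data.Product.Properties using (≡-dec)
open import Data.Sum using (_⊎_; inj₁; inj₂; [_,_]′) renaming (swap to swap-⊎)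
open import Data.Unit using (⊤; tt)
open import Data.Empty using (⊥; ⊥-elim)
open import Relation.Nullary using (¬_; Dec; yes; no; does)
open import Relation.Nullary.Decidable using (_⊎-dec_; map′; via-injection; dec-true)
open import Relation.Unary using (Decidable)
open import Relation.Binary.Definitions using (DecidableEquality)
open import Relation.Binary.PropositionalEquality
  using (_≡_; _≢_; refl; sym; trans; cong; cong₂; subst; subst₂; module ≡-Reasoning)
open import Function.Bundles using (_⇔_; mk⇔; Equivalence)
open import Function.Definitions using (Injective)
open import Function.Properties.Inverse using (↔-sym; Inverse⇒Injection)
open import Algebra.Structures using (IsGroup)
open import Algebra.Bundles using (Group)
import Algebra.Properties.Group as GroupProperties


-- Words in a group

-- The number five comes from the connection set: its members are words of one or two letters, so u
-- s = t is a trivial word of at most six letters, and isolating a letter that occurs once leaves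
-- five factors. The few equations over one edge that survive are the arcs recorded by `C`, `I` and
-- `P′`. The obstacle is twins. If a₁ and a₂ commute, then b₁ a₁ = a₁ b₁ = a₂ gives arcs to a₂ from
-- both a₁ and b₁, and unless b₁ also has an arc to a₁ nothing in the subdigraph tells them apart.
-- Reversing the edge makes a₂ a fork, but recognising the fork takes a fourth vertex on the path.
-- Short paths therefore need sets of their own, with words such as y x or y² added; there word
-- equations are decided by reduction and rigidity by a search that is proved sound. What resists is
-- a short list of relations: for two generators those of Q₈ or of C₃ × C₃, and for three (y x)² =
-- (y z)² = y⁶ = 1 in an abelian group, which is C₃ × C₂³.

data Letter : Set where
  pos neg : ℕ → Letter

Word : Set
Word = List Letter

index : Letter → ℕ
index (pos i) = i
index (neg i) = i

flip : Letter → Letter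
flip (pos i) = neg i
flip (neg i) = pos i

indices : Word → List ℕ
indices = map index

inv : Word → Word
inv []      = []
inv (l ∷ w) = inv w ++ flip l ∷ []

member : ℕ → List ℕ → Bool
member i []       = false
member i (j ∷ js) = (i ℕ.≡ᵇ j) ∨ member i js

cancels : Letter → Letter → Bool
cancels (pos i) (neg j) = i ℕ.≡ᵇ j
cancels (neg i) (pos j) = i ℕ.≡ᵇ j
cancels _       _       = false

isNil : Word → Bool
isNil []      = true
isNil (_ ∷ _) = false

∧-true : ∀ {b c} → b ∧ c ≡ true → b ≡ true × c ≡ true
∧-true {true} {true} _ = refl , refl

∨-true : ∀ {b c} → b ∨ c ≡ true → b ≡ true ⊎ c ≡ true
∨-true {true}  _ = inj₁ refl
∨-true {false} e = inj₂ e

≡ᵇ-true : ∀ i j → (i ℕ.≡ᵇ j) ≡ true → i ≡ j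
≡ᵇ-true i j e = ℕₚ.≡ᵇ⇒≡ i j (subst T (sym e) _)

≡ᵇ-refl : ∀ i → (i ℕ.≡ᵇ i) ≡ true
≡ᵇ-refl zero    = refl
≡ᵇ-refl (suc i) = ≡ᵇ-refl i

<ᵇ-true : ∀ i j → (i ℕ.<ᵇ j) ≡ true → i < j
<ᵇ-true i j e = ℕₚ.<ᵇ⇒< i j (subst T (sym e) _)

member-complete : ∀ {i js} → i ∈ js → member i js ≡ true
member-complete {i} (here refl) rewrite ≡ᵇ-refl i = refl
member-complete {i} {j ∷ js} (there p) with i ℕ.≡ᵇ j
... | true  = refl
... | false = member-complete p

indices-++ : ∀ v w → indices (v ++ w) ≡ indices v ++ indices w
indices-++ []      w = refl
indices-++ (l ∷ v) w = cong (index l ∷_) (indices-++ v w)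

index-flip : ∀ l → index (flip l) ≡ index l
index-flip (pos i) = refl
index-flip (neg i) = refl

∈-inv⁻ : ∀ {i} w → i ∈ indices (inv w) → i ∈ indices w
∈-inv⁻ {i} (l ∷ w) p with ∈-++⁻ (indices (inv w)) (subst (i ∈_) (indices-++ (inv w) (flip l ∷ [])) p)
... | inj₁ q        = there (∈-inv⁻ w q)
... | inj₂ (here e) = here (trans e (index-flip l))

length-inv : ∀ w → length (inv w) ≡ length w
length-inv [] = refl
length-inv (l ∷ w) = trans (List-length-++ (inv w)) (trans (ℕₚ.+-comm _ 1) (cong suc (length-inv w)))
  where
  List-length-++ : ∀ (v : Word) {u} → length (v ++ u) ≡ length v ℕ.+ length u
  List-length-++ []      = refl
  List-length-++ (_ ∷ v) = cong suc (List-length-++ v)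

-- pre is the part of the word scanned so far.
lonely : ℕ → Word → Word → Bool
lonely n pre []         = false
lonely n pre (l ∷ post) =
  ((index l ℕ.<ᵇ n) ∧ not (member (index l) (indices (pre ++ post)))) ∨ lonely n (pre ++ l ∷ []) post

module _ (G : FiniteGroup) where
  open FiniteGroup G

  asGroup : Group 0ℓ 0ℓ
  asGroup = record { isGroup = isGroup }

module GroupWords (G : FiniteGroup) (ρ : ℕ → FiniteGroup.Carrier G) where
  open FiniteGroup G
  open IsGroup isGroup using (assoc; identityˡ; identityʳ; inverseˡ; inverseʳ)
  open GroupProperties (asGroup G)

  ⟦_⟧ : Letter → Carrier
  ⟦ pos i ⟧ = ρ i
  ⟦ neg i ⟧ = ρ i ⁻¹

  eval : Word → Carrier
  eval []      = ε
  eval (l ∷ w) = ⟦ l ⟧ ∙ eval w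

  eval-++ : ∀ v w → eval (v ++ w) ≡ eval v ∙ eval w
  eval-++ []      w = sym (identityˡ _)
  eval-++ (l ∷ v) w = trans (cong (⟦ l ⟧ ∙_) (eval-++ v w)) (sym (assoc _ _ _))

  ⟦flip⟧ : ∀ l → ⟦ flip l ⟧ ≡ ⟦ l ⟧ ⁻¹
  ⟦flip⟧ (pos i) = refl
  ⟦flip⟧ (neg i) = sym (⁻¹-involutive _)

  eval-inv : ∀ w → eval (inv w) ≡ eval w ⁻¹
  eval-inv []      = sym ε⁻¹≈ε
  eval-inv (l ∷ w) = begin
    eval (inv w ++ flip l ∷ [])     ≡⟨ eval-++ (inv w) _ ⟩
    eval (inv w) ∙ (⟦ flip l ⟧ ∙ ε) ≡⟨ cong₂ _∙_ (eval-inv w) (trans (identityʳ _) (⟦flip⟧ l)) ⟩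
    eval w ⁻¹ ∙ ⟦ l ⟧ ⁻¹            ≡⟨ sym (⁻¹-anti-homo-∙ _ _) ⟩
    (⟦ l ⟧ ∙ eval w) ⁻¹             ∎
    where open ≡-Reasoning

  quotient-ε : ∀ {x y} → x ∙ y ⁻¹ ≡ ε → x ≡ y
  quotient-ε {x} {y} e = trans (inverseˡ-unique x (y ⁻¹) e) (⁻¹-involutive y)

  ε-quotient : ∀ {x y} → x ≡ y → x ∙ y ⁻¹ ≡ ε
  ε-quotient refl = inverseʳ _

  eval-quotient : ∀ v w → eval (v ++ inv w) ≡ eval v ∙ eval w ⁻¹
  eval-quotient v w = trans (eval-++ v _) (cong (eval v ∙_) (eval-inv w))

  cancels-sound : ∀ l m → cancels l m ≡ true → ⟦ l ⟧ ∙ ⟦ m ⟧ ≡ ε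
  cancels-sound (pos i) (neg j) e rewrite ≡ᵇ-true i j e = inverseʳ _
  cancels-sound (neg i) (pos j) e rewrite ≡ᵇ-true i j e = inverseˡ _

  Commute : Carrier → Carrier → Set
  Commute x y = x ∙ y ≡ y ∙ x

  commute-sym : ∀ {x y} → Commute x y → Commute y x
  commute-sym = sym

  commute-⁻¹ : ∀ {x y} → Commute x y → Commute x (y ⁻¹)
  commute-⁻¹ {x} {y} c = begin
    x ∙ y ⁻¹                   ≡⟨ sym (identityˡ _) ⟩
    ε ∙ (x ∙ y ⁻¹)             ≡⟨ cong (_∙ (x ∙ y ⁻¹)) (sym (inverseˡ y)) ⟩
    (y ⁻¹ ∙ y) ∙ (x ∙ y ⁻¹)    ≡⟨ assoc _ _ _ ⟩
    y ⁻¹ ∙ (y ∙ (x ∙ y ⁻¹))    ≡⟨ cong (y ⁻¹ ∙_) (sym (assoc _ _ _)) ⟩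
    y ⁻¹ ∙ ((y ∙ x) ∙ y ⁻¹)    ≡⟨ cong (λ z → y ⁻¹ ∙ (z ∙ y ⁻¹)) (sym c) ⟩
    y ⁻¹ ∙ ((x ∙ y) ∙ y ⁻¹)    ≡⟨ cong (y ⁻¹ ∙_) (trans (assoc _ _ _) (cong (x ∙_) (inverseʳ y))) ⟩
    y ⁻¹ ∙ (x ∙ ε)             ≡⟨ cong (y ⁻¹ ∙_) (identityʳ x) ⟩
    y ⁻¹ ∙ x                   ∎
    where open ≡-Reasoning

  -- Group terms are reflected so that an equation between them becomes one between flattened words,
  -- which computation can settle.
  data Expr : Set where
    var  : ℕ → Expr
    _⊙_  : Expr → Expr → Expr
    _⁻   : Expr → Expr
    unit : Expr

  infixl 7 _⊙_
  infix  8 _⁻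

  ⟪_⟫ : Expr → Carrier
  ⟪ var i ⟫ = ρ i
  ⟪ s ⊙ t ⟫ = ⟪ s ⟫ ∙ ⟪ t ⟫
  ⟪ s ⁻ ⟫   = ⟪ s ⟫ ⁻¹
  ⟪ unit ⟫  = ε

  flatten : Expr → Word
  flatten (var i) = pos i ∷ []
  flatten (s ⊙ t) = flatten s ++ flatten t
  flatten (s ⁻)   = inv (flatten s)
  flatten unit    = []

  eval-flatten : ∀ s → eval (flatten s) ≡ ⟪ s ⟫
  eval-flatten (var i) = identityʳ _
  eval-flatten (s ⊙ t) = trans (eval-++ (flatten s) (flatten t)) (cong₂ _∙_ (eval-flatten s) (eval-flatten t))
  eval-flatten (s ⁻)   = trans (eval-inv (flatten s)) (cong _⁻¹ (eval-flatten s))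
  eval-flatten unit    = refl

  as-words : ∀ s t → ⟪ s ⟫ ≡ ⟪ t ⟫ → eval (flatten s) ≡ eval (flatten t)
  as-words s t e = trans (eval-flatten s) (trans e (sym (eval-flatten t)))

  from-words : ∀ s t → eval (flatten s) ≡ eval (flatten t) → ⟪ s ⟫ ≡ ⟪ t ⟫
  from-words s t e = trans (sym (eval-flatten s)) (trans e (eval-flatten t))

  record Relations : Set where
    field
      commuting : ℕ → ℕ → Bool
      commutes  : ∀ i j → commuting i j ≡ true → Commute (ρ i) (ρ j)

  free : Relations
  free = record { commuting = λ _ _ → false ; commutes = λ _ _ () }

  module Reduction (R : Relations) where
    open Relations R

    swaps : Letter → Letter → Bool
    swaps l m = commuting (index l) (index m)

    swaps-sound : ∀ l m → swaps l m ≡ true → Commute ⟦ l ⟧ ⟦ m ⟧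
    swaps-sound (pos i) (pos j) e = commutes i j e
    swaps-sound (pos i) (neg j) e = commute-⁻¹ (commutes i j e)
    swaps-sound (neg i) (pos j) e = commute-sym (commute-⁻¹ (commute-sym (commutes i j e)))
    swaps-sound (neg i) (neg j) e =
      commute-⁻¹ (commute-sym (commute-⁻¹ (commute-sym (commutes i j e))))

    -- The new letter travels to the right past commuting letters until it meets its inverse or is
    -- blocked. Only soundness is proved: a nonempty reduced word by itself shows nothing.
    insert : Letter → Word → Word
    insert l []      = l ∷ []
    insert l (m ∷ w) =
      if cancels l m then w else (if swaps l m then m ∷ insert l w else l ∷ m ∷ w)

    eval-insert : ∀ l w → eval (insert l w) ≡ ⟦ l ⟧ ∙ eval w
    eval-insert l []      = refl
    eval-insert l (m ∷ w) with cancels l m in e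
    ... | true  = sym (trans (sym (assoc _ _ _)) (trans (cong (_∙ eval w) (cancels-sound l m e)) (identityˡ _)))
    ... | false with swaps l m in e′
    ...   | true  = trans (cong (⟦ m ⟧ ∙_) (eval-insert l w))
                      (trans (sym (assoc _ _ _))
                        (trans (cong (_∙ eval w) (sym (swaps-sound l m e′))) (assoc _ _ _)))
    ...   | false = refl

    reduce : Word → Word
    reduce []      = []
    reduce (l ∷ w) = insert l (reduce w)

    eval-reduce : ∀ w → eval (reduce w) ≡ eval w
    eval-reduce []      = refl
    eval-reduce (l ∷ w) = trans (eval-insert l (reduce w)) (cong (⟦ l ⟧ ∙_) (eval-reduce w))

    trivial : Word → Bool
    trivial w = isNil (reduce w)

    trivial-sound : ∀ w → trivial w ≡ true → eval w ≡ ε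
    trivial-sound w e with reduce w in r
    ... | [] = trans (sym (eval-reduce w)) (cong eval r)

    same : ∀ v w → trivial (v ++ inv w) ≡ true → eval v ≡ eval w
    same v w e = quotient-ε (trans (sym (eval-quotient v w)) (trivial-sound (v ++ inv w) e))

    data Relator : Set where
      _by_ : (r : Word × Word) → eval (proj₁ r) ≡ eval (proj₂ r) → Relator

    -- A word is trivial once it is a product of conjugates of relators; the conjugators are supplied.
    conjugates : List (Word × Relator) → Word
    conjugates []                            = []
    conjugates ((c , ((v , w) by _)) ∷ rest) = c ++ (v ++ inv w) ++ inv c ++ conjugates rest

    eval-conjugates : ∀ cs → eval (conjugates cs) ≡ ε
    eval-conjugates []                            = refl
    eval-conjugates ((c , ((v , w) by e)) ∷ rest) = begin
      eval (c ++ (v ++ inv w) ++ inv c ++ conjugates rest)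
        ≡⟨ eval-++ c _ ⟩
      eval c ∙ eval ((v ++ inv w) ++ inv c ++ conjugates rest)
        ≡⟨ cong (eval c ∙_) (eval-++ (v ++ inv w) _) ⟩
      eval c ∙ (eval (v ++ inv w) ∙ eval (inv c ++ conjugates rest))
        ≡⟨ cong (λ z → eval c ∙ (z ∙ eval (inv c ++ conjugates rest)))
             (trans (eval-quotient v w) (ε-quotient e)) ⟩
      eval c ∙ (ε ∙ eval (inv c ++ conjugates rest))
        ≡⟨ cong (eval c ∙_) (identityˡ _) ⟩
      eval c ∙ eval (inv c ++ conjugates rest)
        ≡⟨ cong (eval c ∙_) (trans (eval-++ (inv c) _) (cong₂ _∙_ (eval-inv c) (eval-conjugates rest))) ⟩
      eval c ∙ (eval c ⁻¹ ∙ ε)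
        ≡⟨ trans (cong (eval c ∙_) (identityʳ _)) (inverseʳ _) ⟩
      ε ∎
      where open ≡-Reasoning

    derive : ∀ v w → (cs : List (Word × Relator)) →
             trivial (conjugates cs ++ inv (v ++ inv w)) ≡ true → eval v ≡ eval w
    derive v w cs e = quotient-ε (trans (sym (eval-quotient v w))
      (trans (sym (same (conjugates cs) (v ++ inv w) e)) (eval-conjugates cs)))

    relator : ∀ s t → ⟪ s ⟫ ≡ ⟪ t ⟫ → Relator
    relator s t e = (flatten s , flatten t) by as-words s t e

    deduce : ∀ s t → (cs : List (Word × Relator)) →
             trivial (conjugates cs ++ inv (flatten s ++ inv (flatten t))) ≡ true → ⟪ s ⟫ ≡ ⟪ t ⟫
    deduce s t cs e = from-words s t (derive (flatten s) (flatten t) cs e)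

  -- The working form of five-product avoidance. Letters of index at least `n` may occur in `w` and
  -- count towards its length, but only indices below `n` are forced to reappear.
  record Separated (n : ℕ) : Set where
    field
      separated : ∀ k → k < n → ∀ w → length w ≤ 5 → eval w ≡ ρ k → k ∈ indices w
      square    : ∀ k → k < n → ρ k ∙ ρ k ≢ ε

    -- Rotating the word until `l` comes first leaves at most five letters whose product is the
    -- inverse of `l`. For a positive `l` that product is inverted once more, because `separated`
    -- speaks of generators only.
    occurs-twice : ∀ pre l post → index l < n → length (pre ++ post) ≤ 5 →
                   eval (pre ++ l ∷ post) ≡ ε → index l ∈ indices (pre ++ post)
    occurs-twice pre l post l<n len e =
      subst (index l ∈_) (sym (indices-++ pre post))
        ([ (λ p → ∈-++⁺ʳ (indices pre) p) , (λ p → ∈-++⁺ˡ p) ]′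
          (∈-++⁻ (indices post) (subst (index l ∈_) (indices-++ post pre) (swapped l l<n solved))))
      where
      rotated : ⟦ l ⟧ ∙ eval (post ++ pre) ≡ ε
      rotated = begin
        ⟦ l ⟧ ∙ eval (post ++ pre)   ≡⟨ sym (identityˡ _) ⟩
        ε ∙ (⟦ l ⟧ ∙ eval (post ++ pre))
          ≡⟨ cong₂ _∙_ (sym (inverseˡ p)) (cong (⟦ l ⟧ ∙_) (eval-++ post pre)) ⟩
        (p ⁻¹ ∙ p) ∙ (⟦ l ⟧ ∙ (eval post ∙ p))  ≡⟨ assoc _ _ _ ⟩
        p ⁻¹ ∙ (p ∙ (⟦ l ⟧ ∙ (eval post ∙ p)))
          ≡⟨ cong (λ z → p ⁻¹ ∙ (p ∙ z)) (sym (assoc _ _ _)) ⟩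
        p ⁻¹ ∙ (p ∙ ((⟦ l ⟧ ∙ eval post) ∙ p))
          ≡⟨ cong (p ⁻¹ ∙_) (trans (sym (assoc _ _ _)) (cong (_∙ p) (trans (sym (eval-++ pre (l ∷ post))) e))) ⟩
        p ⁻¹ ∙ (ε ∙ p)               ≡⟨ trans (cong (p ⁻¹ ∙_) (identityˡ _)) (inverseˡ _) ⟩
        ε ∎
        where
        open ≡-Reasoning
        p = eval pre
      solved : eval (post ++ pre) ≡ ⟦ l ⟧ ⁻¹
      solved = inverseʳ-unique _ _ rotated
      len′ : length (post ++ pre) ≤ 5
      len′ = subst (_≤ 5) (length-comm pre post) len
        where
        length-++ : ∀ (v : Word) u → length (v ++ u) ≡ length v ℕ.+ length u
        length-++ []      u = refl
        length-++ (_ ∷ v) u = cong suc (length-++ v u)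
        length-comm : ∀ (v u : Word) → length (v ++ u) ≡ length (u ++ v)
        length-comm v u = trans (length-++ v u) (trans (ℕₚ.+-comm (length v) _) (sym (length-++ u v)))
      swapped : ∀ l → index l < n → eval (post ++ pre) ≡ ⟦ l ⟧ ⁻¹ → index l ∈ indices (post ++ pre)
      swapped (neg i) i<n s = separated i i<n _ len′ (trans s (⁻¹-involutive _))
      swapped (pos i) i<n s = ∈-inv⁻ (post ++ pre) (separated i i<n (inv (post ++ pre))
        (subst (_≤ 5) (sym (length-inv (post ++ pre))) len′)
        (trans (eval-inv (post ++ pre)) (trans (cong _⁻¹ s) (⁻¹-involutive _))))

    lonely-sound : ∀ pre post → length (pre ++ post) ≤ 6 → lonely n pre post ≡ true → eval (pre ++ post) ≢ ε
    lonely-sound pre (l ∷ post) len u e with ∨-true u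
    ... | inj₁ v = notMember (member-complete (occurs-twice pre l post (<ᵇ-true _ _ (proj₁ (∧-true v))) len′ e))
                     (proj₂ (∧-true v))
      where
      length-mid : ∀ (p : Word) {q} → length (p ++ l ∷ q) ≡ suc (length (p ++ q))
      length-mid []      = refl
      length-mid (_ ∷ p) = cong suc (length-mid p)
      len′ : length (pre ++ post) ≤ 5
      len′ = ℕₚ.≤-pred (subst (_≤ 6) (length-mid pre) len)
      notMember : ∀ {b} → b ≡ true → not b ≢ true
      notMember refl ()
    ... | inj₂ v = lonely-sound (pre ++ l ∷ []) post
                     (subst (λ w → length w ≤ 6) (sym (++-assoc′ pre)) len) v
                     (trans (cong eval (++-assoc′ pre)) e)
      where
      ++-assoc′ : ∀ (p : Word) → (p ++ l ∷ []) ++ post ≡ p ++ l ∷ post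
      ++-assoc′ []      = refl
      ++-assoc′ (m ∷ p) = cong (m ∷_) (++-assoc′ p)

    module Decision (R : Relations) where
      open Reduction R

      -- Equations and inequations known from the context, for words that neither reduction nor a
      -- letter occurring once can decide.
      data Fact : Set where
        eq ne : Word → Fact

      Holds : Fact → Set
      Holds (eq w) = eval w ≡ ε
      Holds (ne w) = eval w ≢ ε

      matches : Word → Word → Bool
      matches w v = trivial (w ++ inv v) ∨ trivial (w ++ v)

      matches-sound : ∀ w v → matches w v ≡ true → eval w ≡ eval v ⊎ eval w ≡ eval v ⁻¹
      matches-sound w v e with ∨-true {trivial (w ++ inv v)} e
      ... | inj₁ p = inj₁ (same w v p)
      ... | inj₂ p = inj₂ (inverseˡ-unique _ _ (trans (sym (eval-++ w v)) (trivial-sound (w ++ v) p)))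

      lookupFact : List Fact → Word → Maybe Bool
      lookupFact []          w = nothing
      lookupFact (eq v ∷ fs) w = if matches w v then just true else lookupFact fs w
      lookupFact (ne v ∷ fs) w = if matches w v then just false else lookupFact fs w

      lookupFact-sound : ∀ fs → All Holds fs → ∀ w b → lookupFact fs w ≡ just b →
                         (b ≡ true → eval w ≡ ε) × (b ≡ false → eval w ≢ ε)
      lookupFact-sound (eq v ∷ fs) (h ∷ hs) w b e with matches w v in m
      ... | false = lookupFact-sound fs hs w b e
      lookupFact-sound (eq v ∷ fs) (h ∷ hs) w .true refl | true =
        (λ _ → [ (λ p → trans p h) , (λ p → trans p (trans (cong _⁻¹ h) ε⁻¹≈ε)) ]′ (matches-sound w v m)) , λ ()
      lookupFact-sound (ne v ∷ fs) (h ∷ hs) w b e with matches w v in m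
      ... | false = lookupFact-sound fs hs w b e
      lookupFact-sound (ne v ∷ fs) (h ∷ hs) w .false refl | true =
        (λ ()) , λ _ z → h ([ (λ p → trans (sym p) z)
                            , (λ p → trans (sym (⁻¹-involutive _)) (trans (cong _⁻¹ (trans (sym p) z)) ε⁻¹≈ε)) ]′
                            (matches-sound w v m))

      short-lonely : Word → Bool
      short-lonely w = (length w ℕ.≤ᵇ 6) ∧ lonely n [] w

      short-lonely-sound : ∀ w → short-lonely w ≡ true → eval w ≢ ε
      short-lonely-sound w e = lonely-sound [] w
        (ℕₚ.≤ᵇ⇒≤ _ _ (subst T (sym (proj₁ (∧-true e))) _)) (proj₂ (∧-true e))

      rotate₁ : Word → Word
      rotate₁ []      = []
      rotate₁ (l ∷ w) = w ++ l ∷ []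

      eval-rotate₁ : ∀ w → eval w ≡ ε → eval (rotate₁ w) ≡ ε
      eval-rotate₁ []      e = e
      eval-rotate₁ (l ∷ w) e = trans (eval-++ w _)
        (trans (cong₂ _∙_ (inverseʳ-unique _ _ e) (identityʳ _)) (inverseˡ _))

      -- Reduction does not strip conjugation: in y x⁻¹ y x⁻¹ y⁻¹ no letter occurs once, but moving
      -- the first letter to the end leaves x⁻¹ y x⁻¹, where y does. One such turn suffices for the
      -- words that arise.
      nontrivial : Word → Bool
      nontrivial w = short-lonely (reduce w) ∨ short-lonely (reduce (rotate₁ (reduce w)))

      nontrivial-sound : ∀ w → nontrivial w ≡ true → eval w ≢ ε
      nontrivial-sound w e z with ∨-true {short-lonely (reduce w)} e
      ... | inj₁ p = short-lonely-sound (reduce w) p (trans (eval-reduce w) z)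
      ... | inj₂ p = short-lonely-sound (reduce (rotate₁ (reduce w))) p
        (trans (eval-reduce (rotate₁ (reduce w))) (eval-rotate₁ (reduce w) (trans (eval-reduce w) z)))

      distinct : ∀ v w → nontrivial (v ++ inv w) ≡ true → eval v ≢ eval w
      distinct v w e z = nontrivial-sound (v ++ inv w) e (trans (eval-quotient v w) (ε-quotient z))

      verdict : List Fact → Word → Maybe Bool
      verdict fs w = if trivial w then just true else (if nontrivial w then just false else lookupFact fs w)

      verdict-sound : ∀ fs → All Holds fs → ∀ w b → verdict fs w ≡ just b →
                      (b ≡ true → eval w ≡ ε) × (b ≡ false → eval w ≢ ε)
      verdict-sound fs hs w b e with trivial w in t
      verdict-sound fs hs w .true refl | true = (λ _ → trivial-sound w t) , λ ()
      ... | false with nontrivial w in u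
      verdict-sound fs hs w .false refl | false | true = (λ ()) , λ _ → nontrivial-sound w u
      ...   | false = lookupFact-sound fs hs w b e

-- Automorphisms of Cayley digraphs

module _ (G : FiniteGroup) where
  open FiniteGroup G

  infix 4 _≟_
  _≟_ : DecidableEquality Carrier
  _≟_ = via-injection (Inverse⇒Injection (↔-sym enum)) Finₚ._≟_

module CayleyDigraph (G : FiniteGroup) (P : FiniteGroup.Carrier G → Set) where
  open FiniteGroup G
  open IsGroup isGroup using (assoc; identityˡ; identityʳ; inverseˡ; inverseʳ)
  open GroupProperties (asGroup G)

  _⇢_ : Carrier → Carrier → Set
  x ⇢ y = P (y ∙ x ⁻¹)

  record Aut : Set where
    field
      to      : Carrier → Carrier
      from    : Carrier → Carrier
      to-from : ∀ x → to (from x) ≡ x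
      from-to : ∀ x → from (to x) ≡ x
      arc     : ∀ x y → x ⇢ y → to x ⇢ to y
      arc⁻    : ∀ x y → x ⇢ y → from x ⇢ from y
  open Aut public

  inverse : Aut → Aut
  inverse φ = record
    { to = from φ ; from = to φ ; to-from = from-to φ ; from-to = to-from φ ; arc = arc⁻ φ ; arc⁻ = arc φ }

  Fixed : Carrier → Set
  Fixed g = ∀ φ h → to φ (g ∙ h) ≡ g ∙ to φ h

  translate-quotient : ∀ x y g → (y ∙ g) ∙ (x ∙ g) ⁻¹ ≡ y ∙ x ⁻¹
  translate-quotient x y g = begin
    (y ∙ g) ∙ (x ∙ g) ⁻¹         ≡⟨ cong ((y ∙ g) ∙_) (⁻¹-anti-homo-∙ x g) ⟩
    (y ∙ g) ∙ (g ⁻¹ ∙ x ⁻¹)      ≡⟨ assoc _ _ _ ⟩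
    y ∙ (g ∙ (g ⁻¹ ∙ x ⁻¹))      ≡⟨ cong (y ∙_) (sym (assoc _ _ _)) ⟩
    y ∙ ((g ∙ g ⁻¹) ∙ x ⁻¹)      ≡⟨ cong (λ z → y ∙ (z ∙ x ⁻¹)) (inverseʳ g) ⟩
    y ∙ (ε ∙ x ⁻¹)               ≡⟨ cong (y ∙_) (identityˡ _) ⟩
    y ∙ x ⁻¹                     ∎
    where open ≡-Reasoning

  ⇢-translate : ∀ {x y} g → x ⇢ y → (x ∙ g) ⇢ (y ∙ g)
  ⇢-translate g = subst P (sym (translate-quotient _ _ g))

  normalise : Aut → Carrier → Aut
  normalise φ h = record
    { to      = λ x → to φ (x ∙ h) ∙ to φ h ⁻¹
    ; from    = λ x → from φ (x ∙ to φ h) ∙ h ⁻¹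
    ; to-from = λ x → trans (cong (λ z → to φ z ∙ to φ h ⁻¹) (cancel⁻¹ _ h))
                        (trans (cong (_∙ to φ h ⁻¹) (to-from φ _)) (cancel x _))
    ; from-to = λ x → trans (cong (λ z → from φ z ∙ h ⁻¹) (cancel⁻¹ _ (to φ h)))
                        (trans (cong (_∙ h ⁻¹) (from-to φ _)) (cancel x h))
    ; arc     = λ x y p → ⇢-translate (to φ h ⁻¹) (arc φ _ _ (⇢-translate h p))
    ; arc⁻    = λ x y p → ⇢-translate (h ⁻¹) (arc⁻ φ _ _ (⇢-translate (to φ h) p))
    }
    where
    cancel : ∀ x g → (x ∙ g) ∙ g ⁻¹ ≡ x
    cancel x g = trans (assoc _ _ _) (trans (cong (x ∙_) (inverseʳ g)) (identityʳ x))
    cancel⁻¹ : ∀ x g → (x ∙ g ⁻¹) ∙ g ≡ x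
    cancel⁻¹ x g = trans (assoc _ _ _) (trans (cong (x ∙_) (inverseˡ g)) (identityʳ x))

  Normal : Set
  Normal = Σ Aut λ φ → to φ ε ≡ ε

  inverseₙ : Normal → Normal
  inverseₙ (φ , e) = inverse φ , trans (cong (from φ) (sym e)) (from-to φ ε)

  -- Applied to `normalise φ h`, which fixes 1, the hypothesis reads φ(g h) φ(h)⁻¹ = g. Right
  -- translations being automorphisms, a statement at 1 becomes one at every `h`.
  fixed-from-normal : ∀ {g} → (∀ ((φ , _) : Normal) → to φ g ≡ g) → Fixed g
  fixed-from-normal {g} f φ h = begin
    to φ (g ∙ h)                            ≡⟨ sym (identityʳ _) ⟩
    to φ (g ∙ h) ∙ ε                        ≡⟨ cong (to φ (g ∙ h) ∙_) (sym (inverseˡ _)) ⟩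
    to φ (g ∙ h) ∙ (to φ h ⁻¹ ∙ to φ h)     ≡⟨ sym (assoc _ _ _) ⟩
    (to φ (g ∙ h) ∙ to φ h ⁻¹) ∙ to φ h     ≡⟨ cong (_∙ to φ h) (f (normalise φ h , normal)) ⟩
    g ∙ to φ h                              ∎
    where
    open ≡-Reasoning
    normal : to (normalise φ h) ε ≡ ε
    normal = trans (cong (λ z → to φ z ∙ to φ h ⁻¹) (identityˡ h)) (inverseʳ _)

  fixed-at : ∀ {g} → Fixed g → ((φ , _) : Normal) → to φ g ≡ g
  fixed-at {g} f (φ , e) = begin
    to φ g        ≡⟨ cong (to φ) (sym (identityʳ g)) ⟩
    to φ (g ∙ ε)  ≡⟨ f φ ε ⟩
    g ∙ to φ ε    ≡⟨ trans (cong (g ∙_) e) (identityʳ g) ⟩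
    g             ∎
    where open ≡-Reasoning

  fixed-∙ : ∀ {g h} → Fixed g → Fixed h → Fixed (g ∙ h)
  fixed-∙ {g} {h} f f′ φ k = begin
    to φ ((g ∙ h) ∙ k)  ≡⟨ cong (to φ) (assoc g h k) ⟩
    to φ (g ∙ (h ∙ k))  ≡⟨ f φ _ ⟩
    g ∙ to φ (h ∙ k)    ≡⟨ cong (g ∙_) (f′ φ k) ⟩
    g ∙ (h ∙ to φ k)    ≡⟨ sym (assoc _ _ _) ⟩
    (g ∙ h) ∙ to φ k    ∎
    where open ≡-Reasoning

  fixed-⁻¹ : ∀ {g} → Fixed g → Fixed (g ⁻¹)
  fixed-⁻¹ {g} f φ k = begin
    to φ (g ⁻¹ ∙ k)                  ≡⟨ sym (identityˡ _) ⟩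
    ε ∙ to φ (g ⁻¹ ∙ k)              ≡⟨ cong (_∙ to φ (g ⁻¹ ∙ k)) (sym (inverseˡ g)) ⟩
    (g ⁻¹ ∙ g) ∙ to φ (g ⁻¹ ∙ k)     ≡⟨ assoc _ _ _ ⟩
    g ⁻¹ ∙ (g ∙ to φ (g ⁻¹ ∙ k))     ≡⟨ cong (g ⁻¹ ∙_) (sym (f φ _)) ⟩
    g ⁻¹ ∙ to φ (g ∙ (g ⁻¹ ∙ k))     ≡⟨ cong (λ z → g ⁻¹ ∙ to φ z) (sym (assoc _ _ _)) ⟩
    g ⁻¹ ∙ to φ ((g ∙ g ⁻¹) ∙ k)     ≡⟨ cong (λ z → g ⁻¹ ∙ to φ (z ∙ k)) (inverseʳ g) ⟩
    g ⁻¹ ∙ to φ (ε ∙ k)              ≡⟨ cong (λ z → g ⁻¹ ∙ to φ z) (identityˡ k) ⟩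
    g ⁻¹ ∙ to φ k                    ∎
    where open ≡-Reasoning

  fixed-ε : Fixed ε
  fixed-ε φ k = trans (cong (to φ) (identityˡ k)) (sym (identityˡ _))

  -- The arc from v to u s is carried to an arc from v to u φ(s).
  fixed-transport : ∀ {u v} → Fixed u → Fixed v → ((φ , _) : Normal) → ∀ s →
                    P (u ∙ s ∙ v ⁻¹) → P (u ∙ to φ s ∙ v ⁻¹)
  fixed-transport {u} {v} fu fv (φ , e) s p =
    subst₂ (λ y x → P (y ∙ x ⁻¹)) (fu φ s) (fixed-at fv (φ , e)) (arc φ v (u ∙ s) p)

  -- If every element is fixed, then f(x) = f(x · 1) = x · f(1), so `f` is the right translation by
  -- f(1).
  admits : Decidable P → (∀ g → P g → ¬ P (g ⁻¹)) → (∀ g → Fixed g) → AdmitsORR G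
  admits P? anti fixed = S , (λ s p q → anti s (S⇒P p) (S⇒P q)) , regular , rigid
    where
    S : Carrier → Bool
    S g = does (P? g)
    S⇒P : ∀ {g} → S g ≡ true → P g
    S⇒P {g} e with P? g
    ... | yes p = p
    P⇒S : ∀ {g} → P g → S g ≡ true
    P⇒S {g} p = dec-true (P? g) p
    regular : ∀ g → IsCayAut G S (λ x → x ∙ g)
    regular g = ((λ {x} {y} e → ∙-cancelʳ g x y e)
                , λ y → y ∙ g ⁻¹ , λ { refl → trans (assoc _ _ _) (trans (cong (y ∙_) (inverseˡ g)) (identityʳ y)) })
              , λ x y → mk⇔ (subst (λ z → S z ≡ true) (sym (translate-quotient x y g)))
                            (subst (λ z → S z ≡ true) (translate-quotient x y g))
    rigid : ∀ f → IsCayAut G S f → ∃ λ g → ∀ x → f x ≡ x ∙ g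
    rigid f ((injective , surjective) , arcs) = f ε , λ x →
      trans (cong f (sym (identityʳ x))) (fixed x φ ε)
      where
      f⁻¹ : Carrier → Carrier
      f⁻¹ y = proj₁ (surjective y)
      f-f⁻¹ : ∀ y → f (f⁻¹ y) ≡ y
      f-f⁻¹ y = proj₂ (surjective y) refl
      φ : Aut
      φ = record
        { to = f ; from = f⁻¹ ; to-from = f-f⁻¹ ; from-to = λ x → injective (f-f⁻¹ (f x))
        ; arc = λ x y p → S⇒P (Equivalence.to (arcs x y) (P⇒S p))
        ; arc⁻ = λ x y p → S⇒P (Equivalence.from (arcs _ _)
            (P⇒S (subst₂ _⇢_ (sym (f-f⁻¹ x)) (sym (f-f⁻¹ y)) p))) }

-- Symmetries of the digraph induced on a connection set

record Bisimulation {V : Set} (E : V → V → Set) (R : V → V → Set) : Set where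
  field
    out : ∀ {v w v′} → R v w → E v v′ → ∃ λ w′ → R v′ w′ × E w w′
    in′ : ∀ {v w v′} → R v w → E v′ v → ∃ λ w′ → R v′ w′ × E w′ w
    fun : ∀ {v w w′} → R v w → R v w′ → w ≡ w′

-- R v w stands for: the automorphism maps v to w.
record Symmetry {V : Set} (E : V → V → Set) (R : V → V → Set) : Set where
  field
    forward  : Bisimulation E R
    backward : Bisimulation E (λ w v → R v w)
  open Bisimulation forward public
  open Bisimulation backward public renaming (out to out⁻; in′ to in⁻; fun to inj)

module ConnectionSet (G : FiniteGroup) {V : Set} (Valid : V → Set) (val : V → FiniteGroup.Carrier G) where
  open FiniteGroup G
  open IsGroup isGroup using (assoc; identityʳ; inverseˡ; inverseʳ)
  open GroupProperties (asGroup G)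

  P : Carrier → Set
  P g = ∃ λ v → Valid v × val v ≡ g

  open CayleyDigraph G P public

  -- `E` is exactly the induced subdigraph: val u ∙ val v ≡ val w with `u` valid says that there is
  -- an arc from `val v` to `val w`. Vertices are names rather than group elements, so that rigidity
  -- can be proved by matching on constructors.
  record Induced (E : V → V → Set) : Set where
    field
      complete  : ∀ {u v w} → Valid u → Valid v → Valid w → val u ∙ val v ≡ val w → E v w
      sound     : ∀ {v w} → E v w → Valid v × Valid w × ∃ λ u → Valid u × val u ∙ val v ≡ val w
      injective : ∀ {v w} → Valid v → Valid w → val v ≡ val w → v ≡ w
      oriented  : ∀ {v w} → Valid v → Valid w → val v ∙ val w ≢ ε

    antisymmetric : ∀ g → P g → ¬ P (g ⁻¹)
    antisymmetric g (v , p , refl) (w , q , e) = oriented p q (trans (cong (val v ∙_) e) (inverseʳ _))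

    no-involution : ∀ g → g ∙ g ≡ ε → ¬ P g
    no-involution g e p = antisymmetric g p (subst P (inverseˡ-unique g g e) p)

    Maps : Normal → V → V → Set
    Maps (φ , _) v w = Valid v × Valid w × to φ (val v) ≡ val w

    -- The connection set is the out-neighbourhood of 1, hence preserved by every automorphism
    -- fixing 1.
    image : ((φ , _) : Normal) → ∀ {v} → Valid v → ∃ λ w → Valid w × val w ≡ to φ (val v)
    image (φ , e) {v} p = subst P (trans (cong (to φ (val v) ∙_) (trans (cong _⁻¹ e) ε⁻¹≈ε)) (identityʳ _))
      (arc φ ε (val v) (v , p , sym (trans (cong (val v ∙_) ε⁻¹≈ε) (identityʳ _))))

    image-maps : (φ : Normal) → ∀ {v} → Valid v → ∃ λ w → Maps φ v w
    image-maps φ p with image φ p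
    ... | w , q , e = w , p , q , sym e

    private
      cancelled : ∀ x y → (y ∙ x ⁻¹) ∙ x ≡ y
      cancelled x y = trans (assoc _ _ _) (trans (cong (y ∙_) (inverseˡ x)) (identityʳ y))

      quotient : ∀ {u x y} → u ∙ x ≡ y → u ≡ y ∙ x ⁻¹
      quotient {u} {x} refl = sym (trans (assoc _ _ _) (trans (cong (u ∙_) (inverseʳ x)) (identityʳ u)))

    maps-arc : (φ : Normal) → ∀ {v w v′ w′} → Maps φ v w → Maps φ v′ w′ → E v v′ → E w w′
    maps-arc (φ , e) (p , q , f) (p′ , q′ , f′) a with sound a
    ... | _ , _ , u , pu , g with arc φ _ _ (u , pu , quotient g)
    ... | u′ , pu′ , g′ = complete pu′ q q′
          (trans (cong₂ _∙_ (trans g′ (cong₂ (λ y x → y ∙ x ⁻¹) f′ f)) refl) (cancelled _ _))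

    bisimulation : (φ : Normal) → Bisimulation E (Maps φ)
    bisimulation φ = record
      { out = λ m a → let (w , m′) = image-maps φ (proj₁ (proj₂ (sound a))) in w , m′ , maps-arc φ m m′ a
      ; in′ = λ m a → let (w , m′) = image-maps φ (proj₁ (sound a)) in w , m′ , maps-arc φ m′ m a
      ; fun = λ (_ , q , e) (_ , q′ , e′) → injective q q′ (trans (sym e) e′) }

    maps-inverse : (φ : Normal) → ∀ {v w} → Maps φ v w → Maps (inverseₙ φ) w v
    maps-inverse (φ , _) (p , q , e) = q , p , trans (cong (from φ) (sym e)) (from-to φ _)

    maps-inverse⁻ : (φ : Normal) → ∀ {v w} → Maps (inverseₙ φ) w v → Maps φ v w
    maps-inverse⁻ (φ , _) (q , p , e) = p , q , trans (cong (to φ) (sym e)) (to-from φ _)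

    symmetry : (φ : Normal) → Symmetry E (Maps φ)
    symmetry φ = record
      { forward  = bisimulation φ
      ; backward = record
        { out = λ m a → let (w , m′ , b) = Bisimulation.out B (maps-inverse φ m) a in w , maps-inverse⁻ φ m′ , b
        ; in′ = λ m a → let (w , m′ , b) = Bisimulation.in′ B (maps-inverse φ m) a in w , maps-inverse⁻ φ m′ , b
        ; fun = λ m m′ → Bisimulation.fun B (maps-inverse φ m) (maps-inverse φ m′) } }
      where B = bisimulation (inverseₙ φ)

    fixed-vertex : ∀ v → Valid v → (∀ φ {w} → Maps φ v w → w ≡ v) → Fixed (val v)
    fixed-vertex v p f = fixed-from-normal λ φ → let (w , q , e) = image φ p in
      trans (sym e) (cong val (f φ (p , q , sym e)))

    pinned : ∀ v → Valid v → (∀ φ → Maps φ v v) → Fixed (val v)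
    pinned v p f = fixed-from-normal λ φ → proj₂ (proj₂ (f φ))

    maps-fixed : ∀ v → Valid v → Fixed (val v) → ∀ φ → Maps φ v v
    maps-fixed v p f φ = p , p , fixed-at f φ

-- Rigidity of a path with pendant quotients

data Vertex : Set where
  va vb : ℕ → Vertex

-- va i stands for the generator aᵢ and vb e for the quotient of the ends of the edge tail e → head e.
data LocalArc (m : ℕ) (tail head : ℕ → ℕ) (C I P : ℕ → Set) : Vertex → Vertex → Set where
  along : ∀ {e} → e < m → LocalArc m tail head C I P (va (tail e)) (va (head e))
  into  : ∀ {e} → e < m → C e → LocalArc m tail head C I P (vb e) (va (head e))
  outof : ∀ {e} → e < m → I e → LocalArc m tail head C I P (va (head e)) (vb e)
  back  : ∀ {e} → e < m → P e → LocalArc m tail head C I P (vb e) (va (tail e))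

pred-< : ∀ {k m} → suc k < m → k < m
pred-< p = ℕₚ.<-trans (ℕₚ.n<1+n _) p

module StraightPath {m : ℕ} {C I P : ℕ → Set} (exclusive : ∀ e → e < m → C e → ¬ I e)
  {R : Vertex → Vertex → Set} (symmetric : Symmetry (LocalArc m (λ e → e) suc C I P) R) where
  open Symmetry symmetric

  E : Vertex → Vertex → Set
  E = LocalArc m (λ e → e) suc C I P

  -- a₀ is recognised as the only vertex whose sole in-neighbour is a source. That in-neighbour is
  -- b₀, which nothing enters without `I 0`; a later generator is always entered from its
  -- predecessor as well.
  start-single-back : P 0 → ¬ I 0 → 0 < m → ∀ {w} → R (va 0) w → w ≡ va 0
  start-single-back p ¬i 0<m {w} r with in′ r (back 0<m p) | out r (along 0<m)
  ... | w₀ , r₀ , e₀ | _ = cases e₀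
    where
    source : ∀ {u} → ¬ E u w₀
    source e with in⁻ r₀ e
    ... | _ , _ , outof _ i = ¬i i
    only : ∀ {u} → E u w → w₀ ≡ u
    only e with in⁻ r e
    ... | _ , r′ , back _ _ = fun r₀ r′
    cases : E w₀ w → w ≡ va 0
    cases (along {zero} l)  = ⊥-elim (source (back l p))
    cases (along {suc k} l) = ⊥-elim (source (along (pred-< l)))
    cases (into l _) with only (along l)
    ... | ()
    cases (outof l _) = ⊥-elim (source (along l))
    cases (back {zero} _ _)  = refl
    cases (back {suc k} l _) with only (along (pred-< l))
    ... | ()

  -- The one possible exchange: under these conditions b₁ is, like a₀, a source whose only arc goes
  -- to a₁.
  Exchanged : Vertex → Set
  Exchanged w = w ≡ vb 1 × 1 < m × P 1 × ¬ C 1 × ¬ I 1 × R (va 1) (va 1)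

  -- Now a₀ is a source with the single out-neighbour a₁, and a₁ is entered only from a₀ and
  -- possibly b₁. The image of this configuration is compared with each kind of arc.
  start-no-back : ¬ C 0 → ¬ P 0 → 0 < m → ∀ {w} → R (va 0) w → w ≡ va 0 ⊎ Exchanged w
  start-no-back ¬c ¬p 0<m {w} r with out r (along 0<m)
  ... | w₁ , r₁ , e₁ = cases e₁
    where
    start-source : ∀ {u} → ¬ E u (va 0)
    start-source (back _ p) = ¬p p
    source : ∀ {u} → ¬ E u w
    source e = start-source (proj₂ (proj₂ (in⁻ r e)))
    only : ∀ {u} → E w u → w₁ ≡ u
    only e with out⁻ r e
    ... | _ , r′ , along _ = fun r₁ r′
    -- The arc into the image of b₁ comes from the arc a₂ → b₁, and a₁ → a₂ then forces an arc from w₁.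
    no-triangle : ∀ {k} → ¬ E w₁ (va k) → R (vb 1) (va (suc k)) → E (va k) (va (suc k)) → 1 < m → ⊥
    no-triangle ¬e r′ e 1<m with in⁻ r′ e
    ... | _ , r₂ , outof _ _ with out r₁ (along 1<m)
    ...   | _ , r₂′ , e₂ rewrite fun r₂ r₂′ = ¬e e₂
    cases : E w w₁ → w ≡ va 0 ⊎ Exchanged w
    cases (along {zero} l)  = inj₁ refl
    cases (along {suc k} l) = ⊥-elim (source (along (pred-< l)))
    cases (into {zero} _ c) = ⊥-elim (¬c c)
    cases (into {suc k} l c) with in⁻ r₁ (along l)
    ... | _ , r′ , along _ with fun r r′
    ...   | ()
    cases (into {suc k} l c) | _ , r′ , into _ c₀ = ⊥-elim (¬c c₀)
    cases (into {suc k} l c) | _ , r′ , back 1<m _ = ⊥-elim (no-triangle (λ ()) r′ (along (pred-< l)) 1<m)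
    cases (outof l _) = ⊥-elim (source (along l))
    cases (back {zero} _ p) = ⊥-elim (¬p p)
    cases (back {suc k} l p) with in⁻ r₁ (along (pred-< l))
    ... | _ , r′ , along _ with fun r r′
    ...   | ()
    cases (back {suc k} l p) | _ , r′ , into _ c₀ = ⊥-elim (¬c c₀)
    cases (back {suc (suc k)} l p) | _ , r′ , back 1<m _ =
      ⊥-elim (no-triangle (λ ()) r′ (along (pred-< (pred-< l))) 1<m)
    cases (back {suc zero} l p) | _ , r′ , back 1<m _ =
      inj₂ (refl , l , p , (λ c → distinct (only (into l c))) , (λ i → source (outof l i)) , r₁)
      where
      distinct : va 1 ≢ va 2
      distinct ()

  second-fixed : ¬ C 0 → ¬ P 0 → 0 < m → ∀ {w} → R (va 0) w → w ≡ va 0 ⊎ Exchanged w → R (va 1) (va 1)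
  second-fixed ¬c ¬p 0<m r (inj₁ refl) with out r (along 0<m)
  ... | _ , r₁ , along _ = r₁
  second-fixed ¬c ¬p 0<m r (inj₂ (_ , _ , _ , _ , _ , r₁)) = r₁

  -- Besides a₂ only b₀ can follow a₁. If it does, it is a sink under these hypotheses, whereas a₂
  -- has an arc to a₃ once the path is long enough.
  third-fixed : ¬ C 0 → ¬ P 0 → 1 < m → ¬ I 0 ⊎ 2 < m → R (va 1) (va 1) → R (va 2) (va 2)
  third-fixed ¬c ¬p 1<m s r₁ with out r₁ (along 1<m)
  ... | _ , r₂ , along _ = r₂
  ... | _ , r₂ , outof _ i with s
  ...   | inj₁ ¬i  = ⊥-elim (¬i i)
  ...   | inj₂ 2<m with out r₂ (along 2<m)
  ...     | _ , _ , into _ c = ⊥-elim (¬c c)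
  ...     | _ , _ , back _ p = ⊥-elim (¬p p)

  -- a₀ → a₁ → b₀ → a₀ is a directed triangle in which a₀ is entered from b₀ alone and a₁ has the
  -- further successor a₂. A competing triangle with these features can only lie over edge 1.
  start-triangle : ¬ C 0 → P 0 → I 0 → 1 < m → ∀ {w} → R (va 0) w → w ≡ va 0 ⊎ (m ≡ 2 × P 1 × I 1)
  start-triangle ¬c p i 1<m {w} r with out r (along 0<m) | in′ r (back 0<m p)
    where 0<m = pred-< 1<m
  ... | w₁ , r₁ , e₁ | w₂ , r₂ , e₂ = cases e₁ e₂
    where
    only-in : ∀ {u} → E u w → w₂ ≡ u
    only-in e with in⁻ r e
    ... | _ , r′ , back _ _ = fun r₂ r′
    e₁₂ : E w₁ w₂
    e₁₂ with out r₁ (outof (pred-< 1<m) i)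
    ... | _ , r₂′ , e rewrite fun r₂ r₂′ = e
    third : ∃ λ u → R (va 2) u × E w₁ u
    third = out r₁ (along 1<m)
    third≢w₂ : ¬ R (va 2) w₂
    third≢w₂ r₃ with inj r₂ r₃
    ... | ()
    cases : E w w₁ → E w₂ w → w ≡ va 0 ⊎ (m ≡ 2 × P 1 × I 1)
    cases (along {zero} l) _  = inj₁ refl
    cases (along {suc k} l) _ with only-in (along (pred-< l)) | e₁₂
    ... | refl | ()
    cases (into l c) (outof _ i′) = ⊥-elim (exclusive _ l c i′)
    cases (outof l i′) _ with only-in (along l) | third
    ... | refl | _ , r₃ , into _ c = ⊥-elim (exclusive _ l c i′)
    ... | refl | _ , r₃ , back _ _ = ⊥-elim (third≢w₂ r₃)
    cases (back {zero} l p′) (outof _ _) with third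
    ... | _ , r₃ , along _  = ⊥-elim (third≢w₂ r₃)
    cases (back {suc k} l p′) (outof _ i′) with in⁻ r₁ (along (pred-< l))
    ... | _ , r′ , along _ with fun r r′
    ...   | ()
    cases (back {suc k} l p′) (outof _ i′) | _ , r′ , into _ c₀ = ⊥-elim (¬c c₀)
    cases (back {suc (suc k)} l p′) (outof _ i′) | _ , r′ , back _ _
      with in⁻ r′ (along (pred-< (pred-< l))) | third
    ... | _ , r₃′ , outof _ _ | _ , r₃ , e₃ with fun r₃ r₃′ | e₃
    ...   | refl | ()
    cases (back {suc zero} l p′) (outof _ i′) | _ , r′ , back _ _ with third
    ... | _ , r₃ , along _   = ⊥-elim (third≢w₂ r₃)
    ... | _ , r₃ , outof _ _ = inj₂ (ℕₚ.≤-antisym (ℕₚ.≮⇒≥ short) 1<m , p′ , i′)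
      where
      -- a₂ is mapped to b₀ by now, and the only successor a₀ of b₀ is already the image of b₁, so
      -- nothing is left for a₃.
      short : ¬ 2 < m
      short 2<m with out r₃ (along 2<m)
      ... | _ , _  , into _ c = ¬c c
      ... | _ , r₄ , back _ _ with inj r₄ r′
      ...   | ()

  next-fixed : ∀ {k} → suc k < m → R (va (suc k)) (va (suc k)) → R (vb k) (vb k) →
               R (va (suc (suc k))) (va (suc (suc k)))
  next-fixed l r₁ rb with out r₁ (along l)
  ... | _ , r₂ , along _   = r₂
  ... | _ , r₂ , outof _ _ with inj r₂ rb
  ...   | ()

-- This is `LocalArc` for `forked-tail` and `forked-head` with edge 0 split off, since indices such
-- as `va (forked-tail e)` would block unification in the case analyses.
data ForkedArc (m : ℕ) (C I P : ℕ → Set) : Vertex → Vertex → Set where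
  along₀ : ForkedArc m C I P (va 1) (va 0)
  into₀  : C 0 → ForkedArc m C I P (vb 0) (va 0)
  outof₀ : I 0 → ForkedArc m C I P (va 0) (vb 0)
  back₀  : P 0 → ForkedArc m C I P (vb 0) (va 1)
  along  : ∀ {e} → suc e < m → ForkedArc m C I P (va (suc e)) (va (suc (suc e)))
  into   : ∀ {e} → suc e < m → C (suc e) → ForkedArc m C I P (vb (suc e)) (va (suc (suc e)))
  outof  : ∀ {e} → suc e < m → I (suc e) → ForkedArc m C I P (va (suc (suc e))) (vb (suc e))
  back   : ∀ {e} → suc e < m → P (suc e) → ForkedArc m C I P (vb (suc e)) (va (suc e))

module ForkedPath {m : ℕ} {C I P : ℕ → Set} (exclusive : ∀ e → e < m → C e → ¬ I e)
  {R : Vertex → Vertex → Set} (symmetric : Symmetry (ForkedArc m C I P) R) where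
  open Symmetry symmetric

  E : Vertex → Vertex → Set
  E = ForkedArc m C I P

  -- a₁ is the only vertex with two non-adjacent successors, one of which is a sink.
  fork-fixed : C 0 → 2 < m → ∀ {w} → R (va 1) w → w ≡ va 1
  fork-fixed c 2<m {w} r with out r along₀ | out r (along (pred-< 2<m))
  ... | w₀ , r₀ , e₀ | w₂ , r₂ , e₂ = cases e₀ e₂
    where
    distinct : w₀ ≢ w₂
    distinct refl with inj r₀ r₂
    ... | ()
    nonadjacent : ¬ E w₀ w₂
    nonadjacent e with out⁻ r₀ e
    ... | _ , _ , outof₀ i = exclusive 0 (pred-< (pred-< 2<m)) c i
    nonadjacent⁻ : ¬ E w₂ w₀
    nonadjacent⁻ e with in⁻ r₀ e
    ... | _ , r′ , along₀ with inj r₂ r′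
    ...   | ()
    nonadjacent⁻ e | _ , r′ , into₀ _ with inj r₂ r′
    ...   | ()
    cases : E w w₀ → E w w₂ → w ≡ va 1
    cases along₀ _ = refl
    cases (into₀ _) (into₀ _) = ⊥-elim (distinct refl)
    cases (into₀ _) (back₀ _) = ⊥-elim (nonadjacent⁻ along₀)
    cases (outof₀ i) _ = ⊥-elim (exclusive 0 (pred-< (pred-< 2<m)) c i)
    cases (back₀ _) (into₀ _) = ⊥-elim (nonadjacent along₀)
    cases (back₀ _) (back₀ _) = ⊥-elim (distinct refl)
    cases (into l _) (into _ _) = ⊥-elim (distinct refl)
    cases (into l _) (back _ _) = ⊥-elim (nonadjacent⁻ (along l))
    cases (back l _) (into _ _) = ⊥-elim (nonadjacent (along l))
    cases (back l _) (back _ _) = ⊥-elim (distinct refl)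
    cases (along {zero} _) _ = refl
    cases (along {suc k} l) (along _) = ⊥-elim (distinct refl)
    -- The image of a₂ would be a quotient, and the arc a₂ → a₃ would carry a₃ to a predecessor of
    -- the image of a₁, although a₃ has no arc to a₁.
    cases (along {suc k} l) (outof l′ i) with out r₂ (along 2<m)
    ... | _ , _  , into _ c′ = ⊥-elim (exclusive _ l′ c′ i)
    ... | _ , r₃ , back _ _ with out⁻ r₃ (along (pred-< l))
    ...   | _ , r′ , e with inj r r′ | e
    ...     | refl | ()
    -- The image of a₀ would be a quotient entered from the image of a₁ alone, but b₀ enters a₀ too.
    cases (outof l i) _ with in′ r₀ (into₀ c)
    ... | _ , r′ , outof _ _ with inj r r′
    ...   | ()

  -- The successors of a₁ are a₀ and a₂. The latter leads on to a₃, whereas a₀ is a sink because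
  -- `C 0` excludes `I 0`.
  left-fixed : C 0 → 2 < m → R (va 1) (va 1) → R (va 0) (va 0) × R (va 2) (va 2)
  left-fixed c 2<m r₁ with out r₁ along₀ | out r₁ (along (pred-< 2<m))
  ... | _ , r₀ , along₀  | _ , r₂ , along _ = r₀ , r₂
  ... | _ , r₀ , along₀  | _ , r₂ , along₀ with inj r₀ r₂
  ...   | ()
  left-fixed c 2<m r₁ | _ , r₀ , along _ | _ , r₂ , along _ with inj r₀ r₂
  ...   | ()
  left-fixed c 2<m r₁ | _ , r₀ , along _ | _ , r₂ , along₀ with out r₂ (along 2<m)
  ...   | _ , _ , outof₀ i = ⊥-elim (exclusive 0 (pred-< (pred-< 2<m)) c i)

  next-fixed : ∀ {k} → suc (suc k) < m → R (va (suc (suc k))) (va (suc (suc k))) →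
               R (vb (suc k)) (vb (suc k)) → R (va (suc (suc (suc k)))) (va (suc (suc (suc k))))
  next-fixed l r₁ rb with out r₁ (along l)
  ... | _ , r₂ , along _   = r₂
  ... | _ , r₂ , outof _ _ with inj r₂ rb
  ...   | ()

-- Five-product avoidance in terms of words

module _ (G : FiniteGroup) where
  open FiniteGroup G
  open IsGroup isGroup using (assoc; identityˡ; identityʳ)
  open GroupProperties (asGroup G)

  order>2⇒≢ε : ∀ {g} → OrderGT2 g → g ≢ ε
  order>2⇒≢ε o refl with o 1 (z<s , identityʳ ε , λ { zero () _ ; (suc j) _ (s≤s ()) })
  ... | s≤s ()

  order>2⇒square≢ε : ∀ {g} → OrderGT2 g → g ∙ g ≢ ε
  order>2⇒square≢ε {g} o e with o 2 (z<s , trans (cong (g ∙_) (identityʳ g)) e , below)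
    where
    below : ∀ j → 0 < j → j < 2 → pow g j ≢ ε
    below (suc zero)    _ _ h = order>2⇒≢ε o (trans (sym (identityʳ g)) h)
    below (suc (suc _)) _ (s≤s (s≤s ()))
  ... | s≤s (s≤s ())

  module Tuple {ℓ : ℕ} (a : Fin ℓ → Carrier) (a-injective : Injective _≡_ _≡_ a)
    (avoiding : FiveProductAvoiding G a) (a-order : ∀ i → OrderGT2 (a i)) where

    A : ℕ → Carrier
    A i with i ℕ.<? ℓ
    ... | yes i<ℓ = a (Fin.fromℕ< i<ℓ)
    -- The default has to be 1, which avoidance admits as a factor, so that indices beyond the tuple
    -- are harmless.
    ... | no _    = ε

    A-toℕ : ∀ i → A (Fin.toℕ i) ≡ a i
    A-toℕ i with Fin.toℕ i ℕ.<? ℓ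
    ... | yes p = cong a (Finₚ.fromℕ<-toℕ i p)
    ... | no ¬p = ⊥-elim (¬p (Finₚ.toℕ<n i))

    open GroupWords G A

    A-cases : ∀ i → InT G a (A i) ⊎ (A i ≡ ε)
    A-cases i with i ℕ.<? ℓ
    ... | yes p = inj₁ (_ , refl)
    ... | no _  = inj₂ refl

    A-InT : ∀ k → k < ℓ → InT G a (A k)
    A-InT k k<ℓ with k ℕ.<? ℓ
    ... | yes p = _ , refl
    ... | no ¬p = ⊥-elim (¬p k<ℓ)

    A≢ε : ∀ k → k < ℓ → A k ≢ ε
    A≢ε k k<ℓ e with A-InT k k<ℓ
    ... | i , f = order>2⇒≢ε (a-order i) (trans f e)

    A-square : ∀ k → k < ℓ → A k ∙ A k ≢ ε
    A-square k k<ℓ e with A-InT k k<ℓ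
    ... | i , f = order>2⇒square≢ε (a-order i) (trans (cong₂ _∙_ f f) e)

    A-injective : ∀ i k → k < ℓ → A k ≡ A i → k ≡ i
    A-injective i k k<ℓ e with k ℕ.<? ℓ | i ℕ.<? ℓ
    ... | no ¬p | _     = ⊥-elim (¬p k<ℓ)
    ... | yes p | no _  = ⊥-elim (order>2⇒≢ε (a-order _) e)
    ... | yes p | yes q = trans (sym (Finₚ.toℕ-fromℕ< p)) (trans (cong Fin.toℕ (a-injective e)) (Finₚ.toℕ-fromℕ< q))

    A≢A⁻¹ : ∀ i k → k < ℓ → A k ≢ A i ⁻¹
    A≢A⁻¹ i k k<ℓ e with A-cases i
    ... | inj₂ f = A≢ε k k<ℓ (trans e (trans (cong _⁻¹ f) ε⁻¹≈ε))
    ... | inj₁ p = proj₁ avoiding (A i) p (subst (InT G a) e (A-InT k k<ℓ))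

    -- Avoidance speaks of exactly five factors; `first` and `rest` read a shorter word as padded by
    -- 1.
    first : Word → Carrier
    first []      = ε
    first (l ∷ _) = ⟦ l ⟧

    rest : Word → Word
    rest []      = []
    rest (_ ∷ w) = w

    eval-first : ∀ w → eval w ≡ first w ∙ eval (rest w)
    eval-first []      = sym (identityˡ ε)
    eval-first (_ ∷ _) = refl

    first-InT±1 : ∀ w → InT±1 G a (first w)
    first-InT±1 []          = inj₁ refl
    first-InT±1 (pos i ∷ _) with A-cases i
    ... | inj₁ p = inj₂ (inj₁ p)
    ... | inj₂ e = inj₁ e
    first-InT±1 (neg i ∷ _) with A-cases i
    ... | inj₁ p = inj₂ (inj₂ (subst (InT G a) (sym (⁻¹-involutive _)) p))
    ... | inj₂ e = inj₁ (trans (cong _⁻¹ e) ε⁻¹≈ε)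

    first-index : ∀ k → k < ℓ → ∀ w → A k ≡ first w ⊎ A k ≡ first w ⁻¹ → k ∈ indices w
    first-index k l []          (inj₁ e) = ⊥-elim (A≢ε k l e)
    first-index k l []          (inj₂ e) = ⊥-elim (A≢ε k l (trans e ε⁻¹≈ε))
    first-index k l (pos i ∷ w) (inj₁ e) = here (A-injective i k l e)
    first-index k l (pos i ∷ w) (inj₂ e) = ⊥-elim (A≢A⁻¹ i k l e)
    first-index k l (neg i ∷ w) (inj₁ e) = ⊥-elim (A≢A⁻¹ i k l e)
    first-index k l (neg i ∷ w) (inj₂ e) = here (A-injective i k l (trans e (⁻¹-involutive _)))

    rest-index : ∀ {k} w → k ∈ indices (rest w) → k ∈ indices w
    rest-index (_ ∷ _) p = there p

    rest-length : ∀ {n} w → length w ≤ suc n → length (rest w) ≤ n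
    rest-length []      _       = z≤n
    rest-length (_ ∷ _) (s≤s p) = p

    separated-A : Separated ℓ
    separated-A = record { separated = sep ; square = A-square }
      where
      sep : ∀ k → k < ℓ → ∀ w → length w ≤ 5 → eval w ≡ A k → k ∈ indices w
      sep k k<ℓ w₀ len e with proj₂ avoiding (first w₀) (first w₁) (first w₂) (first w₃) (first w₄)
          (first-InT±1 w₀) (first-InT±1 w₁) (first-InT±1 w₂) (first-InT±1 w₃) (first-InT±1 w₄)
          (A k) (A-InT k k<ℓ) (trans (sym product) e)
        where
        w₁ = rest w₀
        w₂ = rest w₁
        w₃ = rest w₂
        w₄ = rest w₃
        w₅ = rest w₄
        empty : ∀ w → length w ≤ 0 → eval w ≡ ε
        empty [] _ = refl
        product : eval w₀ ≡ first w₀ ∙ first w₁ ∙ first w₂ ∙ first w₃ ∙ first w₄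
        product = begin
          eval w₀  ≡⟨ eval-first w₀ ⟩
          first w₀ ∙ eval w₁  ≡⟨ cong (first w₀ ∙_) (eval-first w₁) ⟩
          first w₀ ∙ (first w₁ ∙ eval w₂)  ≡⟨ sym (assoc _ _ _) ⟩
          first w₀ ∙ first w₁ ∙ eval w₂  ≡⟨ cong ((first w₀ ∙ first w₁) ∙_) (eval-first w₂) ⟩
          first w₀ ∙ first w₁ ∙ (first w₂ ∙ eval w₃)  ≡⟨ sym (assoc _ _ _) ⟩
          first w₀ ∙ first w₁ ∙ first w₂ ∙ eval w₃  ≡⟨ cong ((first w₀ ∙ first w₁ ∙ first w₂) ∙_) (eval-first w₃) ⟩
          first w₀ ∙ first w₁ ∙ first w₂ ∙ (first w₃ ∙ eval w₄)  ≡⟨ sym (assoc _ _ _) ⟩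
          first w₀ ∙ first w₁ ∙ first w₂ ∙ first w₃ ∙ eval w₄  ≡⟨ cong ((first w₀ ∙ first w₁ ∙ first w₂ ∙ first w₃) ∙_) (eval-first w₄) ⟩
          first w₀ ∙ first w₁ ∙ first w₂ ∙ first w₃ ∙ (first w₄ ∙ eval w₅)
            ≡⟨ cong ((first w₀ ∙ first w₁ ∙ first w₂ ∙ first w₃) ∙_) (trans (cong (first w₄ ∙_) (empty w₅ (rest-length w₄ (rest-length w₃
                 (rest-length w₂ (rest-length w₁ (rest-length w₀ len))))))) (identityʳ _)) ⟩
          first w₀ ∙ first w₁ ∙ first w₂ ∙ first w₃ ∙ first w₄ ∎
          where open ≡-Reasoning
      ... | here p = first-index k k<ℓ w₀ p
      ... | there (here p) = rest-index w₀ (first-index k k<ℓ _ p)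
      ... | there (there (here p)) = rest-index w₀ (rest-index (rest w₀) (first-index k k<ℓ _ p))
      ... | there (there (there (here p))) =
        rest-index w₀ (rest-index (rest w₀) (rest-index (rest (rest w₀)) (first-index k k<ℓ _ p)))
      ... | there (there (there (there (here p)))) =
        rest-index w₀ (rest-index (rest w₀) (rest-index (rest (rest w₀))
          (rest-index (rest (rest (rest w₀))) (first-index k k<ℓ _ p))))

  relabel : (ℕ → ℕ) → Letter → Letter
  relabel π (pos i) = pos (π i)
  relabel π (neg i) = neg (π i)

  module _ (ρ : ℕ → Carrier) (π : ℕ → ℕ) where
    private
      module W  = GroupWords G ρ
      module W′ = GroupWords G (λ i → ρ (π i))

    eval-relabel : ∀ w → W.eval (map (relabel π) w) ≡ W′.eval w
    eval-relabel []          = refl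
    eval-relabel (pos i ∷ w) = cong (_ ∙_) (eval-relabel w)
    eval-relabel (neg i ∷ w) = cong (_ ∙_) (eval-relabel w)

    indices-relabel : ∀ w → indices (map (relabel π) w) ≡ map π (indices w)
    indices-relabel []          = refl
    indices-relabel (pos i ∷ w) = cong (_ ∷_) (indices-relabel w)
    indices-relabel (neg i ∷ w) = cong (_ ∷_) (indices-relabel w)

    reindex : ∀ {n n′} → (∀ {i j} → π i ≡ π j → i ≡ j) → (∀ {k} → k < n′ → π k < n) →
              W.Separated n → W′.Separated n′
    reindex π-injective below S = record
      { separated = λ k k<n w len e → unlabel k w (S.separated (π k) (below k<n) (map (relabel π) w)
          (subst (_≤ 5) (sym (Listₚ.length-map _ w)) len) (trans (eval-relabel w) e))
      ; square = λ k k<n → S.square (π k) (below k<n) }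
      where
      module S = W.Separated S
      unlabel : ∀ k w → π k ∈ indices (map (relabel π) w) → k ∈ indices w
      unlabel k w p with ∈-map⁻ π (subst (π k ∈_) (indices-relabel w) p)
      ... | j , q , e = subst (_∈ indices w) (sym (π-injective e)) q

-- The path positions involved in a vertex, that is the indices in its word, regardless of the
-- orientation of the edge.
data Meets (k : ℕ) : Vertex → Set where
  at-vertex : Meets k (va k)
  at-lower  : Meets k (vb k)
  at-upper  : ∀ {e} → k ≡ suc e → Meets k (vb e)

data OnEdge (e : ℕ) : Vertex → Set where
  lower : OnEdge e (va e)
  upper : OnEdge e (va (suc e))
  whole : OnEdge e (vb e)

-- What avoidance retains of a relation among three vertices: every index in the word of one recurs
-- in the word of another.
Covered : Vertex → Vertex → Vertex → Set
Covered x y z = ∀ {k} → Meets k x → Meets k y ⊎ Meets k z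

-- Paths contain no cycles, so three vertex sets covering each index twice lie on one edge.
on-edge : ∀ {e} y z → Covered (vb e) y z → Covered y (vb e) z → Covered z (vb e) y → OnEdge e y × OnEdge e z
on-edge {e} y z cx cy cz = go y z (cx at-lower) (cx (at-upper refl)) cy cz
  where
  edges : ∀ {e f g} → Meets e (vb f) → Meets (suc e) (vb f) ⊎ Meets (suc e) (vb g) →
          Covered (vb f) (vb e) (vb g) → Covered (vb g) (vb e) (vb f) → OnEdge e (vb f) × OnEdge e (vb g)
  edges at-lower _ _ cz with cz at-lower | cz (at-upper refl)
  ... | inj₁ at-lower | _ = whole , whole
  ... | inj₂ at-lower | _ = whole , whole
  ... | inj₁ (at-upper refl) | inj₁ (at-upper ())
  ... | inj₁ (at-upper refl) | inj₂ (at-upper ())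
  ... | inj₂ (at-upper refl) | inj₁ (at-upper ())
  ... | inj₂ (at-upper refl) | inj₂ (at-upper ())
  edges (at-upper refl) (inj₁ (at-upper ())) _ _
  edges (at-upper refl) (inj₂ at-lower) cy _ with cy at-lower
  ... | inj₁ (at-upper ())
  ... | inj₂ (at-upper ())
  edges (at-upper refl) (inj₂ (at-upper refl)) cy _ with cy at-lower
  ... | inj₁ (at-upper ())
  ... | inj₂ (at-upper ())
  mixed : ∀ {e j f} → Meets e (va j) ⊎ Meets e (vb f) → Meets (suc e) (va j) ⊎ Meets (suc e) (vb f) →
          Covered (va j) (vb e) (vb f) → Covered (vb f) (vb e) (va j) → OnEdge e (va j) × OnEdge e (vb f)
  mixed (inj₁ at-vertex) (inj₁ ()) _ _
  mixed (inj₁ at-vertex) (inj₂ at-lower) _ cz with cz (at-upper refl)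
  ... | inj₁ (at-upper ())
  ... | inj₂ ()
  mixed (inj₁ at-vertex) (inj₂ (at-upper refl)) _ _ = lower , whole
  mixed (inj₂ at-lower) _ cy _ with cy at-vertex
  ... | inj₁ at-lower        = lower , whole
  ... | inj₁ (at-upper refl) = upper , whole
  ... | inj₂ at-lower        = lower , whole
  ... | inj₂ (at-upper refl) = upper , whole
  mixed (inj₂ (at-upper refl)) (inj₁ at-vertex) _ cz with cz at-lower
  ... | inj₁ (at-upper ())
  ... | inj₂ ()
  mixed (inj₂ (at-upper refl)) (inj₂ (at-upper ())) _ _
  go : ∀ {e} y z → Meets e y ⊎ Meets e z → Meets (suc e) y ⊎ Meets (suc e) z →
       Covered y (vb e) z → Covered z (vb e) y → OnEdge e y × OnEdge e z
  go (va j) (va k) (inj₁ at-vertex) (inj₂ at-vertex) _ _ = lower , upper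
  go (va j) (va k) (inj₂ at-vertex) (inj₁ at-vertex) _ _ = upper , lower
  go (va j) (vb f) p q cy cz = mixed p q cy cz
  go (vb f) (va j) p q cy cz with mixed (swap-⊎ p) (swap-⊎ q) cz cy
  ... | r , s = s , r
  go (vb f) (vb g) (inj₁ p) q cy cz = edges p q cy cz
  go (vb f) (vb g) (inj₂ p) q cy cz with edges p (swap-⊎ q) cz cy
  ... | r , s = s , r

-- Connection sets from the edges of a path

module EdgeQuotients (G : FiniteGroup) (ρ : ℕ → FiniteGroup.Carrier G) {n : ℕ}
  (S : GroupWords.Separated G ρ n) (m : ℕ) (tail head : ℕ → ℕ) where
  open FiniteGroup G
  open IsGroup isGroup using (assoc; identityˡ; identityʳ; inverseˡ; inverseʳ)
  open GroupProperties (asGroup G)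
  open GroupWords G ρ
  open Separated S

  b : ℕ → Carrier
  b e = ρ (head e) ∙ ρ (tail e) ⁻¹

  -- With x the tail, y the head and b = y x⁻¹: `C` says that x and y commute, `I` that conjugation
  -- by y inverts x. `P′` joins the two equations that yield the arc from b to x, of which the first
  -- amounts to y² = x².
  C I P′ : ℕ → Set
  C e  = ρ (tail e) ∙ b e ≡ ρ (head e)
  I e  = ρ (tail e) ∙ ρ (head e) ≡ b e
  P′ e = ρ (head e) ∙ b e ≡ ρ (tail e) ⊎ b e ∙ b e ≡ ρ (tail e)

  Valid : Vertex → Set
  Valid (va i) = i < n
  Valid (vb e) = e < m

  val : Vertex → Carrier
  val (va i) = ρ i
  val (vb e) = b e

  open ConnectionSet G Valid val

  P? : Decidable P
  P? g = map′ to′ from′ (ℕₚ.anyUpTo? (λ i → _≟_ G (ρ i) g) n ⊎-dec ℕₚ.anyUpTo? (λ e → _≟_ G (b e) g) m)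
    where
    to′ : (∃ λ i → i < n × ρ i ≡ g) ⊎ (∃ λ e → e < m × b e ≡ g) → P g
    to′ (inj₁ (i , p)) = va i , p
    to′ (inj₂ (e , p)) = vb e , p
    from′ : P g → (∃ λ i → i < n × ρ i ≡ g) ⊎ (∃ λ e → e < m × b e ≡ g)
    from′ (va i , p) = inj₁ (i , p)
    from′ (vb e , p) = inj₂ (e , p)

  C? : Decidable C
  C? e = _≟_ G _ _
  I? : Decidable I
  I? e = _≟_ G _ _
  P′? : Decidable P′
  P′? e = _≟_ G _ _ ⊎-dec _≟_ G _ _

  E : Vertex → Vertex → Set
  E = LocalArc m tail head C I P′

  -- Edges may point either way, and `n` may exceed m + 1: generators beyond the last edge belong to
  -- the connection set as vertices without arcs.
  module Path
    (ends   : ∀ e → (tail e ≡ e × head e ≡ suc e) ⊎ (tail e ≡ suc e × head e ≡ e))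
    (bound  : ∀ e → e < m → suc e < n)
    (square-b : ∀ e → e < m → b e ∙ b e ≢ ε) where

    word : Vertex → Word
    word (va i) = pos i ∷ []
    word (vb e) = pos (head e) ∷ neg (tail e) ∷ []

    eval-word : ∀ v → eval (word v) ≡ val v
    eval-word (va i) = identityʳ _
    eval-word (vb e) = cong (ρ (head e) ∙_) (identityʳ _)

    tail<n : ∀ e → e < m → tail e < n
    tail<n e p with ends e
    ... | inj₁ (q , _) rewrite q = ℕₚ.<-trans (ℕₚ.n<1+n e) (bound e p)
    ... | inj₂ (q , _) rewrite q = bound e p

    head<n : ∀ e → e < m → head e < n
    head<n e p with ends e
    ... | inj₁ (_ , q) rewrite q = bound e p
    ... | inj₂ (_ , q) rewrite q = ℕₚ.<-trans (ℕₚ.n<1+n e) (bound e p)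

    head≢tail : ∀ e → head e ≢ tail e
    head≢tail e q with ends e
    ... | inj₁ (s , t) = ℕₚ.1+n≢n (trans (sym t) (trans q s))
    ... | inj₂ (s , t) = ℕₚ.1+n≢n (trans (sym s) (trans (sym q) t))

    meets⁻ : ∀ {k} v → k ∈ indices (word v) → Meets k v
    meets⁻ (va i) (here refl) = at-vertex
    meets⁻ (vb e) p with ends e
    meets⁻ (vb e) (here refl)         | inj₁ (_ , q) = at-upper q
    meets⁻ (vb e) (there (here refl)) | inj₁ (q , _) rewrite q = at-lower
    meets⁻ (vb e) (here refl)         | inj₂ (_ , q) rewrite q = at-lower
    meets⁻ (vb e) (there (here refl)) | inj₂ (q , _) = at-upper q

    meets⁺ : ∀ {k} v → Meets k v → k ∈ indices (word v)
    meets⁺ (va i) at-vertex = here refl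
    meets⁺ (vb e) p with ends e
    meets⁺ (vb e) at-lower        | inj₁ (q , _) = there (here (sym q))
    meets⁺ (vb e) (at-upper refl) | inj₁ (_ , q) = here (sym q)
    meets⁺ (vb e) at-lower        | inj₂ (_ , q) = here (sym q)
    meets⁺ (vb e) (at-upper refl) | inj₂ (q , _) = there (here (sym q))

    covered : ∀ v → Valid v → ∀ w → length w ≤ 4 → eval (word v ++ w) ≡ ε →
              ∀ {k} → Meets k v → k ∈ indices w
    covered v@(va i) p w len e at-vertex = occurs-twice [] (pos i) w p (ℕₚ.m≤n⇒m≤1+n len) e
    covered v@(vb f) p w len e {k} q = go (meets⁺ v q)
      where
      go : k ∈ indices (word v) → k ∈ indices w
      go (here refl) with occurs-twice [] (pos (head f)) (neg (tail f) ∷ w) (head<n f p) (s≤s len) e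
      ... | here s  = ⊥-elim (head≢tail f s)
      ... | there s = s
      go (there (here refl)) with occurs-twice (pos (head f) ∷ []) (neg (tail f)) w (tail<n f p) (s≤s len) e
      ... | here s  = ⊥-elim (head≢tail f (sym s))
      ... | there s = s

    word-length : ∀ v → length (word v) ≤ 2
    word-length (va i) = s≤s z≤n
    word-length (vb e) = s≤s (s≤s z≤n)

    inv-word-length : ∀ v → length (inv (word v)) ≤ 2
    inv-word-length v = subst (_≤ 2) (sym (length-inv (word v))) (word-length v)

    meets-inv : ∀ {k} v → k ∈ indices (inv (word v)) → Meets k v
    meets-inv v p = meets⁻ v (∈-inv⁻ (word v) p)

    ++-length : ∀ (v w : Word) → length v ≤ 2 → length w ≤ 2 → length (v ++ w) ≤ 4
    ++-length v w p q = subst (_≤ 4) (sym (Listₚ.length-++ v {w})) (ℕₚ.+-mono-≤ p q)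

    rotate : ∀ (v w : Word) → eval (v ++ w) ≡ ε → eval (w ++ v) ≡ ε
    rotate v w e = trans (eval-++ w v) (trans (cong (eval w ∙_) v≡w⁻¹) (inverseʳ _))
      where
      v≡w⁻¹ : eval v ≡ eval w ⁻¹
      v≡w⁻¹ = inverseˡ-unique _ _ (trans (sym (eval-++ v w)) e)

    split : ∀ {k} x y → k ∈ indices (x ++ y) → k ∈ indices x ⊎ k ∈ indices y
    split {k} x y p = ∈-++⁻ (indices x) (subst (k ∈_) (indices-++ x y) p)

    module _ {u v w} (pu : Valid u) (pv : Valid v) (pw : Valid w) (product : val u ∙ val v ≡ val w) where

      private
        total : eval (word u ++ (word v ++ inv (word w))) ≡ ε
        total = trans (eval-++ (word u) _) (trans (cong₂ _∙_ (eval-word u) (trans (eval-quotient (word v) (word w))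
          (cong₂ (λ x y → x ∙ y ⁻¹) (eval-word v) (eval-word w)))) (trans (sym (assoc _ _ _)) (ε-quotient product)))

        total₂ : eval (word v ++ (inv (word w) ++ word u)) ≡ ε
        total₂ = subst (λ x → eval x ≡ ε) (Listₚ.++-assoc (word v) (inv (word w)) (word u)) (rotate (word u) (word v ++ inv (word w)) total)

        inverted : val u ⁻¹ ∙ val w ≡ val v
        inverted = trans (cong (val u ⁻¹ ∙_) (sym product)) (trans (sym (assoc _ _ _))
          (trans (cong (_∙ val v) (inverseˡ _)) (identityˡ _)))

        -- `covered` needs the third vertex uninverted and in front, so the relation is rewritten as
        -- u⁻¹ w v⁻¹ = 1 and then rotated.
        total₃ : eval (word w ++ (inv (word v) ++ inv (word u))) ≡ ε
        total₃ = subst (λ x → eval x ≡ ε) (Listₚ.++-assoc (word w) (inv (word v)) (inv (word u)))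
          (rotate (inv (word u)) (word w ++ inv (word v)) (trans (eval-++ (inv (word u)) (word w ++ inv (word v)))
            (trans (cong₂ _∙_ (eval-inv (word u)) (eval-quotient (word w) (word v)))
            (trans (cong₂ _∙_ (cong _⁻¹ (eval-word u)) (cong₂ (λ x y → x ∙ y ⁻¹) (eval-word w) (eval-word v)))
            (trans (sym (assoc _ _ _)) (ε-quotient inverted))))))

      covered₁ : Covered u v w
      covered₁ p with split (word v) _ (covered u pu _
                        (++-length (word v) (inv (word w)) (word-length v) (inv-word-length w)) total p)
      ... | inj₁ q = inj₁ (meets⁻ v q)
      ... | inj₂ q = inj₂ (meets-inv w q)

      covered₂ : Covered v u w
      covered₂ p with split (inv (word w)) _ (covered v pv _
                        (++-length (inv (word w)) (word u) (inv-word-length w) (word-length u)) total₂ p)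
      ... | inj₁ q = inj₂ (meets-inv w q)
      ... | inj₂ q = inj₁ (meets⁻ u q)

      covered₃ : Covered w u v
      covered₃ p with split (inv (word v)) _ (covered w pw _
                        (++-length (inv (word v)) (inv (word u)) (inv-word-length v) (inv-word-length u)) total₃ p)
      ... | inj₁ q = inj₂ (meets-inv v q)
      ... | inj₂ q = inj₁ (meets-inv u q)

    -- Renaming the tail 0 and the head 1 turns every product over the edge into a closed word,
    -- whatever its position and orientation, so that `refl` can check it.
    module OneEdge (e : ℕ) (e<m : e < m) where
      open ≡-Reasoning

      π : ℕ → ℕ
      π 0             = tail e
      π 1             = head e
      π (suc (suc k)) = suc (suc (k + e))

      ends<2+e : tail e < suc (suc e) × head e < suc (suc e)
      ends<2+e with ends e
      ... | inj₁ (q , r) rewrite q | r = ℕₚ.m<n⇒m<1+n (ℕₚ.n<1+n e) , ℕₚ.n<1+n (suc e)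
      ... | inj₂ (q , r) rewrite q | r = ℕₚ.n<1+n (suc e) , ℕₚ.m<n⇒m<1+n (ℕₚ.n<1+n e)

      -- Reindexing needs injectivity on all of ℕ, so the indices other than 0 and 1 are sent past e + 1.
      π-injective : ∀ {i j} → π i ≡ π j → i ≡ j
      π-injective {i} {j} = go i j
        where
        past : ∀ {i} k → i < suc (suc e) → i ≢ suc (suc (k + e))
        past k p = ℕₚ.<⇒≢ (ℕₚ.<-≤-trans p (s≤s (s≤s (ℕₚ.m≤n+m e k))))
        go : ∀ i j → π i ≡ π j → i ≡ j
        go 0 0 _ = refl
        go 0 1 s = ⊥-elim (head≢tail e (sym s))
        go 1 0 s = ⊥-elim (head≢tail e s)
        go 1 1 _ = refl
        go 0 (suc (suc k)) s = ⊥-elim (past k (proj₁ ends<2+e) s)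
        go 1 (suc (suc k)) s = ⊥-elim (past k (proj₂ ends<2+e) s)
        go (suc (suc k)) 0 s = ⊥-elim (past k (proj₁ ends<2+e) (sym s))
        go (suc (suc k)) 1 s = ⊥-elim (past k (proj₂ ends<2+e) (sym s))
        go (suc (suc k)) (suc (suc k′)) s =
          cong (λ x → suc (suc x)) (ℕₚ.+-cancelʳ-≡ e k k′ (ℕₚ.suc-injective (ℕₚ.suc-injective s)))

      π<n : ∀ {k} → k < 2 → π k < n
      π<n {0} _ = tail<n e e<m
      π<n {1} _ = head<n e e<m
      π<n {suc (suc _)} (s≤s (s≤s ()))

      module L = GroupWords G (λ i → ρ (π i))
      module LS = L.Separated (reindex G ρ π π-injective π<n S)
      open LS.Decision L.free using (distinct)
      open L.Reduction L.free using (derive; _by_)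

      data Position : Set where
        tl hd qt : Position

      at : Position → Vertex
      at tl = va (tail e)
      at hd = va (head e)
      at qt = vb e

      lword : Position → Word
      lword tl = pos 0 ∷ []
      lword hd = pos 1 ∷ []
      lword qt = pos 1 ∷ neg 0 ∷ []

      eval-lword : ∀ p → L.eval (lword p) ≡ val (at p)
      eval-lword tl = identityʳ _
      eval-lword hd = identityʳ _
      eval-lword qt = cong (ρ (head e) ∙_) (identityʳ _)

      position : ∀ {v} → OnEdge e v → ∃ λ p → v ≡ at p
      position whole = qt , refl
      position lower with ends e
      ... | inj₁ (q , _) = tl , cong va (sym q)
      ... | inj₂ (_ , q) = hd , cong va (sym q)
      position upper with ends e
      ... | inj₁ (_ , q) = hd , cong va (sym q)
      ... | inj₂ (q , _) = tl , cong va (sym q)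

      x y : Carrier
      x = ρ (tail e)
      y = ρ (head e)

      -- Together x b = y and x y = b give x x y = y, that is x² = 1.
      exclusive-at : C e → ¬ I e
      exclusive-at c i = square (tail e) (tail<n e e<m)
        (trans (trans (cong (x ∙_) (sym (identityʳ x))) (derive (pos 0 ∷ pos 0 ∷ []) []
          (([] , ((pos 0 ∷ pos 0 ∷ pos 1 ∷ [] , pos 1 ∷ []) by xxy)) ∷ []) refl)) refl)
        where
        xxy : L.eval (pos 0 ∷ pos 0 ∷ pos 1 ∷ []) ≡ L.eval (pos 1 ∷ [])
        xxy = begin
          x ∙ (x ∙ (y ∙ ε))  ≡⟨ cong (λ z → x ∙ (x ∙ z)) (identityʳ y) ⟩
          x ∙ (x ∙ y)        ≡⟨ cong (x ∙_) i ⟩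
          x ∙ b e            ≡⟨ c ⟩
          y                  ≡⟨ sym (identityʳ y) ⟩
          y ∙ ε              ∎

      -- Of the 27 products five are arcs of `E`. Two more amount to a square being 1: y x = y x⁻¹
      -- to x² = 1, and b y = x to b² = 1. The other twenty leave a letter that occurs once,
      -- possibly after a rotation.
      arc-at : ∀ p q r → val (at p) ∙ val (at q) ≡ val (at r) →
               L.eval (lword p ++ lword q) ≡ L.eval (lword r) → E (at q) (at r)
      arc-at tl tl tl _ h = ⊥-elim (distinct (lword tl ++ lword tl) (lword tl) refl h)
      arc-at tl tl hd _ h = ⊥-elim (distinct (lword tl ++ lword tl) (lword hd) refl h)
      arc-at tl tl qt _ h = ⊥-elim (distinct (lword tl ++ lword tl) (lword qt) refl h)
      arc-at tl hd tl _ h = ⊥-elim (distinct (lword tl ++ lword hd) (lword tl) refl h)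
      arc-at tl hd hd _ h = ⊥-elim (distinct (lword tl ++ lword hd) (lword hd) refl h)
      arc-at tl hd qt h _ = outof e<m h
      arc-at tl qt tl _ h = ⊥-elim (distinct (lword tl ++ lword qt) (lword tl) refl h)
      arc-at tl qt hd h _ = into e<m h
      arc-at tl qt qt _ h = ⊥-elim (distinct (lword tl ++ lword qt) (lword qt) refl h)
      arc-at hd tl tl _ h = ⊥-elim (distinct (lword hd ++ lword tl) (lword tl) refl h)
      arc-at hd tl hd _ h = ⊥-elim (distinct (lword hd ++ lword tl) (lword hd) refl h)
      arc-at hd tl qt _ h = ⊥-elim (square (tail e) (tail<n e e<m) xx≡ε)
        where
        xx≡ε : x ∙ x ≡ ε
        xx≡ε = trans (cong (x ∙_) (sym (identityʳ x))) (derive (pos 0 ∷ pos 0 ∷ []) []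
          ((neg 1 ∷ [] , ((lword hd ++ lword tl , lword qt) by h)) ∷ []) refl)
      arc-at hd hd tl _ h = ⊥-elim (distinct (lword hd ++ lword hd) (lword tl) refl h)
      arc-at hd hd hd _ h = ⊥-elim (distinct (lword hd ++ lword hd) (lword hd) refl h)
      arc-at hd hd qt _ h = ⊥-elim (distinct (lword hd ++ lword hd) (lword qt) refl h)
      arc-at hd qt tl h _ = back e<m (inj₁ h)
      arc-at hd qt hd _ h = ⊥-elim (distinct (lword hd ++ lword qt) (lword hd) refl h)
      arc-at hd qt qt _ h = ⊥-elim (distinct (lword hd ++ lword qt) (lword qt) refl h)
      arc-at qt tl tl _ h = ⊥-elim (distinct (lword qt ++ lword tl) (lword tl) refl h)
      arc-at qt tl hd _ _ = along e<m
      arc-at qt tl qt _ h = ⊥-elim (distinct (lword qt ++ lword tl) (lword qt) refl h)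
      arc-at qt hd tl _ h = ⊥-elim (square-b e e<m bb≡ε)
        where
        bb≡ε : b e ∙ b e ≡ ε
        bb≡ε = trans (sym (trans (L.eval-++ (lword qt) (lword qt)) (cong₂ _∙_ (eval-lword qt) (eval-lword qt))))
          (derive (lword qt ++ lword qt) [] (([] , ((lword qt ++ lword hd , lword tl) by h)) ∷ []) refl)
      arc-at qt hd hd _ h = ⊥-elim (distinct (lword qt ++ lword hd) (lword hd) refl h)
      arc-at qt hd qt _ h = ⊥-elim (distinct (lword qt ++ lword hd) (lword qt) refl h)
      arc-at qt qt tl h _ = back e<m (inj₂ h)
      arc-at qt qt hd _ h = ⊥-elim (distinct (lword qt ++ lword qt) (lword hd) refl h)
      arc-at qt qt qt _ h = ⊥-elim (distinct (lword qt ++ lword qt) (lword qt) refl h)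

    exclusive : ∀ e → e < m → C e → ¬ I e
    exclusive e p = OneEdge.exclusive-at e p

    local : ∀ {e u v w} → e < m → OnEdge e u → OnEdge e v → OnEdge e w → val u ∙ val v ≡ val w → E v w
    local {e} p ou ov ow h with OneEdge.position e p ou | OneEdge.position e p ov | OneEdge.position e p ow
    ... | q , refl | r , refl | s , refl = arc-at q r s h
      (trans (L.eval-++ (lword q) _) (trans (cong₂ _∙_ (eval-lword q) (eval-lword r)) (trans h (sym (eval-lword s)))))
      where open OneEdge e p

    same-edge : ∀ {e f} → Meets e (vb f) → Meets (suc e) (vb f) → e ≡ f
    same-edge at-lower        _             = refl
    same-edge (at-upper refl) (at-upper ())

    induced : Induced E
    induced = record { complete = complete ; sound = sound ; injective = injective ; oriented = oriented }
      where
      not-idempotent : ∀ i → i < n → ρ i ∙ ρ i ≢ ρ i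
      not-idempotent i i<n h = square i i<n (trans h (identityˡ-unique _ _ h))
      complete : ∀ {u v w} → Valid u → Valid v → Valid w → val u ∙ val v ≡ val w → E v w
      complete {u} {v} {w} pu pv pw h = go u v w pu pv pw h (covered₁ pu pv pw h) (covered₂ pu pv pw h) (covered₃ pu pv pw h)
        where
        go : ∀ u v w → Valid u → Valid v → Valid w → val u ∙ val v ≡ val w →
             Covered u v w → Covered v u w → Covered w u v → E v w
        go (vb e) v w pu pv pw h c₁ c₂ c₃ with on-edge v w c₁ c₂ c₃
        ... | ov , ow = local pu whole ov ow h
        go u@(va _) (vb e) w pu pv pw h c₁ c₂ c₃ with on-edge u w c₂ c₁ (λ p → swap-⊎ (c₃ p))
        ... | ou , ow = local pv ou whole ow h
        go u@(va _) v@(va _) (vb e) pu pv pw h c₁ c₂ c₃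
          with on-edge u v c₃ (λ p → swap-⊎ (c₁ p)) (λ p → swap-⊎ (c₂ p))
        ... | ou , ov = local pw ou ov whole h
        -- Among three single letters the covering forces i = j = k, so the generator would be
        -- idempotent.
        go (va i) (va j) (va k) pu pv pw h c₁ c₂ c₃ with c₁ at-vertex | c₃ at-vertex
        ... | inj₁ at-vertex | inj₁ at-vertex = ⊥-elim (not-idempotent i pu h)
        ... | inj₁ at-vertex | inj₂ at-vertex = ⊥-elim (not-idempotent i pu h)
        ... | inj₂ at-vertex | _ with c₂ at-vertex
        ...   | inj₁ at-vertex = ⊥-elim (not-idempotent i pu h)
        ...   | inj₂ at-vertex = ⊥-elim (not-idempotent i pu h)
      cancelled : ∀ x y → (y ∙ x ⁻¹) ∙ x ≡ y
      cancelled x y = trans (assoc _ _ _) (trans (cong (y ∙_) (inverseˡ x)) (identityʳ y))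
      sound : ∀ {v w} → E v w → Valid v × Valid w × ∃ λ u → Valid u × val u ∙ val v ≡ val w
      sound (along {e} p)           = tail<n e p , head<n e p , vb e , p , cancelled _ _
      sound (into {e} p c)          = p , head<n e p , va (tail e) , tail<n e p , c
      sound (outof {e} p i)         = head<n e p , p , va (tail e) , tail<n e p , i
      sound (back {e} p (inj₁ h))   = p , tail<n e p , va (head e) , head<n e p , h
      sound (back {e} p (inj₂ h))   = p , tail<n e p , vb e , p , h
      injective : ∀ {v w} → Valid v → Valid w → val v ≡ val w → v ≡ w
      injective {v} {w} pv pw h = go v w (meet v w pv h) (meet w v pw (sym h))
        where
        meet : ∀ v w → Valid v → val v ≡ val w → ∀ {k} → Meets k v → Meets k w
        meet v w pv h p = meets-inv w (covered v pv (inv (word w)) (ℕₚ.≤-trans (inv-word-length w) (s≤s (s≤s z≤n)))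
          (trans (eval-quotient (word v) (word w)) (ε-quotient (trans (eval-word v) (trans h (sym (eval-word w)))))) p)
        go : ∀ v w → (∀ {k} → Meets k v → Meets k w) → (∀ {k} → Meets k w → Meets k v) → v ≡ w
        go (va i) (va j) f g with f at-vertex
        ... | at-vertex = refl
        go (va i) (vb e) f g with g at-lower | g (at-upper refl)
        ... | at-vertex | ()
        go (vb e) (va j) f g with f at-lower | f (at-upper refl)
        ... | at-vertex | ()
        go (vb e) (vb f) h g = cong vb (same-edge (h at-lower) (h (at-upper refl)))
      oriented : ∀ {v w} → Valid v → Valid w → val v ∙ val w ≢ ε
      oriented {v} {w} pv pw h = go v w pv h (meet v w pv h′) (meet w v pw (rotate (word v) (word w) h′))
        where
        h′ : eval (word v ++ word w) ≡ ε
        h′ = trans (eval-++ (word v) _) (trans (cong₂ _∙_ (eval-word v) (eval-word w)) h)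
        meet : ∀ v w → Valid v → eval (word v ++ word w) ≡ ε → ∀ {k} → Meets k v → Meets k w
        meet v w pv h p = meets⁻ w (covered v pv (word w) (ℕₚ.≤-trans (word-length w) (s≤s (s≤s z≤n))) h p)
        go : ∀ v w → Valid v → val v ∙ val w ≡ ε → (∀ {k} → Meets k v → Meets k w) → (∀ {k} → Meets k w → Meets k v) → ⊥
        go (va i) (va j) p h f g with f at-vertex
        ... | at-vertex = square i p h
        go (va i) (vb e) p h f g with g at-lower | g (at-upper refl)
        ... | at-vertex | ()
        go (vb e) (va j) p h f g with f at-lower | f (at-upper refl)
        ... | at-vertex | ()
        go (vb e) (vb f) p h s g with same-edge (s at-lower) (s (at-upper refl))
        ... | refl = square-b e p h

-- Generating families and rigidity along their paths

module Families (G : FiniteGroup) where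
  open FiniteGroup G

  -- Generation is stated as closure induction, which serves fixed elements, centralisers and images
  -- of homomorphisms alike.
  Generated : (ℕ → Carrier) → ℕ → Set₁
  Generated ρ n = (F : Carrier → Set) → F ε → (∀ {g h} → F g → F h → F (g ∙ h)) → (∀ {g} → F g → F (g ⁻¹)) →
                  (∀ k → k < n → F (ρ k)) → ∀ g → F g

  record Family (ρ : ℕ → Carrier) (n : ℕ) : Set₁ where
    field
      separation : GroupWords.Separated G ρ n
      generated  : Generated ρ n
    open GroupWords.Separated separation public

  fixed-all : ∀ {ρ n} → Generated ρ n → {P : Carrier → Set} → (∀ k → k < n → CayleyDigraph.Fixed G P (ρ k)) →
              ∀ g → CayleyDigraph.Fixed G P g
  fixed-all gen {P} = gen Fixed fixed-ε fixed-∙ fixed-⁻¹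
    where open CayleyDigraph G P

  tuple-family : ∀ {ℓ} (a : Fin ℓ → Carrier) (a-injective : Injective _≡_ _≡_ a) → Generates G a →
                 (avoiding : FiveProductAvoiding G a) (a-order : ∀ i → OrderGT2 (a i)) →
                 Family (Tuple.A G a a-injective avoiding a-order) ℓ
  tuple-family {ℓ} a a-injective gens avoiding a-order = record { separation = separated-A ; generated = gen }
    where
    open Tuple G a a-injective avoiding a-order
    gen : Generated A ℓ
    gen F e m i f g = go (gens g)
      where
      f′ : ∀ j → F (a j)
      f′ j = subst F (A-toℕ j) (f (Fin.toℕ j) (Finₚ.toℕ<n j))
      go : ∀ {g} → Gen G a g → F g
      go gen-ε                  = e
      go (gen-t (j , refl) x)   = m (f′ j) (go x)
      go (gen-t⁻¹ (j , refl) x) = m (i (f′ j)) (go x)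

  permute : ∀ {ρ n} (π : ℕ → ℕ) → (∀ i → π (π i) ≡ i) → (∀ {k} → k < n → π k < n) →
            Family ρ n → Family (λ i → ρ (π i)) n
  permute {ρ} π involutive below fam = record
    { separation = reindex G ρ π (λ {i} {j} e → trans (sym (involutive i)) (trans (cong π e) (involutive j))) below separation
    ; generated = λ F e m i f → generated F e m i (λ k k<n → subst (λ j → F (ρ j)) (involutive k) (f (π k) (below k<n))) }
    where open Family fam

  module StraightSet {ρ : ℕ → Carrier} {m : ℕ} (fam : Family ρ (suc m))
    (square-b : ∀ e → e < m → (ρ (suc e) ∙ ρ e ⁻¹) ∙ (ρ (suc e) ∙ ρ e ⁻¹) ≢ ε) where
    open Family fam
    open EdgeQuotients G ρ separation m (λ e → e) suc public
    open Path (λ e → inj₁ (refl , refl)) (λ e → s<s) square-b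
    open ConnectionSet G Valid val
    open Induced induced

    module Sym φ = StraightPath exclusive (symmetry φ)

    fixed-b : ∀ {e} → Fixed (ρ (suc e)) → Fixed (ρ e) → Fixed (b e)
    fixed-b f g = fixed-∙ f (fixed-⁻¹ g)

    spread : 0 < m → Fixed (ρ 0) → AdmitsORR G
    spread 0<m f₀ = admits P? antisymmetric (fixed-all generated (λ k k<n → every k (ℕₚ.≤-pred k<n)))
      where
      f₁ : Fixed (ρ 1)
      f₁ = pinned (va 1) (s<s 0<m) λ φ → second φ (Symmetry.out (symmetry φ) (maps-fixed (va 0) z<s f₀ φ) (along 0<m))
        where
        second : ∀ φ → (∃ λ w′ → Maps φ (va 1) w′ × E (va 0) w′) → Maps φ (va 1) (va 1)
        second φ (_ , r′ , along _) = r′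
      step : ∀ k → suc k ≤ m → Fixed (ρ k) × Fixed (ρ (suc k))
      step zero    _ = f₀ , f₁
      step (suc k) p with step k (ℕₚ.≤-trans (ℕₚ.n≤1+n _) p)
      ... | f , g = g , pinned (va (suc (suc k))) (s≤s p) λ φ →
            Sym.next-fixed φ p (maps-fixed (va (suc k)) (s≤s (ℕₚ.≤-trans (ℕₚ.n≤1+n _) p)) g φ)
              (maps-fixed (vb k) (ℕₚ.≤-trans (ℕₚ.n≤1+n _) p) (fixed-b g f) φ)
      every : ∀ k → k ≤ m → Fixed (ρ k)
      every zero    _ = f₀
      every (suc k) p = proj₂ (step k p)

    -- The two pictures over two edges that are symmetric about a₁: either a₀ and b₁ enter it while
    -- a₂ and b₀ leave it, or two directed triangles share it.
    Exceptional : Set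
    Exceptional = m ≡ 2 × I 0 × P′ 1 × (¬ P′ 0 × ¬ C 1 × ¬ I 1 ⊎ P′ 0 × I 1)

    no-back : ¬ C 0 → ¬ P′ 0 → 0 < m → AdmitsORR G ⊎ Exceptional
    no-back ¬c ¬p 0<m with 1 ℕ.<? m
    ... | no ¬1<m = inj₁ (spread 0<m (fixed-vertex (va 0) z<s λ φ r →
                      [ (λ e → e) , (λ x → ⊥-elim (¬1<m (proj₁ (proj₂ x)))) ]′ (Sym.start-no-back φ ¬c ¬p 0<m r)))
    ... | yes 1<m = bent
      where
      -- a₁ and a₂ are fixed, hence so is b₁, and a₀ can only move to b₁.
      ample : ¬ I 0 ⊎ 2 < m → AdmitsORR G
      ample s = spread 0<m (fixed-vertex (va 0) z<s λ φ r →
        [ (λ e → e) , (λ x → ⊥-elim (moved φ (subst (Maps φ (va 0)) (proj₁ x) r))) ]′ (Sym.start-no-back φ ¬c ¬p 0<m r))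
        where
        r₁ : ∀ φ → Maps φ (va 1) (va 1)
        r₁ φ with image-maps φ {va 0} z<s
        ... | w , r = Sym.second-fixed φ ¬c ¬p 0<m r (Sym.start-no-back φ ¬c ¬p 0<m r)
        f₁ : Fixed (ρ 1)
        f₁ = pinned (va 1) (s<s 0<m) r₁
        f₂ : Fixed (ρ 2)
        f₂ = pinned (va 2) (s<s 1<m) λ φ → Sym.third-fixed φ ¬c ¬p 1<m s (r₁ φ)
        moved : ∀ φ → ¬ Maps φ (va 0) (vb 1)
        moved φ r = vertex≢ (Symmetry.inj (symmetry φ) {vb 1} {va 0} {vb 1} r (maps-fixed (vb 1) 1<m (fixed-b f₂ f₁) φ))
          where
          vertex≢ : va 0 ≢ vb 1
          vertex≢ ()
      bent : AdmitsORR G ⊎ Exceptional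
      bent with I? 0 | m ℕ.≟ 2
      ... | no ¬i | _      = inj₁ (ample (inj₁ ¬i))
      ... | yes i | no m≢2 = inj₁ (ample (inj₂ (ℕₚ.≤∧≢⇒< 1<m (λ e → m≢2 (sym e)))))
      ... | yes i | yes refl with P′? 1 | C? 1 | I? 1
      ...   | yes p | no ¬c₁ | no ¬i₁ = inj₂ (refl , i , p , inj₁ (¬p , ¬c₁ , ¬i₁))
      ...   | no ¬p₁ | _ | _ = inj₁ (spread 0<m (fixed-vertex (va 0) z<s λ φ r →
              [ (λ e → e) , (λ (_ , _ , p , _) → ⊥-elim (¬p₁ p)) ]′ (Sym.start-no-back φ ¬c ¬p 0<m r)))
      ...   | _ | yes c₁ | _ = inj₁ (spread 0<m (fixed-vertex (va 0) z<s λ φ r →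
              [ (λ e → e) , (λ (_ , _ , _ , ¬c₁ , _) → ⊥-elim (¬c₁ c₁)) ]′ (Sym.start-no-back φ ¬c ¬p 0<m r)))
      ...   | _ | _ | yes i₁ = inj₁ (spread 0<m (fixed-vertex (va 0) z<s λ φ r →
              [ (λ e → e) , (λ (_ , _ , _ , _ , ¬i₁ , _) → ⊥-elim (¬i₁ i₁)) ]′ (Sym.start-no-back φ ¬c ¬p 0<m r)))

    -- The hypothesis rules out `C 0` without `P′ 0`, where a₀ and b₀ are both sources whose only
    -- arc goes to a₁. The last outcome is a lone directed triangle, which can rotate.
    straight : 0 < m → ¬ C 0 ⊎ P′ 0 → AdmitsORR G ⊎ Exceptional ⊎ (m ≡ 1 × I 0 × P′ 0)
    straight 0<m s with P′? 0 | I? 0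
    ... | yes p | no ¬i = inj₁ (spread 0<m (fixed-vertex (va 0) z<s λ φ r → Sym.start-single-back φ p ¬i 0<m r))
    ... | no ¬p | _ with no-back ([ (λ ¬c → ¬c) , (λ p → ⊥-elim (¬p p)) ]′ s) ¬p 0<m
    ...   | inj₁ x = inj₁ x
    ...   | inj₂ x = inj₂ (inj₁ x)
    straight 0<m s | yes p | yes i with 1 ℕ.<? m
    ... | no ¬1<m = inj₂ (inj₂ (ℕₚ.≤-antisym (ℕₚ.≮⇒≥ ¬1<m) 0<m , i , p))
    ... | yes 1<m with P′? 1 | I? 1 | m ℕ.≟ 2
    ...   | yes p₁ | yes i₁ | yes e = inj₂ (inj₁ (e , i , p₁ , inj₂ (p , i₁)))
    ...   | no ¬p₁ | _ | _ = inj₁ (spread 0<m (fixed-vertex (va 0) z<s λ φ r →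
              [ (λ e → e) , (λ (_ , p , _) → ⊥-elim (¬p₁ p)) ]′ (Sym.start-triangle φ (λ c → exclusive 0 0<m c i) p i 1<m r)))
    ...   | _ | no ¬i₁ | _ = inj₁ (spread 0<m (fixed-vertex (va 0) z<s λ φ r →
              [ (λ e → e) , (λ (_ , _ , i) → ⊥-elim (¬i₁ i)) ]′ (Sym.start-triangle φ (λ c → exclusive 0 0<m c i) p i 1<m r)))
    ...   | _ | _ | no m≢2 = inj₁ (spread 0<m (fixed-vertex (va 0) z<s λ φ r →
              [ (λ e → e) , (λ (e , _) → ⊥-elim (m≢2 e)) ]′ (Sym.start-triangle φ (λ c → exclusive 0 0<m c i) p i 1<m r)))

  forked-tail forked-head : ℕ → ℕ
  forked-tail zero    = 1
  forked-tail (suc e) = suc e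
  forked-head zero    = 0
  forked-head (suc e) = suc (suc e)

  module ForkedSet {ρ : ℕ → Carrier} {m : ℕ} (fam : Family ρ (suc m))
    (square-b : ∀ e → e < m → (ρ (forked-head e) ∙ ρ (forked-tail e) ⁻¹) ∙ (ρ (forked-head e) ∙ ρ (forked-tail e) ⁻¹) ≢ ε) where
    open Family fam
    open EdgeQuotients G ρ separation m forked-tail forked-head public

    ends : ∀ e → (forked-tail e ≡ e × forked-head e ≡ suc e) ⊎ (forked-tail e ≡ suc e × forked-head e ≡ e)
    ends zero    = inj₂ (refl , refl)
    ends (suc e) = inj₁ (refl , refl)

    open Path ends (λ e → s<s) square-b
    open ConnectionSet G Valid val
    open Induced induced

    E′ : Vertex → Vertex → Set
    E′ = ForkedArc m C I P′

    E⇒E′ : ∀ {v w} → E v w → E′ v w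
    E⇒E′ (along {zero} p)    = along₀
    E⇒E′ (along {suc e} p)   = along p
    E⇒E′ (into {zero} p c)   = into₀ c
    E⇒E′ (into {suc e} p c)  = into p c
    E⇒E′ (outof {zero} p c)  = outof₀ c
    E⇒E′ (outof {suc e} p c) = outof p c
    E⇒E′ (back {zero} p c)   = back₀ c
    E⇒E′ (back {suc e} p c)  = back p c

    forked : C 0 → 2 < m → AdmitsORR G
    forked c 2<m = admits P? antisymmetric (fixed-all generated (λ k k<n → every k (ℕₚ.≤-pred k<n)))
      where
      0<m : 0 < m
      0<m = pred-< (pred-< 2<m)

      E′⇒E : ∀ {v w} → E′ v w → E v w
      E′⇒E along₀      = along 0<m
      E′⇒E (into₀ c)   = into 0<m c
      E′⇒E (outof₀ c)  = outof 0<m c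
      E′⇒E (back₀ c)   = back 0<m c
      E′⇒E (along p)   = along p
      E′⇒E (into p c)  = into p c
      E′⇒E (outof p c) = outof p c
      E′⇒E (back p c)  = back p c

      induced′ : Induced E′
      induced′ = record
        { complete = λ pu pv pw h → E⇒E′ (complete pu pv pw h) ; sound = λ e → sound (E′⇒E e)
        ; injective = injective ; oriented = oriented }

      open Induced induced′ using () renaming (pinned to pinned′; maps-fixed to maps-fixed′)

      module Sym φ = ForkedPath exclusive (Induced.symmetry induced′ φ)

      f₁ : Fixed (ρ 1)
      f₁ = Induced.fixed-vertex induced′ (va 1) (s<s 0<m) λ φ r → Sym.fork-fixed φ c 2<m r
      m₁ : ∀ φ → Induced.Maps induced′ φ (va 1) (va 1)
      m₁ = maps-fixed′ (va 1) (s<s 0<m) f₁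
      f₀ : Fixed (ρ 0)
      f₀ = pinned′ (va 0) z<s λ φ → proj₁ (Sym.left-fixed φ c 2<m (m₁ φ))
      f₂ : Fixed (ρ 2)
      f₂ = pinned′ (va 2) (s<s (pred-< 2<m)) λ φ → proj₂ (Sym.left-fixed φ c 2<m (m₁ φ))

      step : ∀ k → suc (suc k) ≤ m → Fixed (ρ (suc k)) × Fixed (ρ (suc (suc k)))
      step zero    _ = f₁ , f₂
      step (suc k) p with step k (ℕₚ.≤-trans (ℕₚ.n≤1+n _) p)
      ... | f , g = g , pinned′ (va (suc (suc (suc k)))) (s≤s p) λ φ →
            Sym.next-fixed φ p (maps-fixed′ (va (suc (suc k))) (s≤s (ℕₚ.≤-trans (ℕₚ.n≤1+n _) p)) g φ)
              (maps-fixed′ (vb (suc k)) (ℕₚ.≤-trans (ℕₚ.n≤1+n _) p) (fixed-∙ g (fixed-⁻¹ f)) φ)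
      every : ∀ k → k ≤ m → Fixed (ρ k)
      every zero          _ = f₀
      every (suc zero)    _ = f₁
      every (suc (suc k)) p = proj₂ (step k p)

-- Connection sets given by words

every : ∀ {n} → (Fin n → Bool) → Bool
every {zero}  f = true
every {suc n} f = f zero ∧ every (λ i → f (suc i))

every-sound : ∀ {n} (f : Fin n → Bool) → every f ≡ true → ∀ i → f i ≡ true
every-sound f e zero    = proj₁ (∧-true e)
every-sound f e (suc i) = every-sound (λ i → f (suc i)) (proj₂ (∧-true {f zero} e)) i

some : ∀ {n} → (Fin n → Bool) → Bool
some {zero}  f = false
some {suc n} f = f zero ∨ some (λ i → f (suc i))

some-sound : ∀ {n} (f : Fin n → Bool) → some f ≡ true → ∃ λ i → f i ≡ true
some-sound {suc n} f e with ∨-true {f zero} e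
... | inj₁ p = zero , p
... | inj₂ p with some-sound (λ i → f (suc i)) p
...   | i , q = suc i , q

some-complete : ∀ {n} (f : Fin n → Bool) i → f i ≡ true → some f ≡ true
some-complete f zero    e rewrite e = refl
some-complete f (suc i) e with f zero
... | true  = refl
... | false = some-complete (λ i → f (suc i)) i e

_==_ : ∀ {n} → Fin n → Fin n → Bool
i == j = does (i Fin.≟ j)

==-true : ∀ {n} {i j : Fin n} → (i == j) ≡ true → i ≡ j
==-true {i = i} {j} e with i Fin.≟ j
... | yes p = p

_iff_ : Bool → Bool → Bool
true  iff b = b
false iff b = not b

iff-refl : ∀ {a b} → a ≡ b → a iff b ≡ true
iff-refl {true}  refl = refl
iff-refl {false} refl = refl

-- rigid evaluates to true only if every automorphism of the finite digraph fixes all targets.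
module Search {N : ℕ} (edge : Fin N → Fin N → Bool) (target : Fin N → Bool) where

  compatible : Fin N → Fin N → List (Fin N × Fin N) → Bool
  compatible i j []               = true
  compatible i j ((i′ , j′) ∷ as) =
    (((i == i′) iff (j == j′)) ∧ ((edge i i′ iff edge j j′) ∧ (edge i′ i iff edge j′ j))) ∧ compatible i j as

  goal : List (Fin N × Fin N) → Bool
  goal []             = true
  goal ((i , j) ∷ as) = (not (target i) ∨ (j == i)) ∧ goal as

  search : List (Fin N × Fin N) → List (Fin N) → Bool
  search as []       = goal as
  search as (i ∷ is) = every λ j → not (compatible i j as) ∨ search ((i , j) ∷ as) is

  rigid : Bool
  rigid = search [] (List.allFin N)

  module _ {R : Fin N → Fin N → Set} (symmetric : Symmetry (λ i j → edge i j ≡ true) R)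
           (total : ∀ i → ∃ (R i)) where
    open Symmetry symmetric

    edge-iff : ∀ {i j i′ j′} → R i j → R i′ j′ → edge i i′ ≡ edge j j′
    edge-iff {i} {j} {i′} {j′} r r′ with edge i i′ in e | edge j j′ in f
    ... | true  | true  = refl
    ... | false | false = refl
    ... | true  | false with out r e
    ...   | _ , r″ , e″ rewrite fun r′ r″ = trans (sym e″) f
    edge-iff {i} {j} {i′} {j′} r r′ | false | true with out⁻ r f
    ...   | _ , r″ , e″ rewrite inj r′ r″ = trans (sym e) e″

    ==-iff : ∀ {i j i′ j′} → R i j → R i′ j′ → (i == i′) ≡ (j == j′)
    ==-iff {i} {j} {i′} {j′} r r′ with i Fin.≟ i′ | j Fin.≟ j′
    ... | yes _    | yes _    = refl
    ... | no _     | no _     = refl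
    ... | yes refl | no ¬q    = ⊥-elim (¬q (fun r r′))
    ... | no ¬p    | yes refl = ⊥-elim (¬p (inj r r′))

    Related : Fin N × Fin N → Set
    Related (i , j) = R i j

    compatible-complete : ∀ {i j} as → R i j → All Related as → compatible i j as ≡ true
    compatible-complete []               r []       = refl
    compatible-complete ((i′ , j′) ∷ as) r (r′ ∷ h)
      rewrite iff-refl (==-iff r r′) | iff-refl (edge-iff r r′) | iff-refl (edge-iff r′ r) = compatible-complete as r h

    Stays : Fin N → Set
    Stays i = target i ≡ true → ∀ {j} → R i j → j ≡ i

    goal-sound : ∀ as → goal as ≡ true → All Related as → All (λ a → Stays (proj₁ a)) as
    goal-sound [] _ [] = []
    goal-sound ((i , j) ∷ as) g (r ∷ h) with ∧-true {not (target i) ∨ (j == i)} g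
    ... | p , q = (λ t r′ → trans (fun r′ r) (stays t p)) ∷ goal-sound as q h
      where
      stays : ∀ {b} → b ≡ true → not b ∨ (j == i) ≡ true → j ≡ i
      stays refl p = ==-true p

    -- The branch chosen by the automorphism itself passes every `compatible` test, so the search
    -- cannot succeed without checking `goal` on it.
    search-sound : ∀ as is → search as is ≡ true → All Related as → All (λ a → Stays (proj₁ a)) as × All Stays is
    search-sound as []       s h = goal-sound as s h , []
    search-sound as (i ∷ is) s h with total i
    ... | j , r with ∨-true {not (compatible i j as)} (every-sound (λ j → not (compatible i j as) ∨ search ((i , j) ∷ as) is) s j)
    ...   | inj₁ p rewrite compatible-complete as r h = ⊥-elim (absurd p)
      where
      absurd : false ≢ true
      absurd ()
    ...   | inj₂ p with search-sound ((i , j) ∷ as) is p (r ∷ h)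
    ...     | s₀ ∷ hs , ss = hs , s₀ ∷ ss

    rigid-sound : rigid ≡ true → ∀ i → Stays i
    rigid-sound e i = All.lookup (proj₂ (search-sound [] (List.allFin N) e [])) (∈-allFin i)

module WordSet (G : FiniteGroup) (ρ : ℕ → FiniteGroup.Carrier G) {n : ℕ} (S : GroupWords.Separated G ρ n)
  (R : GroupWords.Relations G ρ) where
  open FiniteGroup G
  open IsGroup isGroup using (identityʳ)
  open GroupWords G ρ
  open Separated S using (module Decision)
  open Decision R public
  open Reduction R public

  module Chosen {N : ℕ} (ws : Vec Word N) (facts : List Fact) where

    w : Fin N → Word
    w = Vec.lookup ws

    is-false : Maybe Bool → Bool
    is-false (just false) = true
    is-false _            = false

    is-true : Maybe Bool → Bool
    is-true (just true) = true
    is-true _           = false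

    known : Maybe Bool → Bool
    known (just _) = true
    known nothing  = false

    arrow : Fin N → Fin N → Fin N → Maybe Bool
    arrow k i j = verdict facts ((w k ++ w i) ++ inv (w j))

    edge : Fin N → Fin N → Bool
    edge i j = some λ k → is-true (arrow k i j)

    -- Every verdict on an arrow has to be definite, so that `edge` is the induced digraph itself
    -- and not merely a part of it.
    settled : Bool
    settled =
      (every λ i → every λ j → is-false (verdict facts (w i ++ w j))) ∧
      (every λ i → every λ j → (i == j) ∨ is-false (verdict facts (w i ++ inv (w j)))) ∧
      (every λ k → every λ i → every λ j → known (arrow k i j))

    val : Fin N → Carrier
    val i = eval (w i)

    E : Fin N → Fin N → Set
    E i j = edge i j ≡ true

    open ConnectionSet G {Fin N} (λ _ → ⊤) val

    P? : Decidable P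
    P? g with Finₚ.any? (λ i → _≟_ G (val i) g)
    ... | yes (i , p) = yes (i , tt , p)
    ... | no ¬p       = no λ (i , _ , p) → ¬p (i , p)

    module _ (hold : All Holds facts) (ok : settled ≡ true) where
      private
        refute : ∀ v → is-false (verdict facts v) ≡ true → eval v ≢ ε
        refute v e with verdict facts v in q
        ... | just false = proj₂ (verdict-sound facts hold v false q) refl
        confirm : ∀ v → is-true (verdict facts v) ≡ true → eval v ≡ ε
        confirm v e with verdict facts v in q
        ... | just true = proj₁ (verdict-sound facts hold v true q) refl
        decide : ∀ v → known (verdict facts v) ≡ true → eval v ≡ ε → is-true (verdict facts v) ≡ true
        decide v k z with verdict facts v in q
        ... | just true  = refl
        ... | just false = ⊥-elim (proj₂ (verdict-sound facts hold v false q) refl z)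
        oriented-ok : ∀ i j → is-false (verdict facts (w i ++ w j)) ≡ true
        oriented-ok i j = every-sound (λ j → is-false (verdict facts (w i ++ w j)))
          (every-sound (λ i → every λ j → is-false (verdict facts (w i ++ w j))) (proj₁ (∧-true ok)) i) j
        injective-ok : ∀ i j → (i == j) ∨ is-false (verdict facts (w i ++ inv (w j))) ≡ true
        injective-ok i j = every-sound _ (every-sound _ (proj₁ (∧-true (proj₂ (∧-true
          {every λ i → every λ j → is-false (verdict facts (w i ++ w j))} ok)))) i) j
        arrows-ok : ∀ k i j → known (arrow k i j) ≡ true
        arrows-ok k i j = every-sound _ (every-sound _ (every-sound _ (proj₂ (∧-true
          {every λ i → every λ j → (i == j) ∨ is-false (verdict facts (w i ++ inv (w j)))} (proj₂ (∧-true
          {every λ i → every λ j → is-false (verdict facts (w i ++ w j))} ok)))) k) i) j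

      induced : Induced E
      induced = record
        { complete  = λ {u} {v} {x} _ _ _ h → some-complete (λ k → is-true (arrow k v x)) u (decide ((w u ++ w v) ++ inv (w x)) (arrows-ok u v x)
            (trans (eval-quotient (w u ++ w v) (w x)) (ε-quotient (trans (eval-++ (w u) (w v)) h))))
        ; sound     = λ {v} {x} e → tt , tt , (let (k , p) = some-sound (λ k → is-true (arrow k v x)) e in k , tt ,
            trans (sym (eval-++ (w k) (w v)))
              (quotient-ε (trans (sym (eval-quotient (w k ++ w v) (w x))) (confirm ((w k ++ w v) ++ inv (w x)) p))))
        ; injective = λ {v} {x} _ _ h → [ ==-true , (λ p → ⊥-elim (refute (w v ++ inv (w x)) p
            (trans (eval-quotient (w v) (w x)) (ε-quotient h)))) ]′ (∨-true (injective-ok v x))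
        ; oriented  = λ {v} {x} _ _ h → refute (w v ++ w x) (oriented-ok v x) (trans (eval-++ (w v) (w x)) h) }

      fixed-target : (target : Fin N → Bool) → Search.rigid edge target ≡ true →
                     ∀ i → target i ≡ true → Fixed (val i)
      fixed-target target r i t = Induced.fixed-vertex induced i tt λ φ m →
        Search.rigid-sound edge target (Induced.symmetry induced φ) (λ i → Induced.image-maps induced φ tt) r i t m

      fixed-generator : ∀ {k} i → w i ≡ pos k ∷ [] → Fixed (val i) → Fixed (ρ k)
      fixed-generator i e = subst Fixed (trans (cong eval e) (identityʳ _))

      admits-generated : (∀ g → Fixed g) → AdmitsORR G
      admits-generated = admits P? (Induced.antisymmetric induced)

-- Two and three generators

pattern X  = pos 0
pattern X⁻ = neg 0
pattern Y  = pos 1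
pattern Y⁻ = neg 1
pattern Z  = pos 2
pattern Z⁻ = neg 2

exchange₀₁ : ℕ → ℕ
exchange₀₁ 0 = 1
exchange₀₁ 1 = 0
exchange₀₁ k = k

exchange₀₂ : ℕ → ℕ
exchange₀₂ 0 = 2
exchange₀₂ 2 = 0
exchange₀₂ k = k

exchange₁₂ : ℕ → ℕ
exchange₁₂ 1 = 2
exchange₁₂ 2 = 1
exchange₁₂ k = k

module SmallSets (G : FiniteGroup) where
  open FiniteGroup G
  open IsGroup isGroup using (identityʳ)
  open Families G

  exchange₀₁-family : ∀ {ρ n} → 1 < n → Family ρ n → Family (λ i → ρ (exchange₀₁ i)) n
  exchange₀₁-family {n = n} 1<n = permute exchange₀₁ (λ { 0 → refl ; 1 → refl ; (suc (suc _)) → refl })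
    λ { {0} _ → 1<n ; {1} p → pred-< p ; {suc (suc _)} p → p }

  exchange₀₂-family : ∀ {ρ n} → 2 < n → Family ρ n → Family (λ i → ρ (exchange₀₂ i)) n
  exchange₀₂-family 2<n = permute exchange₀₂ (λ { 0 → refl ; 1 → refl ; 2 → refl ; (suc (suc (suc _))) → refl })
    λ { {0} _ → 2<n ; {1} p → p ; {2} p → pred-< (pred-< p) ; {suc (suc (suc _))} p → p }

  exchange₁₂-family : ∀ {ρ n} → 2 < n → Family ρ n → Family (λ i → ρ (exchange₁₂ i)) n
  exchange₁₂-family 2<n = permute exchange₁₂ (λ { 0 → refl ; 1 → refl ; 2 → refl ; (suc (suc (suc _))) → refl })
    λ { {0} p → p ; {1} _ → 2<n ; {2} p → pred-< p ; {suc (suc (suc _))} p → p }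

  empty-family : ∀ {ρ} → Family ρ 0 → AdmitsORR G
  empty-family {ρ} fam = admits-generated [] refl (fixed-all generated (λ _ ()))
    where
    open Family fam
    open WordSet G ρ separation (GroupWords.free G ρ)
    open Chosen [] []

  single-family : ∀ {ρ} → Family ρ 1 → AdmitsORR G
  single-family {ρ} fam = admits-generated hold refl
    (fixed-all generated λ { zero _ → fixed-generator hold refl zero refl (fixed-target hold refl (λ _ → true) refl zero refl)
                           ; (suc _) (s≤s ()) })
    where
    open Family fam
    open WordSet G ρ separation (GroupWords.free G ρ)
    open Chosen ((X ∷ []) ∷ []) (ne (X ∷ X ∷ []) ∷ [])
    hold : All Holds (ne (X ∷ X ∷ []) ∷ [])
    hold = (λ e → square 0 z<s (trans (cong (ρ 0 ∙_) (sym (identityʳ _))) e)) ∷ []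

  module CommutingPair {ρ : ℕ → Carrier} (fam : Family ρ 2) (xy≡yx : ρ 0 ∙ ρ 1 ≡ ρ 1 ∙ ρ 0) where
    open Family fam
    open GroupWords G ρ

    relations : Relations
    relations = record
      { commuting = λ { 0 1 → true ; 1 0 → true ; _ _ → false }
      ; commutes  = λ { 0 1 _ → xy≡yx ; 1 0 _ → sym xy≡yx } }

    open WordSet G ρ separation relations

    squares : ∀ k → k < 2 → eval (pos k ∷ pos k ∷ []) ≢ ε
    squares k k<2 e = square k k<2 (trans (cong (ρ k ∙_) (sym (identityʳ _))) e)

    xx≢ε : eval (X ∷ X ∷ []) ≢ ε
    xx≢ε = squares 0 z<s
    yy≢ε : eval (Y ∷ Y ∷ []) ≢ ε
    yy≢ε = squares 1 (s<s z<s)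

    BB : Word
    BB = Y ∷ X⁻ ∷ Y ∷ X⁻ ∷ []

    module _ (bb≢ε : eval BB ≢ ε) where

      -- As x and y commute, (y x⁻¹)² ≠ 1 means x² ≠ y². Then y → y² is the only arc on {x, y, y²},
      -- and x is isolated.
      square-set : eval (Y ∷ Y ∷ Y ∷ []) ≢ ε → eval (Y ∷ Y ∷ Y ∷ Y ∷ []) ≢ ε → AdmitsORR G
      square-set y³≢ε y⁴≢ε = admits-generated hold refl (fixed-all generated
        λ { zero _ → stays zero refl ; (suc zero) _ → stays (suc zero) refl ; (suc (suc _)) (s≤s (s≤s ())) })
        where
        facts : List Fact
        facts = ne (X ∷ X ∷ []) ∷ ne (Y ∷ Y ∷ []) ∷ ne BB ∷ ne (Y ∷ Y ∷ Y ∷ []) ∷ ne (Y ∷ Y ∷ Y ∷ Y ∷ []) ∷ []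
        hold : All Holds facts
        hold = xx≢ε ∷ yy≢ε ∷ bb≢ε ∷ y³≢ε ∷ y⁴≢ε ∷ []
        open Chosen ((X ∷ []) ∷ (Y ∷ []) ∷ (Y ∷ Y ∷ []) ∷ []) facts
        stays : ∀ {k} i → w i ≡ pos k ∷ [] → _
        stays i e = fixed-generator hold refl i e (fixed-target hold refl (λ _ → true) refl i refl)

      -- The twins x and y x⁻¹ both lead to y. Adding y x separates them, because x leads to y x as
      -- well and y x⁻¹ does not.
      quadrangle-set : eval (X ∷ X ∷ X ∷ X ∷ []) ≡ ε → eval (Y ∷ Y ∷ Y ∷ Y ∷ []) ≡ ε → AdmitsORR G
      quadrangle-set x⁴ y⁴ = admits-generated hold refl (fixed-all generated
        λ { zero _ → stays zero refl ; (suc zero) _ → stays (suc zero) refl ; (suc (suc _)) (s≤s (s≤s ())) })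
        where
        facts : List Fact
        facts = ne (X ∷ X ∷ []) ∷ ne (Y ∷ Y ∷ []) ∷ ne BB ∷ ne (X ∷ X ∷ X ∷ []) ∷
                ne (BB ++ X⁻ ∷ []) ∷ ne (Y ∷ X ∷ Y ∷ X ∷ []) ∷ []
        hold : All Holds facts
        hold = xx≢ε ∷ yy≢ε ∷ bb≢ε
          ∷ (λ x³ → nontrivial-sound (X ∷ []) refl (derive (X ∷ []) []
              (([] , ((X ∷ X ∷ X ∷ X ∷ [] , []) by x⁴)) ∷ ([] , (([] , X ∷ X ∷ X ∷ []) by sym x³)) ∷ []) refl))
          ∷ (λ h → nontrivial-sound (Y ∷ Y ∷ X ∷ []) refl (derive (Y ∷ Y ∷ X ∷ []) []
              (([] , ((X ∷ X ∷ X ∷ X ∷ [] , []) by x⁴)) ∷ ([] , ((BB ++ X⁻ ∷ [] , []) by h)) ∷ []) refl))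
          ∷ (λ h → bb≢ε (derive BB []
              (([] , (([] , X ∷ X ∷ X ∷ X ∷ []) by sym x⁴)) ∷ ([] , ((Y ∷ X ∷ Y ∷ X ∷ [] , []) by h)) ∷ []) refl))
          ∷ []
        open Chosen ((X ∷ []) ∷ (Y ∷ []) ∷ (Y ∷ X⁻ ∷ []) ∷ (Y ∷ X ∷ []) ∷ []) facts
        stays : ∀ {k} i → w i ≡ pos k ∷ [] → _
        stays i e = fixed-generator hold refl i e (fixed-target hold refl (λ _ → true) refl i refl)

    power : ℕ → Word
    power zero    = []
    power (suc n) = X ∷ Y ∷ power n

    -- Here x y generates the group, so the connection set {x y} yields a directed cycle.
    cyclic-set : eval (X ∷ X ∷ X ∷ []) ≡ ε → eval (Y ∷ Y ∷ Y ∷ Y ∷ []) ≡ ε → AdmitsORR G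
    cyclic-set x³ y⁴ = admits-generated hold refl (fixed-all generated
        -- The exponents solve congruences: 4 is 1 modulo 3 and 0 modulo 4, while 9 is 0 modulo 3
        -- and 1 modulo 4.
        λ { zero _ → subst Fixed (trans x-power (identityʳ _)) (fixed-power 4)
          ; (suc zero) _ → subst Fixed (trans y-power (identityʳ _)) (fixed-power 9)
          ; (suc (suc _)) (s≤s (s≤s ())) })
      where
      facts : List Fact
      facts = ne (X ∷ Y ∷ X ∷ Y ∷ []) ∷ []
      hold : All Holds facts
      hold = (λ h → nontrivial-sound (X ∷ []) refl (derive (X ∷ []) []
          (([] , ((power 2 , []) by h)) ∷ ([] , ((power 2 , []) by h)) ∷ ([] , (([] , Y ∷ Y ∷ Y ∷ Y ∷ []) by sym y⁴)) ∷
           ([] , (([] , X ∷ X ∷ X ∷ []) by sym x³)) ∷ []) refl)) ∷ []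
      open Chosen ((X ∷ Y ∷ []) ∷ []) facts
      open ConnectionSet G {Fin 1} (λ _ → ⊤) val using (Fixed; fixed-∙; fixed-ε)
      generator : Fixed (eval (X ∷ Y ∷ []))
      generator = fixed-target hold refl (λ _ → true) refl zero refl
      fixed-power : ∀ n → Fixed (eval (power n))
      fixed-power zero    = fixed-ε
      fixed-power (suc n) = subst Fixed (sym (eval-++ (X ∷ Y ∷ []) (power n))) (fixed-∙ generator (fixed-power n))
      X³ Y⁴ : Word × Relator
      X³ = [] , ((X ∷ X ∷ X ∷ [] , []) by x³)
      Y⁴ = [] , ((Y ∷ Y ∷ Y ∷ Y ∷ [] , []) by y⁴)
      x-power : eval (power 4) ≡ eval (X ∷ [])
      x-power = derive (power 4) (X ∷ []) (X³ ∷ Y⁴ ∷ []) refl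
      y-power : eval (power 9) ≡ eval (Y ∷ [])
      y-power = derive (power 9) (Y ∷ []) (X³ ∷ X³ ∷ X³ ∷ Y⁴ ∷ Y⁴ ∷ []) refl

module Pairs (G : FiniteGroup) where
  open FiniteGroup G
  open IsGroup isGroup using (assoc; identityʳ; inverseˡ; inverseʳ)
  open GroupProperties (asGroup G)
  open Families G
  open SmallSets G

  -- The three possible arcs at the quotient of the edge p → q, as in EdgeQuotients.
  Commuting Inverting Returning : Carrier → Carrier → Set
  Commuting p q = p ∙ (q ∙ p ⁻¹) ≡ q
  Inverting p q = p ∙ q ≡ q ∙ p ⁻¹
  Returning p q = q ∙ (q ∙ p ⁻¹) ≡ p ⊎ (q ∙ p ⁻¹) ∙ (q ∙ p ⁻¹) ≡ p

  commuting? : ∀ p q → Dec (Commuting p q)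
  commuting? p q = _≟_ G _ _

  inverting? : ∀ p q → Dec (Inverting p q)
  inverting? p q = _≟_ G _ _

  returning? : ∀ p q → Dec (Returning p q)
  returning? p q = _≟_ G _ _ ⊎-dec _≟_ G _ _

  inverted-quotient : ∀ g h → (h ∙ g ⁻¹) ∙ (h ∙ g ⁻¹) ≢ ε → (g ∙ h ⁻¹) ∙ (g ∙ h ⁻¹) ≢ ε
  inverted-quotient g h sq e = sq (trans (sym (⁻¹-involutive _)) (trans (cong _⁻¹ (trans inverse-square e)) ε⁻¹≈ε))
    where
    flipped : (h ∙ g ⁻¹) ⁻¹ ≡ g ∙ h ⁻¹
    flipped = trans (⁻¹-anti-homo-∙ _ _) (cong (_∙ h ⁻¹) (⁻¹-involutive _))
    inverse-square : ((h ∙ g ⁻¹) ∙ (h ∙ g ⁻¹)) ⁻¹ ≡ (g ∙ h ⁻¹) ∙ (g ∙ h ⁻¹)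
    inverse-square = trans (⁻¹-anti-homo-∙ _ _) (cong₂ _∙_ flipped flipped)

  commuting-swap : ∀ g h → Commuting g h → g ∙ h ≡ h ∙ g
  commuting-swap g h c = trans (cong (g ∙_) (sym cancelled)) (trans (sym (assoc _ _ _)) (cong (_∙ g) c))
    where
    cancelled : (h ∙ g ⁻¹) ∙ g ≡ h
    cancelled = trans (assoc _ _ _) (trans (cong (h ∙_) (inverseˡ g)) (identityʳ h))

  swap-commuting : ∀ g h → g ∙ h ≡ h ∙ g → Commuting g h
  swap-commuting g h c = trans (sym (assoc _ _ _)) (trans (cong (_∙ g ⁻¹) c)
    (trans (assoc _ _ _) (trans (cong (h ∙_) (inverseʳ _)) (identityʳ _))))

  commuting-sym : ∀ g h → Commuting g h → Commuting h g
  commuting-sym g h c = swap-commuting h g (sym (commuting-swap g h c))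

  -- A pair that does not commute fails only through the rotating triangle. For a commuting pair
  -- `square-set` applies unless x and y each satisfy g³ = 1 or g⁴ = 1, and then only two cubes
  -- equal to 1 resist the other sets.
  pair : ∀ {ρ} → Family ρ 2 → (ρ 1 ∙ ρ 0 ⁻¹) ∙ (ρ 1 ∙ ρ 0 ⁻¹) ≢ ε →
         AdmitsORR G ⊎ (Inverting (ρ 0) (ρ 1) × Returning (ρ 0) (ρ 1)) ⊎
         (ρ 0 ∙ ρ 1 ≡ ρ 1 ∙ ρ 0 × ρ 0 ∙ (ρ 0 ∙ ρ 0) ≡ ε × ρ 1 ∙ (ρ 1 ∙ ρ 1) ≡ ε)
  pair {ρ} fam sq with commuting? (ρ 0) (ρ 1)
  ... | no ¬c with StraightSet.straight fam (λ { zero _ → sq ; (suc _) (s≤s ()) }) z<s (inj₁ ¬c)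
  ...   | inj₁ orr                   = inj₁ orr
  ...   | inj₂ (inj₁ (() , _))
  ...   | inj₂ (inj₂ (_ , i , p))    = inj₂ (inj₁ (i , p))
  pair {ρ} fam sq | yes c = commuting
    where
    open GroupWords G ρ
    open Reduction free
    x y : Expr
    x = var 0
    y = var 1
    xy≡yx : ρ 0 ∙ ρ 1 ≡ ρ 1 ∙ ρ 0
    xy≡yx = commuting-swap (ρ 0) (ρ 1) c
    fam′ = exchange₀₁-family (s<s z<s) fam
    module CP  = CommutingPair fam xy≡yx
    module CP′ = CommutingPair fam′ (sym xy≡yx)
    bb : eval (Y ∷ X⁻ ∷ Y ∷ X⁻ ∷ []) ≢ ε
    bb e = sq (from-words ((y ⊙ x ⁻) ⊙ (y ⊙ x ⁻)) unit e)
    bb′ : eval (X ∷ Y⁻ ∷ X ∷ Y⁻ ∷ []) ≢ ε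
    bb′ e = bb (derive (Y ∷ X⁻ ∷ Y ∷ X⁻ ∷ []) [] (([] , (([] , X ∷ Y⁻ ∷ X ∷ Y⁻ ∷ []) by sym e)) ∷ []) refl)
    cube : ∀ k → eval (pos k ∷ pos k ∷ pos k ∷ []) ≡ ε → ρ k ∙ (ρ k ∙ ρ k) ≡ ε
    cube k = from-words (var k ⊙ (var k ⊙ var k)) unit
    is? : (w : Word) → Dec (eval w ≡ ε)
    is? w = _≟_ G _ _
    commuting : _
    commuting with is? (Y ∷ Y ∷ Y ∷ []) | is? (Y ∷ Y ∷ Y ∷ Y ∷ []) | is? (X ∷ X ∷ X ∷ []) | is? (X ∷ X ∷ X ∷ X ∷ [])
    ... | no y³  | no y⁴  | _      | _      = inj₁ (CP.square-set bb y³ y⁴)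
    ... | _      | _      | no x³  | no x⁴  = inj₁ (CP′.square-set bb′ x³ x⁴)
    ... | yes y³ | _      | yes x³ | _      = inj₂ (inj₂ (xy≡yx , cube 0 x³ , cube 1 y³))
    ... | _      | yes y⁴ | _      | yes x⁴ = inj₁ (CP.quadrangle-set bb x⁴ y⁴)
    ... | _      | yes y⁴ | yes x³ | _      = inj₁ (CP.cyclic-set x³ y⁴)
    ... | yes y³ | _      | _      | yes x⁴ = inj₁ (CP′.cyclic-set y³ x⁴)

  triple : ∀ {ρ} → Family ρ 3 → (ρ 1 ∙ ρ 0 ⁻¹) ∙ (ρ 1 ∙ ρ 0 ⁻¹) ≢ ε → (ρ 2 ∙ ρ 1 ⁻¹) ∙ (ρ 2 ∙ ρ 1 ⁻¹) ≢ ε →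
           ¬ Commuting (ρ 0) (ρ 1) ⊎ Returning (ρ 0) (ρ 1) →
           AdmitsORR G ⊎ (Inverting (ρ 0) (ρ 1) × Returning (ρ 1) (ρ 2) ×
             (¬ Returning (ρ 0) (ρ 1) × ¬ Commuting (ρ 1) (ρ 2) × ¬ Inverting (ρ 1) (ρ 2) ⊎
              Returning (ρ 0) (ρ 1) × Inverting (ρ 1) (ρ 2)))
  triple fam sq₀ sq₁ s with StraightSet.straight fam
    (λ { 0 _ → sq₀ ; 1 _ → sq₁ ; (suc (suc _)) (s≤s (s≤s ())) }) z<s s
  ... | inj₁ orr                = inj₁ orr
  ... | inj₂ (inj₁ (_ , x))     = inj₂ x
  ... | inj₂ (inj₂ (() , _))

  module PairFacts {ρ : ℕ → Carrier} {n : ℕ} (S : GroupWords.Separated G ρ (suc (suc n))) where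
    open GroupWords G ρ
    open Separated S
    open Reduction free
    open Decision free
    private
      x y : Expr
      x = var 0
      y = var 1

    exclude : Commuting (ρ 0) (ρ 1) → ¬ Inverting (ρ 0) (ρ 1)
    exclude c i = square 0 z<s (deduce (x ⊙ x) unit
      ((X ∷ [] , relator (x ⊙ y) (y ⊙ x ⁻) i) ∷ ([] , relator (x ⊙ (y ⊙ x ⁻)) y c) ∷ []) refl)

    -- The second form of `Returning` is impossible: replacing the last y x⁻¹ by x y in (y x⁻¹)² = x
    -- gives y² = x, against separation.
    equal-squares : Inverting (ρ 0) (ρ 1) → Returning (ρ 0) (ρ 1) → ρ 0 ∙ ρ 0 ≡ ρ 1 ∙ ρ 1
    equal-squares i (inj₁ r) = deduce (x ⊙ x) (y ⊙ y) (([] , relator x (y ⊙ (y ⊙ x ⁻)) (sym r)) ∷ []) refl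
    equal-squares i (inj₂ r) = ⊥-elim (distinct (Y ∷ Y ∷ []) (X ∷ []) refl
      (derive (Y ∷ Y ∷ []) (X ∷ [])
        ((Y ∷ X⁻ ∷ [] , relator (x ⊙ y) (y ⊙ x ⁻) i) ∷ ([] , relator ((y ⊙ x ⁻) ⊙ (y ⊙ x ⁻)) x r) ∷ []) refl))

module Triples (G : FiniteGroup) where
  open FiniteGroup G
  open IsGroup isGroup using (identityʳ)
  open Families G
  open SmallSets G
  open Pairs G

  module Triple {ρ : ℕ → Carrier} (fam : Family ρ 3)
    (sq₀ : (ρ 1 ∙ ρ 0 ⁻¹) ∙ (ρ 1 ∙ ρ 0 ⁻¹) ≢ ε) (sq₁ : (ρ 2 ∙ ρ 1 ⁻¹) ∙ (ρ 2 ∙ ρ 1 ⁻¹) ≢ ε) where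
    open Family fam
    open GroupWords G ρ

    x y z : Expr
    x = var 0
    y = var 1
    z = var 2

    squares : ∀ k → k < 3 → eval (pos k ∷ pos k ∷ []) ≢ ε
    squares k k<3 e = square k k<3 (trans (cong (ρ k ∙_) (sym (identityʳ _))) e)

    module Free where
      open Reduction free

      -- Since y inverts z, (z y⁻¹)² equals y⁻², and the equation would give y³ = 1. But y also
      -- inverts x, hence so does its cube, and x² = 1 follows.
      inverting-both : Inverting (ρ 0) (ρ 1) → Inverting (ρ 2) (ρ 1) →
                       (ρ 2 ∙ ρ 1 ⁻¹) ∙ (ρ 2 ∙ ρ 1 ⁻¹) ≢ ρ 1
      inverting-both i j r = square 0 z<s (deduce (x ⊙ x) unit
        ((X ∷ [] , y³⁻) ∷ ([] , k) ∷ (Y ∷ X⁻ ∷ [] , k⁻) ∷ (Y ∷ Y ∷ [] , k) ∷ ([] , y³⁺) ∷ []) refl)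
        where
        y³ : ⟪ y ⊙ y ⊙ y ⟫ ≡ ε
        y³ = deduce (y ⊙ y ⊙ y) unit
          (([] , relator y ((z ⊙ y ⁻) ⊙ (z ⊙ y ⁻)) (sym r)) ∷ (Y⁻ ∷ Z⁻ ∷ [] , relator (z ⊙ y) (y ⊙ z ⁻) j) ∷ []) refl
        k k⁻ y³⁺ y³⁻ : Relator
        k   = relator (x ⊙ y) (y ⊙ x ⁻) i
        k⁻  = relator (y ⊙ x ⁻) (x ⊙ y) (sym i)
        y³⁺ = relator (y ⊙ y ⊙ y) unit y³
        y³⁻ = relator unit (y ⊙ y ⊙ y) (sym y³)

      equal-squares-returning : ρ 2 ∙ ρ 2 ≡ ρ 1 ∙ ρ 1 → Returning (ρ 2) (ρ 1)
      equal-squares-returning e = inj₁ (deduce (y ⊙ (y ⊙ z ⁻)) z (([] , relator (y ⊙ y) (z ⊙ z) (sym e)) ∷ []) refl)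

      -- If (z x⁻¹)² = 1, then z x⁻¹ = x z⁻¹, and multiplying by the common square x² = z² gives z x
      -- = x z.
      quotient-square : ρ 0 ∙ ρ 0 ≡ ρ 2 ∙ ρ 2 → ρ 2 ∙ ρ 0 ≢ ρ 0 ∙ ρ 2 → (ρ 2 ∙ ρ 0 ⁻¹) ∙ (ρ 2 ∙ ρ 0 ⁻¹) ≢ ε
      quotient-square s ¬c e = ¬c (deduce (z ⊙ x) (x ⊙ z)
        (([] , relator ((z ⊙ x ⁻) ⊙ (z ⊙ x ⁻)) unit e) ∷ (X ∷ Z⁻ ∷ [] , relator (x ⊙ x) (z ⊙ z) s) ∷ []) refl)

    reversed : Family (λ i → ρ (exchange₀₂ i)) 3
    reversed = exchange₀₂-family (s<s (s<s z<s)) fam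

    sq₀⁻ : (ρ 0 ∙ ρ 1 ⁻¹) ∙ (ρ 0 ∙ ρ 1 ⁻¹) ≢ ε
    sq₀⁻ = inverted-quotient (ρ 0) (ρ 1) sq₀
    sq₁⁻ : (ρ 1 ∙ ρ 2 ⁻¹) ∙ (ρ 1 ∙ ρ 2 ⁻¹) ≢ ε
    sq₁⁻ = inverted-quotient (ρ 1) (ρ 2) sq₁

    -- The connection set {x, y, z, y x⁻¹}: the first, second and fourth element form a directed triangle,
    -- z is isolated, and conjugation by z preserves exactly one vertex of the triangle.
    module Triangle (i : Inverting (ρ 0) (ρ 1)) (r : Returning (ρ 0) (ρ 1)) (j : Inverting (ρ 1) (ρ 2)) where
      open EdgeQuotients G ρ separation 1 (λ e → e) suc

      ends : ∀ (e : ℕ) → (e ≡ e × suc e ≡ suc e) ⊎ (e ≡ suc e × suc e ≡ e)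
      ends e = inj₁ (refl , refl)
      bound : ∀ e → e < 1 → suc e < 3
      bound zero    _ = s<s z<s
      bound (suc _) (s≤s ())
      square-b : ∀ e → e < 1 → b e ∙ b e ≢ ε
      square-b zero    _ = sq₀
      square-b (suc _) (s≤s ())

      open Path ends bound square-b
      open ConnectionSet G Valid val
      open Induced induced
      open Reduction free using (deduce; relator; _by_)

      one : 0 < 1
      one = z<s

      isolated : ∀ {w} → ¬ E (va 2) w
      isolated (along (s≤s ()))
      isolated (outof (s≤s ()) _)

      -- z is the only sink, since each of the other vertices has an arc of the triangle leaving it.
      fixed-z : Fixed (ρ 2)
      fixed-z = fixed-vertex (va 2) (s<s (s<s z<s)) λ φ {w} m → only φ w (proj₁ (proj₂ m)) m
        where
        only : ∀ φ w → Valid w → Maps φ (va 2) w → w ≡ va 2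
        blocked : ∀ φ {w w′} → Maps φ (va 2) w → E w w′ → ⊥
        blocked φ m e = isolated (proj₂ (proj₂ (Symmetry.out⁻ (symmetry φ) {_} {va 2} m e)))
        only φ (va 0) _ m = ⊥-elim (blocked φ m (along one))
        only φ (va 1) _ m = ⊥-elim (blocked φ m (outof one i))
        only φ (va 2) _ m = refl
        only φ (va (suc (suc (suc _)))) (s≤s (s≤s (s≤s ()))) m
        only φ (vb zero) _ m = ⊥-elim (blocked φ m (back one r))
        only φ (vb (suc _)) (s≤s ()) m

      not-z : ∀ φ v → v ≢ va 2 → ¬ Maps φ v (va 2)
      not-z φ v ≢ m = ≢ (Symmetry.inj (symmetry φ) {va 2} {v} {va 2} m (maps-fixed (va 2) (s<s (s<s z<s)) fixed-z φ))

      y-inverted : ρ 2 ∙ ρ 1 ∙ ρ 2 ⁻¹ ≡ ρ 1 ⁻¹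
      y-inverted = deduce (z ⊙ y ⊙ z ⁻) (y ⁻) ((Y⁻ ∷ [] , relator (y ⊙ z) (z ⊙ y ⁻) j) ∷ []) refl

      P-val : ∀ v → Valid v → P (val v)
      P-val v p = v , p , refl

      conjugate : ∀ φ v w → Maps φ v w → P (ρ 2 ∙ val v ∙ ρ 2 ⁻¹) → P (ρ 2 ∙ val w ∙ ρ 2 ⁻¹)
      conjugate φ v w (_ , _ , e) p = subst (λ g → P (ρ 2 ∙ g ∙ ρ 2 ⁻¹)) e (fixed-transport fixed-z fixed-z φ (val v) p)

      not-inverted : ∀ w → Valid w → ρ 2 ∙ val w ∙ ρ 2 ⁻¹ ≡ val w ⁻¹ → ¬ P (ρ 2 ∙ val w ∙ ρ 2 ⁻¹)
      not-inverted w p e q = antisymmetric (val w) (P-val w p) (subst P e q)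

      from-x : Fixed (ρ 0) → AdmitsORR G
      from-x fx = admits P? antisymmetric (fixed-all generated
        λ { 0 _ → fx ; 1 _ → fy ; 2 _ → fixed-z ; (suc (suc (suc _))) (s≤s (s≤s (s≤s ()))) })
        where
        fy : Fixed (ρ 1)
        fy = pinned (va 1) (s<s z<s) λ φ → next φ (Symmetry.out (symmetry φ) (maps-fixed (va 0) z<s fx φ) (along one))
          where
          next : ∀ φ → (∃ λ w → Maps φ (va 1) w × E (va 0) w) → Maps φ (va 1) (va 1)
          next φ (_ , m , along _) = m

      -- Conjugation by z fixes x and inverts y and y x⁻¹, so x is the triangle vertex whose
      -- conjugate stays in the connection set.
      central-x : ρ 2 ∙ ρ 0 ≡ ρ 0 ∙ ρ 2 → AdmitsORR G
      central-x c = from-x (fixed-vertex (va 0) z<s λ φ {w} m → only φ w (proj₁ (proj₂ m)) m)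
        where
        x-kept : ρ 2 ∙ ρ 0 ∙ ρ 2 ⁻¹ ≡ ρ 0
        x-kept = deduce (z ⊙ x ⊙ z ⁻) x (([] , relator (z ⊙ x) (x ⊙ z) c) ∷ []) refl
        b-inverted : ρ 2 ∙ (ρ 1 ∙ ρ 0 ⁻¹) ∙ ρ 2 ⁻¹ ≡ (ρ 1 ∙ ρ 0 ⁻¹) ⁻¹
        b-inverted = deduce (z ⊙ (y ⊙ x ⁻) ⊙ z ⁻) ((y ⊙ x ⁻) ⁻)
          (([] , relator (z ⊙ y ⊙ z ⁻) (y ⁻) y-inverted) ∷ (Y⁻ ∷ X⁻ ∷ [] , relator x (z ⊙ x ⊙ z ⁻) (sym x-kept)) ∷
           (Y⁻ ∷ X⁻ ∷ [] , relator (y ⊙ x ⁻) (x ⊙ y) (sym i)) ∷ []) refl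
        only : ∀ φ w → Valid w → Maps φ (va 0) w → w ≡ va 0
        kept : P (ρ 2 ∙ ρ 0 ∙ ρ 2 ⁻¹)
        kept = subst P (sym x-kept) (P-val (va 0) z<s)
        only φ (va 0) _ m = refl
        only φ (va 1) p m = ⊥-elim (not-inverted (va 1) p y-inverted (conjugate φ (va 0) (va 1) m kept))
        only φ (va 2) _ m = ⊥-elim (not-z φ (va 0) (λ ()) m)
        only φ (va (suc (suc (suc _)))) (s≤s (s≤s (s≤s ()))) m
        only φ (vb zero) p m = ⊥-elim (not-inverted (vb 0) p b-inverted (conjugate φ (va 0) (vb 0) m kept))
        only φ (vb (suc _)) (s≤s ()) m

      -- Here z inverts x and y and, as x² = y², centralises y x⁻¹. That vertex is then fixed, and
      -- its only arc leads to x.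
      inverted-x : Inverting (ρ 0) (ρ 2) → ρ 0 ∙ ρ 0 ≡ ρ 1 ∙ ρ 1 → AdmitsORR G
      inverted-x k s = from-x (pinned (va 0) z<s λ φ →
          next φ (Symmetry.out (symmetry φ) (maps-fixed (vb 0) one fb φ) (back one r)))
        where
        x-inverted : ρ 2 ∙ ρ 0 ∙ ρ 2 ⁻¹ ≡ ρ 0 ⁻¹
        x-inverted = deduce (z ⊙ x ⊙ z ⁻) (x ⁻) ((X⁻ ∷ [] , relator (x ⊙ z) (z ⊙ x ⁻) k) ∷ []) refl
        b-kept : ρ 2 ∙ (ρ 1 ∙ ρ 0 ⁻¹) ∙ ρ 2 ⁻¹ ≡ ρ 1 ∙ ρ 0 ⁻¹
        b-kept = deduce (z ⊙ (y ⊙ x ⁻) ⊙ z ⁻) (y ⊙ x ⁻)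
          (([] , relator (z ⊙ y ⊙ z ⁻) (y ⁻) y-inverted) ∷ (Y⁻ ∷ X ∷ [] , relator (x ⁻) (z ⊙ x ⊙ z ⁻) (sym x-inverted)) ∷
           (Y⁻ ∷ [] , relator (x ⊙ x) (y ⊙ y) s) ∷ []) refl
        kept : P (ρ 2 ∙ (ρ 1 ∙ ρ 0 ⁻¹) ∙ ρ 2 ⁻¹)
        kept = subst P (sym b-kept) (P-val (vb 0) one)
        only : ∀ φ w → Valid w → Maps φ (vb 0) w → w ≡ vb 0
        only φ (va 0) p m = ⊥-elim (not-inverted (va 0) p x-inverted (conjugate φ (vb 0) (va 0) m kept))
        only φ (va 1) p m = ⊥-elim (not-inverted (va 1) p y-inverted (conjugate φ (vb 0) (va 1) m kept))
        only φ (va 2) _ m = ⊥-elim (not-z φ (vb 0) (λ ()) m)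
        only φ (va (suc (suc (suc _)))) (s≤s (s≤s (s≤s ()))) m
        only φ (vb zero) p m = refl
        only φ (vb (suc _)) (s≤s ()) m
        fb : Fixed (ρ 1 ∙ ρ 0 ⁻¹)
        fb = fixed-vertex (vb 0) one λ φ {w} m → only φ w (proj₁ (proj₂ m)) m
        next : ∀ φ → (∃ λ w → Maps φ (va 0) w × E (vb 0) w) → Maps φ (va 0) (va 0)
        next φ (_ , m , into p c) = ⊥-elim (exclusive 0 p c i)
        next φ (_ , m , back _ _) = m

module CommutingTriples (G : FiniteGroup) where
  open FiniteGroup G
  open Families G
  open Pairs G
  open Triples G

  module Central {ρ : ℕ → Carrier} (fam : Family ρ 3)
    (sq₀ : (ρ 1 ∙ ρ 0 ⁻¹) ∙ (ρ 1 ∙ ρ 0 ⁻¹) ≢ ε) (sq₁ : (ρ 2 ∙ ρ 1 ⁻¹) ∙ (ρ 2 ∙ ρ 1 ⁻¹) ≢ ε)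
    (xy≡yx : ρ 0 ∙ ρ 1 ≡ ρ 1 ∙ ρ 0) (yz≡zy : ρ 1 ∙ ρ 2 ≡ ρ 2 ∙ ρ 1) where
    open Family fam
    open GroupWords G ρ
    open Triple fam sq₀ sq₁ using (x; y; z; squares)

    relations : Relations
    relations = record
      { commuting = λ { 0 1 → true ; 1 0 → true ; 1 2 → true ; 2 1 → true ; _ _ → false }
      ; commutes  = λ { 0 1 _ → xy≡yx ; 1 0 _ → sym xy≡yx ; 1 2 _ → yz≡zy ; 2 1 _ → sym yz≡zy } }

    open WordSet G ρ separation relations

    BB CC : Word
    BB = Y ∷ X⁻ ∷ Y ∷ X⁻ ∷ []
    CC = Z ∷ Y⁻ ∷ Z ∷ Y⁻ ∷ []

    bb≢ε : eval BB ≢ ε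
    bb≢ε e = sq₀ (from-words ((y ⊙ x ⁻) ⊙ (y ⊙ x ⁻)) unit e)
    cc≢ε : eval CC ≢ ε
    cc≢ε e = sq₁ (from-words ((z ⊙ y ⁻) ⊙ (z ⊙ y ⁻)) unit e)

    five-words : Vec Word 5
    five-words = (X ∷ []) ∷ (Y ∷ []) ∷ (Z ∷ []) ∷ (Y ∷ X⁻ ∷ []) ∷ (Y ∷ X ∷ []) ∷ []

    six-words : Vec Word 6
    six-words = (X ∷ []) ∷ (Y ∷ []) ∷ (Z ∷ []) ∷ (Y ∷ X⁻ ∷ []) ∷ (Y ∷ X ∷ []) ∷ (Z ∷ Y⁻ ∷ []) ∷ []

    -- As for commuting pairs, y x separates x from y x⁻¹. If x³ = 1, however, y x⁻¹ → y → y x → y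
    -- x⁻¹ is a triangle dominated by x that can rotate; then z y⁻¹ is added, and the new arc y → z
    -- singles out y.
    central-set : ¬ Returning (ρ 0) (ρ 1) → (ρ 1 ∙ ρ 0) ∙ (ρ 1 ∙ ρ 0) ≢ ε → AdmitsORR G
    central-set ¬r yx = cases (_≟_ G _ _) (_≟_ G _ _)
      where
      common : List Fact
      common = ne (X ∷ X ∷ []) ∷ ne (Y ∷ Y ∷ []) ∷ ne (Z ∷ Z ∷ []) ∷ ne BB ∷ ne CC ∷
               ne (Y ∷ X ∷ Y ∷ X ∷ []) ∷ ne (BB ++ X⁻ ∷ []) ∷ []
      hold : All Holds common
      hold = squares 0 z<s ∷ squares 1 (s<s z<s) ∷ squares 2 (s<s (s<s z<s)) ∷ bb≢ε ∷ cc≢ε ∷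
             (λ e → yx (from-words ((y ⊙ x) ⊙ (y ⊙ x)) unit e)) ∷
             (λ e → ¬r (inj₂ (from-words ((y ⊙ x ⁻) ⊙ (y ⊙ x ⁻)) x
               (derive BB (X ∷ []) (([] , ((BB ++ X⁻ ∷ [] , []) by e)) ∷ []) refl)))) ∷ []
      x³ c³ : Word
      x³ = X ∷ X ∷ X ∷ []
      -- Triviality of this word means (z y⁻¹)² = y, which decides whether z y⁻¹ has an arc to y.
      c³ = CC ++ Y⁻ ∷ []
      module Finish {N : ℕ} (words : Vec Word (3 + N)) (facts : List Fact) (h : All Holds facts)
        (ok : Chosen.settled words facts ≡ true)
        (r : Search.rigid (Chosen.edge words facts) (λ _ → true) ≡ true)
        (wx : Vec.lookup words zero ≡ X ∷ []) (wy : Vec.lookup words (suc zero) ≡ Y ∷ [])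
        (wz : Vec.lookup words (suc (suc zero)) ≡ Z ∷ []) where
        open Chosen words facts
        orr : AdmitsORR G
        orr = admits-generated h ok (fixed-all generated
          λ { 0 _ → stays zero wx ; 1 _ → stays (suc zero) wy ; 2 _ → stays (suc (suc zero)) wz
            ; (suc (suc (suc _))) (s≤s (s≤s (s≤s ()))) })
          where
          stays : ∀ {k} i → w i ≡ pos k ∷ [] → _
          stays i e = fixed-generator h ok i e (fixed-target h ok (λ _ → true) r i refl)
      cases : Dec (eval x³ ≡ ε) → Dec (eval c³ ≡ ε) → AdmitsORR G
      cases (yes p) (yes q) = Finish.orr six-words (eq x³ ∷ eq c³ ∷ common) (p ∷ q ∷ hold) refl refl refl refl refl
      cases (yes p) (no q)  = Finish.orr six-words (eq x³ ∷ ne c³ ∷ common) (p ∷ q ∷ hold) refl refl refl refl refl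
      cases (no p)  _       = Finish.orr five-words (ne x³ ∷ common) (p ∷ hold) refl refl refl refl refl

  module Abelian {ρ : ℕ → Carrier} (fam : Family ρ 3)
    (sq₀ : (ρ 1 ∙ ρ 0 ⁻¹) ∙ (ρ 1 ∙ ρ 0 ⁻¹) ≢ ε) (sq₁ : (ρ 2 ∙ ρ 1 ⁻¹) ∙ (ρ 2 ∙ ρ 1 ⁻¹) ≢ ε)
    (xy≡yx : ρ 0 ∙ ρ 1 ≡ ρ 1 ∙ ρ 0) (yz≡zy : ρ 1 ∙ ρ 2 ≡ ρ 2 ∙ ρ 1) (zx≡xz : ρ 2 ∙ ρ 0 ≡ ρ 0 ∙ ρ 2)
    (xy²≡ε : (ρ 1 ∙ ρ 0) ∙ (ρ 1 ∙ ρ 0) ≡ ε) (zy²≡ε : (ρ 1 ∙ ρ 2) ∙ (ρ 1 ∙ ρ 2) ≡ ε) where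
    open Family fam
    open GroupWords G ρ
    open Triple fam sq₀ sq₁ using (x; y; z; squares)

    relations : Relations
    relations = record
      { commuting = λ { 0 1 → true ; 1 0 → true ; 1 2 → true ; 2 1 → true ; 0 2 → true ; 2 0 → true ; _ _ → false }
      ; commutes  = λ { 0 1 _ → xy≡yx ; 1 0 _ → sym xy≡yx ; 1 2 _ → yz≡zy ; 2 1 _ → sym yz≡zy
                      ; 0 2 _ → sym zx≡xz ; 2 0 _ → zx≡xz } }

    open WordSet G ρ separation relations public

    YX YZ YX⁻ YZ⁻ : Word × Relator
    YX  = [] , relator ((y ⊙ x) ⊙ (y ⊙ x)) unit xy²≡ε
    YX⁻ = [] , relator unit ((y ⊙ x) ⊙ (y ⊙ x)) (sym xy²≡ε)
    YZ  = [] , relator ((y ⊙ z) ⊙ (y ⊙ z)) unit zy²≡ε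
    YZ⁻ = [] , relator unit ((y ⊙ z) ⊙ (y ⊙ z)) (sym zy²≡ε)

    zero-by : (w : Word) → eval w ≡ ε → Word × Relator
    zero-by w e = [] , ((w , []) by e)

    Y⁶ : Word
    Y⁶ = Y ∷ Y ∷ Y ∷ Y ∷ Y ∷ Y ∷ []

    -- From (y x)² = 1 and y³ = 1 it would follow that x² = y⁻² = y, against separation.
    y³≢ε : eval (Y ∷ Y ∷ Y ∷ []) ≢ ε
    y³≢ε e = distinct (X ∷ X ∷ []) (Y ∷ []) refl (derive (X ∷ X ∷ []) (Y ∷ [])
      (YX ∷ ([] , (([] , Y ∷ Y ∷ Y ∷ []) by sym e)) ∷ []) refl)

    BB CC : Word
    BB = Y ∷ X⁻ ∷ Y ∷ X⁻ ∷ []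
    CC = Z ∷ Y⁻ ∷ Z ∷ Y⁻ ∷ []

    facts : List Fact
    facts = ne (X ∷ X ∷ []) ∷ ne (Y ∷ Y ∷ []) ∷ ne BB ∷ ne (Y ∷ Y ∷ Y ∷ []) ∷ ne (Y ∷ Y ∷ Y ∷ Y ∷ []) ∷
            ne CC ∷ ne (CC ++ Y⁻ ∷ []) ∷ ne (CC ++ Y⁻ ∷ Y⁻ ∷ []) ∷ []

    open Chosen ((X ∷ []) ∷ (Y ∷ []) ∷ (Y ∷ Y ∷ []) ∷ (Z ∷ Y⁻ ∷ []) ∷ []) facts

    -- The only arc is y → y², so the subdigraph still admits a swap of the isolated x and z y⁻¹; an
    -- arc of the Cayley digraph outside it excludes the swap. As (z y⁻¹)² = y⁻⁴, the condition y⁶ ≠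
    -- 1 keeps it apart from y².
    four-set : eval Y⁶ ≢ ε → AdmitsORR G
    four-set y⁶ = admits-generated hold refl (fixed-all generated
      λ { 0 _ → fixed-generator hold refl zero refl fx ; 1 _ → fy
        ; 2 _ → subst Fixed z-from (fixed-∙ fc fy)
        ; (suc (suc (suc _))) (s≤s (s≤s (s≤s ()))) })
      where
      hold : All Holds facts
      hold = squares 0 z<s ∷ squares 1 (s<s z<s)
        ∷ (λ e → sq₀ (from-words ((y ⊙ x ⁻) ⊙ (y ⊙ x ⁻)) unit e))
        ∷ y³≢ε
        ∷ (λ e → sq₀ (from-words ((y ⊙ x ⁻) ⊙ (y ⊙ x ⁻)) unit
            (derive BB [] (zero-by (Y ∷ Y ∷ Y ∷ Y ∷ []) e ∷ YX⁻ ∷ []) refl)))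
        ∷ (λ e → sq₁ (from-words ((z ⊙ y ⁻) ⊙ (z ⊙ y ⁻)) unit e))
        ∷ (λ e → distinct (X ∷ X ∷ X ∷ X ∷ []) (Y ∷ []) refl (derive (X ∷ X ∷ X ∷ X ∷ []) (Y ∷ [])
            (YX ∷ YX ∷ zero-by (CC ++ Y⁻ ∷ []) e ∷ YZ⁻ ∷ []) refl))
        ∷ (λ e → y⁶ (derive Y⁶ [] (YZ ∷ ([] , (([] , CC ++ Y⁻ ∷ Y⁻ ∷ []) by sym e)) ∷ []) refl))
        ∷ []
      ind : ConnectionSet.Induced G (λ _ → ⊤) val E
      ind = induced hold refl
      open ConnectionSet G {Fin 4} (λ _ → ⊤) val
      open Induced ind
      target : Fin 4 → Bool
      target (suc zero)       = true
      target (suc (suc zero)) = true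
      target _                = false
      fy′ : Fixed (val (suc zero))
      fy′ = fixed-target hold refl target refl (suc zero) refl
      fyy : Fixed (val (suc (suc zero)))
      fyy = fixed-target hold refl target refl (suc (suc zero)) refl
      fy : Fixed (ρ 1)
      fy = fixed-generator hold refl (suc zero) refl fy′
      no-hit : ∀ φ i → Fixed (val i) → ∀ j → j ≢ i → ¬ Maps φ j i
      no-hit φ i f j ≢ m = ≢ (Symmetry.inj (symmetry φ) {i} {j} {i} m (maps-fixed i tt f φ))
      -- x has the arc x → x² = y⁻², whereas y⁻² (z y⁻¹)⁻¹ = (y z)⁻¹ is an involution.
      not-swapped : ∀ φ → ¬ Maps φ zero (suc (suc (suc zero)))
      not-swapped (φ , n) (_ , _ , e) = no-involution _ involution (subst₂ (λ g h → P (g ∙ h ⁻¹))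
          (fixed-at (fixed-⁻¹ fyy) (φ , n)) e (arc φ (val zero) (val (suc (suc zero)) ⁻¹) (zero , tt , sym step)))
        where
        step : val (suc (suc zero)) ⁻¹ ∙ val zero ⁻¹ ≡ val zero
        step = trans (cong₂ (λ g h → g ⁻¹ ∙ h ⁻¹) (eval-flatten (y ⊙ y)) (eval-flatten x))
          (trans (deduce ((y ⊙ y) ⁻ ⊙ x ⁻) x (YX⁻ ∷ []) refl) (sym (eval-flatten x)))
        involution : (val (suc (suc zero)) ⁻¹ ∙ val (suc (suc (suc zero))) ⁻¹) ∙
                     (val (suc (suc zero)) ⁻¹ ∙ val (suc (suc (suc zero))) ⁻¹) ≡ ε
        involution = trans (cong₂ (λ g h → (g ⁻¹ ∙ h ⁻¹) ∙ (g ⁻¹ ∙ h ⁻¹)) (eval-flatten (y ⊙ y)) (eval-flatten (z ⊙ y ⁻)))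
          (deduce (((y ⊙ y) ⁻ ⊙ (z ⊙ y ⁻) ⁻) ⊙ ((y ⊙ y) ⁻ ⊙ (z ⊙ y ⁻) ⁻)) unit (YZ⁻ ∷ []) refl)
      fx : Fixed (val zero)
      fx = fixed-vertex zero tt λ φ {w} m → only φ w m
        where
        only : ∀ φ w → Maps φ zero w → w ≡ zero
        only φ zero _ = refl
        only φ (suc zero) m = ⊥-elim (no-hit φ (suc zero) fy′ zero (λ ()) m)
        only φ (suc (suc zero)) m = ⊥-elim (no-hit φ (suc (suc zero)) fyy zero (λ ()) m)
        only φ (suc (suc (suc zero))) m = ⊥-elim (not-swapped φ m)
      fc : Fixed (val (suc (suc (suc zero))))
      fc = fixed-vertex (suc (suc (suc zero))) tt λ φ {w} m → only φ w m
        where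
        only : ∀ φ w → Maps φ (suc (suc (suc zero))) w → w ≡ suc (suc (suc zero))
        only φ zero m = ⊥-elim (no-hit φ zero fx (suc (suc (suc zero))) (λ ()) m)
        only φ (suc zero) m = ⊥-elim (no-hit φ (suc zero) fy′ (suc (suc (suc zero))) (λ ()) m)
        only φ (suc (suc zero)) m = ⊥-elim (no-hit φ (suc (suc zero)) fyy (suc (suc (suc zero))) (λ ()) m)
        only φ (suc (suc (suc zero))) m = refl
      z-from : val (suc (suc (suc zero))) ∙ ρ 1 ≡ ρ 2
      z-from = trans (cong (_∙ ρ 1) (eval-flatten (z ⊙ y ⁻))) (deduce ((z ⊙ y ⁻) ⊙ y) z [] refl)

module AllTriples (G : FiniteGroup) where
  open FiniteGroup G
  open Families G
  open SmallSets G
  open Pairs G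
  open Triples G
  open CommutingTriples G

  -- In these relations y² accounts for the factor C₃, and y³, y x and y z for the three factors C₂.
  record Exception (ρ : ℕ → Carrier) : Set where
    field
      xy≡yx : ρ 0 ∙ ρ 1 ≡ ρ 1 ∙ ρ 0
      yz≡zy : ρ 1 ∙ ρ 2 ≡ ρ 2 ∙ ρ 1
      zx≡xz : ρ 2 ∙ ρ 0 ≡ ρ 0 ∙ ρ 2
      yx²≡ε : (ρ 1 ∙ ρ 0) ∙ (ρ 1 ∙ ρ 0) ≡ ε
      yz²≡ε : (ρ 1 ∙ ρ 2) ∙ (ρ 1 ∙ ρ 2) ≡ ε
      y⁶≡ε  : GroupWords.eval G ρ (Y ∷ Y ∷ Y ∷ Y ∷ Y ∷ Y ∷ []) ≡ ε

  module _ {ρ : ℕ → Carrier} (fam : Family ρ 3)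
    (sq₀ : (ρ 1 ∙ ρ 0 ⁻¹) ∙ (ρ 1 ∙ ρ 0 ⁻¹) ≢ ε) (sq₁ : (ρ 2 ∙ ρ 1 ⁻¹) ∙ (ρ 2 ∙ ρ 1 ⁻¹) ≢ ε) where
    open Family fam using (separation)
    open GroupWords G ρ
    open Triple fam sq₀ sq₁
    open Free

    private
      2<3 : 2 < 3
      2<3 = s<s (s<s z<s)

      module XY = PairFacts separation
      module YX = PairFacts (Family.separation (exchange₀₁-family (s<s z<s) fam))
      module ZY = PairFacts (Family.separation reversed)
      module YZ = PairFacts (Family.separation (exchange₀₁-family (s<s z<s) reversed))

      -- An exceptional path of the first kind is tried again from its other end, where the
      -- exceptions contradict each other. Two triangles through y give x² = y² = z²; then
      -- `Triangle` applies, or the path x, z, y starts with an edge that neither commutes nor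
      -- inverts.
      noncommuting : ¬ Commuting (ρ 0) (ρ 1) → AdmitsORR G
      noncommuting ¬c with triple fam sq₀ sq₁ (inj₁ ¬c)
      ... | inj₁ orr = orr
      ... | inj₂ (i₀₁ , r₁₂ , inj₁ (¬r₀₁ , ¬c₁₂ , _))
        with triple reversed sq₁⁻ sq₀⁻ (inj₁ (λ c → ¬c₁₂ (commuting-sym (ρ 2) (ρ 1) c)))
      ...   | inj₁ orr = orr
      ...   | inj₂ (i₂₁ , _ , inj₁ (¬r₂₁ , _)) = ⊥-elim (contradiction r₁₂)
        where
        open Reduction free
        contradiction : ¬ Returning (ρ 1) (ρ 2)
        contradiction (inj₁ r) = ¬r₂₁ (equal-squares-returning
          (deduce (z ⊙ z) (y ⊙ y) (([] , relator (z ⊙ (z ⊙ y ⁻)) y r) ∷ []) refl))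
        contradiction (inj₂ r) = inverting-both i₀₁ i₂₁ r
      ...   | inj₂ (_ , r₁₀ , inj₂ (_ , i₁₀)) = ⊥-elim (¬r₀₁ (inj₁
              (deduce (y ⊙ (y ⊙ x ⁻)) x (([] , relator (y ⊙ y) (x ⊙ x) (YX.equal-squares i₁₀ r₁₀)) ∷ []) refl)))
        where open Reduction free
      noncommuting ¬c | inj₂ (i₀₁ , r₁₂ , inj₂ (r₀₁ , i₁₂)) with _≟_ G (ρ 2 ∙ ρ 0) (ρ 0 ∙ ρ 2) | inverting? (ρ 0) (ρ 2)
      ... | yes c | _     = Triangle.central-x i₀₁ r₀₁ i₁₂ c
      ... | _     | yes i = Triangle.inverted-x i₀₁ r₀₁ i₁₂ i (XY.equal-squares i₀₁ r₀₁)
      ... | no ¬k | no ¬i with triple (exchange₁₂-family 2<3 fam)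
              (quotient-square (trans (XY.equal-squares i₀₁ r₀₁) (YZ.equal-squares i₁₂ r₁₂)) ¬k)
              sq₁⁻ (inj₁ (λ c → ¬k (sym (commuting-swap (ρ 0) (ρ 2) c))))
      ...   | inj₁ orr     = orr
      ...   | inj₂ (i , _) = ⊥-elim (¬i i)

      half-commuting : Commuting (ρ 0) (ρ 1) → ¬ Commuting (ρ 1) (ρ 2) → AdmitsORR G
      half-commuting c ¬c₁₂ with triple reversed sq₁⁻ sq₀⁻ (inj₁ (λ c → ¬c₁₂ (commuting-sym (ρ 2) (ρ 1) c)))
      ... | inj₁ orr                               = orr
      ... | inj₂ (_ , _ , inj₁ (_ , ¬c₁₀ , _))     = ⊥-elim (¬c₁₀ (commuting-sym (ρ 0) (ρ 1) c))
      ... | inj₂ (_ , _ , inj₂ (_ , i₁₀))          = ⊥-elim (YX.exclude (commuting-sym (ρ 0) (ρ 1) c) i₁₀)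

      module _ (c₀₁ : Commuting (ρ 0) (ρ 1)) (c₁₂ : Commuting (ρ 1) (ρ 2)) where
        xy≡yx : ρ 0 ∙ ρ 1 ≡ ρ 1 ∙ ρ 0
        xy≡yx = commuting-swap (ρ 0) (ρ 1) c₀₁
        yz≡zy : ρ 1 ∙ ρ 2 ≡ ρ 2 ∙ ρ 1
        yz≡zy = commuting-swap (ρ 1) (ρ 2) c₁₂

        commuting : AdmitsORR G ⊎ Exception ρ
        commuting with returning? (ρ 0) (ρ 1) | returning? (ρ 2) (ρ 1)
        ... | yes r | _ with triple fam sq₀ sq₁ (inj₂ r)
        ...   | inj₁ orr     = inj₁ orr
        ...   | inj₂ (i , _) = ⊥-elim (XY.exclude c₀₁ i)
        commuting | _ | yes r with triple reversed sq₁⁻ sq₀⁻ (inj₂ r)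
        ...   | inj₁ orr     = inj₁ orr
        ...   | inj₂ (i , _) = ⊥-elim (ZY.exclude (commuting-sym (ρ 1) (ρ 2) c₁₂) i)
        commuting | no ¬r₀ | no ¬r₂ with _≟_ G ((ρ 1 ∙ ρ 0) ∙ (ρ 1 ∙ ρ 0)) ε | _≟_ G ((ρ 1 ∙ ρ 2) ∙ (ρ 1 ∙ ρ 2)) ε
        ...   | no h | _ = inj₁ (Central.central-set fam sq₀ sq₁ xy≡yx yz≡zy ¬r₀ h)
        ...   | _ | no h = inj₁ (Central.central-set reversed sq₁⁻ sq₀⁻ (sym yz≡zy) (sym xy≡yx) ¬r₂ h)
        ...   | yes yx² | yes yz² with _≟_ G (ρ 2 ∙ ρ 0) (ρ 0 ∙ ρ 2)
        ...     | yes k with _≟_ G (eval (Y ∷ Y ∷ Y ∷ Y ∷ Y ∷ Y ∷ [])) ε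
        ...       | no y⁶  = inj₁ (Abelian.four-set fam sq₀ sq₁ xy≡yx yz≡zy k yx² yz² y⁶)
        ...       | yes y⁶ = inj₂ (record
                    { xy≡yx = xy≡yx ; yz≡zy = yz≡zy ; zx≡xz = k ; yx²≡ε = yx² ; yz²≡ε = yz² ; y⁶≡ε = y⁶ })
        -- (y x)² = (y z)² = 1 gives x² = z², so the quotient of x and z does not square to 1 and
        -- they may be adjacent. The path z, x, y starts with an edge that does not commute, and its
        -- exceptions require `Returning` from x to y.
        commuting | no ¬r₀ | no ¬r₂ | yes yx² | yes yz² | no ¬k
          with triple (exchange₀₂-family 2<3 (exchange₀₁-family (s<s z<s) fam))
                 (inverted-quotient (ρ 0) (ρ 2) (quotient-square xx≡zz ¬k)) sq₀ (inj₁ (λ c → ¬k (commuting-swap (ρ 2) (ρ 0) c)))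
          where
          open Reduction (Central.relations fam sq₀ sq₁ xy≡yx yz≡zy)
          xx≡zz : ρ 0 ∙ ρ 0 ≡ ρ 2 ∙ ρ 2
          xx≡zz = deduce (x ⊙ x) (z ⊙ z) (([] , relator ((y ⊙ x) ⊙ (y ⊙ x)) unit yx²) ∷
                    ([] , relator unit ((y ⊙ z) ⊙ (y ⊙ z)) (sym yz²)) ∷ []) refl
        ... | inj₁ orr         = inj₁ orr
        ... | inj₂ (_ , r , _) = ⊥-elim (¬r₀ r)

    triples : AdmitsORR G ⊎ Exception ρ
    triples with commuting? (ρ 0) (ρ 1) | commuting? (ρ 1) (ρ 2)
    ... | no ¬c | _       = inj₁ (noncommuting ¬c)
    ... | yes c | no ¬c   = inj₁ (half-commuting c ¬c)
    ... | yes c | yes c₁₂ = commuting c c₁₂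

-- The exceptional groups

record Exhaustible (A : Set) : Set₁ where
  field
    all       : (A → Bool) → Bool
    all-sound : ∀ f → all f ≡ true → ∀ a → f a ≡ true

fin-exhaustible : ∀ {n} → Exhaustible (Fin n)
fin-exhaustible = record { all = every ; all-sound = every-sound }

×-exhaustible : ∀ {A B} → Exhaustible A → Exhaustible B → Exhaustible (A × B)
×-exhaustible EA EB = record
  { all       = λ f → A.all λ a → B.all λ b → f (a , b)
  ; all-sound = λ f e (a , b) → B.all-sound _ (A.all-sound (λ a → B.all λ b → f (a , b)) e a) b }
  where
  module A = Exhaustible EA
  module B = Exhaustible EB

-- How an oriented set meets an inverse pair {r, r⁻¹}: in neither element, in r, or in r⁻¹.
data Trit : Set where
  none plus minus : Trit

module Homomorphisms (G H : FiniteGroup) where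
  private
    module G where
      open FiniteGroup G public
      open IsGroup isGroup public using (assoc; identityˡ; identityʳ; inverseˡ; inverseʳ)
      open GroupProperties (asGroup G) public
    module H where
      open FiniteGroup H public
      open IsGroup isGroup public using (assoc; identityˡ; identityʳ; inverseˡ; inverseʳ)
      open GroupProperties (asGroup H) public

  Homomorphic : (G.Carrier → H.Carrier) → Set
  Homomorphic f = ∀ x y → f (x G.∙ y) ≡ f x H.∙ f y

  hom-ε : ∀ {f} → Homomorphic f → f G.ε ≡ H.ε
  hom-ε {f} h = H.identityˡ-unique _ _ (trans (sym (h G.ε G.ε)) (cong f (G.identityˡ G.ε)))

  hom-⁻¹ : ∀ {f} → Homomorphic f → ∀ x → f (x G.⁻¹) ≡ f x H.⁻¹
  hom-⁻¹ {f} h x = H.inverseˡ-unique _ _ (trans (sym (h _ _)) (trans (cong f (G.inverseˡ x)) (hom-ε h)))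

  hom-quotient : ∀ {f} → Homomorphic f → ∀ x y → f (y G.∙ x G.⁻¹) ≡ f y H.∙ f x H.⁻¹
  hom-quotient {f} h x y = trans (h _ _) (cong (f y H.∙_) (hom-⁻¹ h x))

module NoRegularRepresentation (H : FiniteGroup) where
  open FiniteGroup H
  open IsGroup isGroup using (identityˡ)

  record Automorphism : Set where
    field
      act act⁻¹   : Carrier → Carrier
      homomorphic : ∀ p q → act (p ∙ q) ≡ act p ∙ act q
      act-act⁻¹   : ∀ q → act (act⁻¹ q) ≡ q
      act⁻¹-act   : ∀ q → act⁻¹ (act q) ≡ q
      moved       : Carrier
      moves       : act moved ≢ moved

  Preserved : (Carrier → Bool) → Set
  Preserved S = Σ Automorphism λ α → ∀ q → S (Automorphism.act α q) ≡ S q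

  Oriented : (Carrier → Bool) → Set
  Oriented S = ∀ q → S q ≡ true → ¬ (S (q ⁻¹) ≡ true)

  -- A group automorphism preserving the connection set is a digraph automorphism fixing the identity.
  no-representation : (∀ S → Oriented S → Preserved S) → ∀ G → AdmitsORR G → ¬ (G ≅ H)
  no-representation preserved G (S , oriented , _ , rigid) (f , (f-injective , f-surjective) , f-hom) =
    α.moves (trans (sym (fk _)) (trans (cong f (trans (sym (cong (λ q → k (α.act q)) (fk α.moved))) φ-id)) (fk _)))
    where
    module G where
      open FiniteGroup G public
      open IsGroup (FiniteGroup.isGroup G) public using (identityʳ; identityˡ)
    k : Carrier → G.Carrier
    k q = proj₁ (f-surjective q)
    fk : ∀ q → f (k q) ≡ q
    fk q = proj₂ (f-surjective q) refl
    kf : ∀ g → k (f g) ≡ g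
    kf g = f-injective (fk (f g))
    k-hom : ∀ p q → k (p ∙ q) ≡ k p G.∙ k q
    k-hom p q = f-injective (trans (fk _) (sym (trans (f-hom _ _) (cong₂ _∙_ (fk p) (fk q)))))
    module F = Homomorphisms G H
    module K = Homomorphisms H G
    module A = Homomorphisms H H
    α′ = preserved (λ q → S (k q)) (λ q s t → oriented (k q) s (subst (λ g → S g ≡ true) (K.hom-⁻¹ k-hom q) t))
    module α = Automorphism (proj₁ α′)
    φ φ⁻¹ : G.Carrier → G.Carrier
    φ g = k (α.act (f g))
    φ⁻¹ g = k (α.act⁻¹ (f g))
    φφ⁻¹ : ∀ g → φ (φ⁻¹ g) ≡ g
    φφ⁻¹ g = trans (cong (λ q → k (α.act q)) (fk _)) (trans (cong k (α.act-act⁻¹ _)) (kf g))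
    φ⁻¹φ : ∀ g → φ⁻¹ (φ g) ≡ g
    φ⁻¹φ g = trans (cong (λ q → k (α.act⁻¹ q)) (fk _)) (trans (cong k (α.act⁻¹-act _)) (kf g))
    arcs : ∀ g h → S (φ h G.∙ φ g G.⁻¹) ≡ S (h G.∙ g G.⁻¹)
    arcs g h = begin
      S (φ h G.∙ φ g G.⁻¹)                              ≡⟨ cong S (sym (K.hom-quotient k-hom _ _)) ⟩
      S (k (α.act (f h) ∙ α.act (f g) ⁻¹))              ≡⟨ cong (λ q → S (k q)) (sym (A.hom-quotient α.homomorphic _ _)) ⟩
      S (k (α.act (f h ∙ f g ⁻¹)))                      ≡⟨ proj₂ α′ _ ⟩
      S (k (f h ∙ f g ⁻¹))                              ≡⟨ cong (λ q → S (k q)) (sym (F.hom-quotient f-hom _ _)) ⟩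
      S (k (f (h G.∙ g G.⁻¹)))                          ≡⟨ cong S (kf _) ⟩
      S (h G.∙ g G.⁻¹)                                  ∎
      where open ≡-Reasoning
    φ-aut : IsCayAut G S φ
    φ-aut = ((λ {g} {h} e → trans (sym (φ⁻¹φ g)) (trans (cong φ⁻¹ e) (φ⁻¹φ h)))
            , λ g → φ⁻¹ g , λ { refl → φφ⁻¹ g })
          , λ g h → mk⇔ (trans (arcs g h)) (trans (sym (arcs g h)))
    translation : ∃ λ c → ∀ g → φ g ≡ g G.∙ c
    translation = rigid φ φ-aut
    φ-ε : φ G.ε ≡ G.ε
    φ-ε = trans (cong (λ q → k (α.act q)) (F.hom-ε f-hom)) (trans (cong k (A.hom-ε α.homomorphic)) (K.hom-ε k-hom))
    φ-id : ∀ {g} → φ g ≡ g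
    φ-id {g} = trans (proj₂ translation g) (trans (cong (g G.∙_)
      (trans (sym (G.identityˡ _)) (trans (sym (proj₂ translation G.ε)) φ-ε))) (G.identityʳ g))

  -- One `Trit` per inverse pair determines an oriented set, so only finitely many patterns need a
  -- candidate that preserves them. Applying `act` period + 1 times is checked to be the identity,
  -- which makes `period` applications the inverse.
  module Exhaustion (_≟ᴴ_ : DecidableEquality Carrier) (exhaustible : Exhaustible Carrier)
    {m : ℕ} (representative : Fin m → Carrier) (classify : Carrier → Maybe (Fin m × Bool))
    {K : Set} (act : K → Carrier → Carrier) (moved : K → Carrier) (period : ℕ) (candidates : List K) where
    open Exhaustible exhaustible

    _=ᴴ_ : Carrier → Carrier → Bool
    p =ᴴ q = does (p ≟ᴴ q)

    =ᴴ-sound : ∀ {p q} → (p =ᴴ q) ≡ true → p ≡ q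
    =ᴴ-sound {p} {q} e with p ≟ᴴ q
    ... | yes h = h

    -- Inverse pairs are indexed; an unclassified element is an involution or the identity.
    classified : Carrier → Maybe (Fin m × Bool) → Bool
    classified q nothing            = (q ⁻¹) =ᴴ q
    classified q (just (i , true))  = q =ᴴ representative i
    classified q (just (i , false)) = q =ᴴ (representative i ⁻¹)

    has : Trit → Bool → Bool
    has plus  true  = true
    has minus false = true
    has _     _     = false

    pattern-set : Vec Trit m → Maybe (Fin m × Bool) → Bool
    pattern-set τ nothing        = false
    pattern-set τ (just (i , s)) = has (Vec.lookup τ i) s

    stable : Vec Trit m → K → Bool
    stable τ κ = all λ q → pattern-set τ (classify (act κ q)) iff pattern-set τ (classify q)

    iterate : ℕ → (Carrier → Carrier) → Carrier → Carrier
    iterate zero    f q = q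
    iterate (suc n) f q = f (iterate n f q)

    iterate-shift : ∀ n f q → iterate n f (f q) ≡ f (iterate n f q)
    iterate-shift zero    f q = refl
    iterate-shift (suc n) f q = cong f (iterate-shift n f q)

    valid : K → Bool
    valid κ = (all λ p → all λ q → act κ (p ∙ q) =ᴴ (act κ p ∙ act κ q)) ∧
              ((all λ q → iterate (suc period) (act κ) q =ᴴ q) ∧ not (act κ (moved κ) =ᴴ moved κ))

    all-patterns : ∀ n → (Vec Trit n → Bool) → Bool
    all-patterns zero    f = f []
    all-patterns (suc n) f = all-patterns n (λ τ → f (none ∷ τ)) ∧
      (all-patterns n (λ τ → f (plus ∷ τ)) ∧ all-patterns n (λ τ → f (minus ∷ τ)))

    all-patterns-sound : ∀ n f → all-patterns n f ≡ true → ∀ τ → f τ ≡ true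
    all-patterns-sound zero    f e []          = e
    all-patterns-sound (suc n) f e (none ∷ τ)  = all-patterns-sound n _ (proj₁ (∧-true e)) τ
    all-patterns-sound (suc n) f e (plus ∷ τ)  = all-patterns-sound n _ (proj₁ (∧-true (proj₂ (∧-true {all-patterns n (λ τ → f (none ∷ τ))} e)))) τ
    all-patterns-sound (suc n) f e (minus ∷ τ) =
      all-patterns-sound n _ (proj₂ (∧-true {all-patterns n (λ τ → f (plus ∷ τ))}
        (proj₂ (∧-true {all-patterns n (λ τ → f (none ∷ τ))} e)))) τ

    any-candidate : (K → Bool) → List K → Bool
    any-candidate f []       = false
    any-candidate f (κ ∷ κs) = f κ ∨ any-candidate f κs

    all-candidates : (K → Bool) → List K → Bool
    all-candidates f []       = true
    all-candidates f (κ ∷ κs) = f κ ∧ all-candidates f κs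

    select : ∀ f g κs → any-candidate f κs ≡ true → all-candidates g κs ≡ true → ∃ λ κ → f κ ≡ true × g κ ≡ true
    select f g (κ ∷ κs) e h with ∨-true {f κ} e
    ... | inj₁ p = κ , p , proj₁ (∧-true h)
    ... | inj₂ p = select f g κs p (proj₂ (∧-true {g κ} h))

    view : Bool → Bool → Trit
    view true  _     = plus
    view false true  = minus
    view false false = none

    iff-sound : ∀ a b → a iff b ≡ true → a ≡ b
    iff-sound true  true  _ = refl
    iff-sound false false _ = refl

    automorphism : ∀ κ → valid κ ≡ true → Automorphism
    automorphism κ e = record
      { act = act κ ; act⁻¹ = iterate period (act κ)
      ; homomorphic = λ p q → =ᴴ-sound (all-sound _ (all-sound (λ p → all λ q → act κ (p ∙ q) =ᴴ (act κ p ∙ act κ q)) (proj₁ (∧-true e)) p) q)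
      ; act-act⁻¹ = period-id ; act⁻¹-act = λ q → trans (iterate-shift period (act κ) q) (period-id q)
      ; moved = moved κ ; moves = λ h → clash h }
      where
      e′ = proj₂ (∧-true {all λ p → all λ q → act κ (p ∙ q) =ᴴ (act κ p ∙ act κ q)} e)
      period-id : ∀ q → iterate (suc period) (act κ) q ≡ q
      period-id q = =ᴴ-sound (all-sound (λ q → iterate (suc period) (act κ) q =ᴴ q) (proj₁ (∧-true e′)) q)
      clash : act κ (moved κ) ≢ moved κ
      clash h with act κ (moved κ) ≟ᴴ moved κ | proj₂ (∧-true {all λ q → iterate (suc period) (act κ) q =ᴴ q} e′)
      ... | yes _ | ()
      ... | no ¬p | _ = ¬p h

    preserved : all (λ q → classified q (classify q)) ≡ true → all-candidates valid candidates ≡ true →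
                all-patterns m (λ τ → any-candidate (stable τ) candidates) ≡ true →
                ∀ S → Oriented S → Preserved S
    preserved cl sound st S oriented with select (stable τ) valid candidates (all-patterns-sound m _ st τ) sound
      where
      τ : Vec Trit m
      τ = Vec.tabulate λ i → view (S (representative i)) (S (representative i ⁻¹))
    ... | κ , s , v = automorphism κ v , λ q → trans (S-pattern (act κ q))
            (trans (iff-sound _ _ (all-sound (λ q → pattern-set τ (classify (act κ q)) iff pattern-set τ (classify q)) s q))
              (sym (S-pattern q)))
      where
      τ : Vec Trit m
      τ = Vec.tabulate λ i → view (S (representative i)) (S (representative i ⁻¹))
      S-pattern : ∀ q → S q ≡ pattern-set τ (classify q)
      S-pattern q = go (classify q) (all-sound _ cl q)
        where
        go : ∀ c → classified q c ≡ true → S q ≡ pattern-set τ c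
        go nothing e with S q in s
        ... | false = refl
        ... | true  = ⊥-elim (oriented q s (trans (cong S (=ᴴ-sound e)) s))
        go (just (i , b)) e rewrite Vecₚ.lookup∘tabulate (λ i → view (S (representative i)) (S (representative i ⁻¹))) i = side b e
          where
          side : ∀ b → classified q (just (i , b)) ≡ true →
                 S q ≡ has (view (S (representative i)) (S (representative i ⁻¹))) b
          side true e rewrite =ᴴ-sound e with S (representative i) | S (representative i ⁻¹)
          ... | true  | _     = refl
          ... | false | true  = refl
          ... | false | false = refl
          side false e rewrite =ᴴ-sound e with S (representative i) in s | S (representative i ⁻¹) in t
          ... | true  | true  = ⊥-elim (oriented _ s t)
          ... | true  | false = refl
          ... | false | true  = refl
          ... | false | false = refl

pattern f0 = zero
pattern f1 = suc zero
pattern f2 = suc (suc zero)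
pattern f3 = suc (suc (suc zero))

Q₈-no-ORR : ∀ G → AdmitsORR G → ¬ (G ≅ Q₈)
Q₈-no-ORR = no-representation (preserved refl refl refl)
  where
  open Quat using (Q; one; _·_)
  open NoRegularRepresentation Q₈

  representative : Fin 3 → Q
  representative i = f0 , suc i

  classify : Q → Maybe (Fin 3 × Bool)
  classify (s  , f0)    = nothing
  classify (f0 , suc i) = just (i , true)
  classify (f1 , suc i) = just (i , false)

  -- The automorphism sending i and j to the given elements.
  act : Q × Q → Q → Q
  act _       (s , f0) = s , f0
  act (p , q) (s , f1) = (s , f0) · p
  act (p , q) (s , f2) = (s , f0) · q
  act (p , q) (s , f3) = (s , f0) · (p · q)

  moved : Q × Q → Q
  moved ((f0 , f1) , _) = f0 , f2
  moved _               = f0 , f1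

  candidates : List (Q × Q)
  candidates =
    ((f0 , f1) , (f0 , f3)) ∷ ((f0 , f2) , (f0 , f1)) ∷ ((f0 , f2) , (f0 , f3)) ∷ ((f0 , f2) , (f1 , f1)) ∷
    ((f0 , f2) , (f1 , f3)) ∷ ((f0 , f3) , (f0 , f2)) ∷ ((f0 , f3) , (f1 , f1)) ∷ ((f0 , f3) , (f1 , f2)) ∷
    ((f1 , f1) , (f0 , f3)) ∷ ((f1 , f1) , (f1 , f3)) ∷ ((f1 , f2) , (f0 , f3)) ∷ ((f1 , f2) , (f1 , f1)) ∷
    ((f1 , f3) , (f1 , f2)) ∷ []

  open Exhaustion (≡-dec Fin._≟_ Fin._≟_) (×-exhaustible fin-exhaustible fin-exhaustible)
    -- 12 = 11 + 1 is the exponent of Aut Q₈, which is the symmetric group of degree 4.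
    representative classify act moved 11 candidates

C₃×C₃-no-ORR : ∀ G → AdmitsORR G → ¬ (G ≅ C₃×C₃)
C₃×C₃-no-ORR = no-representation (preserved refl refl refl)
  where
  open FiniteGroup C₃×C₃ using (Carrier; _∙_)
  open NoRegularRepresentation C₃×C₃

  representative : Fin 4 → Carrier
  representative f0 = f0 , f1
  representative f1 = f1 , f0
  representative f2 = f1 , f1
  representative f3 = f1 , f2

  classify : Carrier → Maybe (Fin 4 × Bool)
  classify (f0 , f0) = nothing
  classify (f0 , f1) = just (f0 , true)
  classify (f0 , f2) = just (f0 , false)
  classify (f1 , f0) = just (f1 , true)
  classify (f2 , f0) = just (f1 , false)
  classify (f1 , f1) = just (f2 , true)
  classify (f2 , f2) = just (f2 , false)
  classify (f1 , f2) = just (f3 , true)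
  classify (f2 , f1) = just (f3 , false)

  multiple : Fin 3 → Carrier → Carrier
  multiple f0 p = f0 , f0
  multiple f1 p = p
  multiple f2 p = p ∙ p

  -- The linear map sending the standard basis to the given vectors.
  act : Carrier × Carrier → Carrier → Carrier
  act (p , q) (i , j) = multiple i p ∙ multiple j q

  moved : Carrier × Carrier → Carrier
  moved ((f1 , f0) , _) = f0 , f1
  moved _               = f1 , f0

  candidates : List (Carrier × Carrier)
  candidates =
    ((f0 , f1) , (f1 , f0)) ∷ ((f0 , f2) , (f2 , f0)) ∷ ((f1 , f0) , (f0 , f2)) ∷ ((f2 , f0) , (f0 , f1)) ∷
    ((f0 , f1) , (f2 , f2)) ∷ ((f0 , f2) , (f1 , f2)) ∷ ((f1 , f0) , (f1 , f1)) ∷ ((f1 , f0) , (f1 , f2)) ∷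
    ((f1 , f0) , (f2 , f2)) ∷ ((f1 , f1) , (f0 , f1)) ∷ ((f1 , f1) , (f0 , f2)) ∷ ((f1 , f2) , (f0 , f2)) ∷
    ((f2 , f0) , (f1 , f1)) ∷ ((f2 , f0) , (f2 , f1)) ∷ ((f2 , f1) , (f0 , f1)) ∷ ((f2 , f2) , (f0 , f1)) ∷ []

  open Exhaustion (≡-dec Fin._≟_ Fin._≟_) (×-exhaustible fin-exhaustible fin-exhaustible)
    -- 24 = 23 + 1 is the exponent of GL(2,3).
    representative classify act moved 23 candidates

C₃×C₂³-no-ORR : ∀ G → AdmitsORR G → ¬ (G ≅ C₃×C₂³)
C₃×C₂³-no-ORR = no-representation (preserved refl refl refl)
  where
  open FiniteGroup C₃×C₂³ using (Carrier)
  open FiniteGroup (C₂ ⊗ (C₂ ⊗ C₂)) using () renaming (Carrier to Plane; _∙_ to _+ᵥ_)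
  open NoRegularRepresentation C₃×C₂³

  number : Plane → Fin 8
  number (f0 , f0 , f0) = f0
  number (f0 , f0 , f1) = f1
  number (f0 , f1 , f0) = f2
  number (f0 , f1 , f1) = f3
  number (f1 , f0 , f0) = suc f3
  number (f1 , f0 , f1) = suc (suc f3)
  number (f1 , f1 , f0) = suc (suc (suc f3))
  number (f1 , f1 , f1) = suc (suc (suc (suc f3)))

  vector : Fin 8 → Plane
  vector f0                         = f0 , f0 , f0
  vector f1                         = f0 , f0 , f1
  vector f2                         = f0 , f1 , f0
  vector f3                         = f0 , f1 , f1
  vector (suc f3)                   = f1 , f0 , f0
  vector (suc (suc f3))             = f1 , f0 , f1
  vector (suc (suc (suc f3)))       = f1 , f1 , f0
  vector (suc (suc (suc (suc f3)))) = f1 , f1 , f1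

  -- An oriented set contains no involution and not 1, so here it amounts to a colouring of the
  -- vectors of C₂³ with three colours.
  representative : Fin 8 → Carrier
  representative i = f1 , vector i

  classify : Carrier → Maybe (Fin 8 × Bool)
  classify (f0 , v) = nothing
  classify (f1 , v) = just (number v , true)
  classify (f2 , v) = just (number v , false)

  scalar : Fin 2 → Fin 2 → Fin 2
  scalar f0 _ = f0
  scalar f1 b = b

  form : Plane → Plane → Fin 2
  form (a , b , c) (x , y , z) = proj₁ ((scalar a x , f0 , f0) +ᵥ ((scalar b y , f0 , f0) +ᵥ (scalar c z , f0 , f0)))

  shift : Fin 2 → Plane → Plane → Plane
  shift f0 t v = v
  shift f1 t v = v +ᵥ t

  -- The transvection v ↦ v + φ(v) t on the elementary abelian factor.
  act : Plane × Plane → Carrier → Carrier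
  act (φ , t) (c , v) = c , shift (form φ v) t v

  moved : Plane × Plane → Carrier
  moved ((f1 , _ , _) , _)  = f0 , f1 , f0 , f0
  moved ((f0 , f1 , _) , _) = f0 , f0 , f1 , f0
  moved ((f0 , f0 , _) , _) = f0 , f0 , f0 , f1

  -- These are all 21 transvections, given by nonzero φ and t with φ(t) = 0. Each is an involution
  -- that fixes the plane φ = 0 pointwise and swaps v with v + t off it, so it preserves a colouring
  -- as soon as two pairs of vectors have matching colours.
  candidates : List (Plane × Plane)
  candidates =
    ((f0 , f0 , f1) , (f0 , f1 , f0)) ∷ ((f0 , f1 , f0) , (f0 , f0 , f1)) ∷ ((f0 , f1 , f1) , (f0 , f1 , f1)) ∷
    ((f1 , f0 , f1) , (f1 , f0 , f1)) ∷ ((f1 , f1 , f0) , (f1 , f1 , f0)) ∷ ((f0 , f0 , f1) , (f1 , f0 , f0)) ∷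
    ((f1 , f0 , f0) , (f0 , f0 , f1)) ∷ ((f1 , f1 , f0) , (f1 , f1 , f1)) ∷ ((f1 , f1 , f1) , (f1 , f1 , f0)) ∷
    ((f0 , f1 , f0) , (f1 , f0 , f0)) ∷ ((f0 , f1 , f1) , (f1 , f1 , f1)) ∷ ((f0 , f0 , f1) , (f1 , f1 , f0)) ∷
    ((f0 , f1 , f0) , (f1 , f0 , f1)) ∷ ((f0 , f1 , f1) , (f1 , f0 , f0)) ∷ ((f1 , f0 , f0) , (f0 , f1 , f0)) ∷
    ((f1 , f0 , f0) , (f0 , f1 , f1)) ∷ ((f1 , f0 , f1) , (f0 , f1 , f0)) ∷ ((f1 , f0 , f1) , (f1 , f1 , f1)) ∷
    ((f1 , f1 , f0) , (f0 , f0 , f1)) ∷ ((f1 , f1 , f1) , (f0 , f1 , f1)) ∷ ((f1 , f1 , f1) , (f1 , f0 , f1)) ∷ []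

  open Exhaustion (≡-dec Fin._≟_ (≡-dec Fin._≟_ (≡-dec Fin._≟_ Fin._≟_)))
    (×-exhaustible fin-exhaustible (×-exhaustible fin-exhaustible (×-exhaustible fin-exhaustible fin-exhaustible)))
    representative classify act moved 1 candidates

-- Recognising the exceptional groups from their relations

module Isomorphisms (G : FiniteGroup) where
  open FiniteGroup G
  open IsGroup isGroup using (assoc; identityˡ; identityʳ; inverseʳ)
  open GroupProperties (asGroup G)
  open Families G
  open Homomorphisms using (Homomorphic)

  module _ (H : FiniteGroup) (h : FiniteGroup.Carrier H → Carrier) (homomorphic : Homomorphic H G h)
    (kernel : ∀ p → h p ≡ ε → p ≡ FiniteGroup.ε H) where
    private
      module H where
        open FiniteGroup H public
        open GroupProperties (asGroup H) public

    hom-injective : ∀ {p q} → h p ≡ h q → p ≡ q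
    hom-injective {p} {q} e = trans (H.inverseˡ-unique p (q H.⁻¹) (kernel _
      (trans (Homomorphisms.hom-quotient H G homomorphic q p) (trans (cong (_∙ h q ⁻¹) e) (inverseʳ _)))))
      (H.⁻¹-involutive q)

    -- Closure induction lifts every element of G along `h`; the lift is the inverse map, so the
    -- order of G never has to be counted.
    isomorphism : ∀ {ρ n} → Generated ρ n → (∀ k → k < n → ∃ λ p → h p ≡ ρ k) → G ≅ H
    isomorphism generated images = f , ((λ e → trans (sym (hf _)) (trans (cong h e) (hf _)))
                                     , λ q → h q , λ { refl → hom-injective (hf (h q)) })
                                 , λ x y → hom-injective (trans (hf _) (sym (trans (homomorphic _ _) (cong₂ _∙_ (hf x) (hf y)))))
      where
      onto : ∀ g → ∃ λ p → h p ≡ g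
      onto = generated (λ g → ∃ λ p → h p ≡ g) (H.ε , Homomorphisms.hom-ε H G homomorphic)
        (λ (p , e) (q , e′) → p H.∙ q , trans (homomorphic p q) (cong₂ _∙_ e e′))
        (λ (p , e) → p H.⁻¹ , trans (Homomorphisms.hom-⁻¹ H G homomorphic p) (cong _⁻¹ e)) images
      f : Carrier → H.Carrier
      f g = proj₁ (onto g)
      hf : ∀ g → h (f g) ≡ g
      hf g = proj₂ (onto g)

  abelian : ∀ {ρ n} → Generated ρ n → (∀ i j → i < n → j < n → ρ i ∙ ρ j ≡ ρ j ∙ ρ i) → ∀ g h → g ∙ h ≡ h ∙ g
  abelian {ρ} {n} generated c g h =
    centralised h g λ k k<n → centralised (ρ k) h λ j j<n → c k j k<n j<n
    where
    open GroupWords G ρ using (commute-⁻¹)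
    centralised : ∀ g h → (∀ k → k < n → g ∙ ρ k ≡ ρ k ∙ g) → h ∙ g ≡ g ∙ h
    centralised g h f = sym (generated (λ h → g ∙ h ≡ h ∙ g) (trans (identityʳ g) (sym (identityˡ g)))
      (λ {a} {b} p q → trans (sym (assoc g a b)) (trans (cong (_∙ b) p) (trans (assoc a g b)
        (trans (cong (a ∙_) q) (sym (assoc a b g))))))
      commute-⁻¹ f h)

  of-order-2 : Carrier → Fin 2 → Carrier
  of-order-2 g zero       = ε
  of-order-2 g (suc zero) = g

  of-order-2-homomorphic : ∀ {g} → g ∙ g ≡ ε → Homomorphic C₂ G (of-order-2 g)
  of-order-2-homomorphic e zero       zero       = sym (identityˡ ε)
  of-order-2-homomorphic e zero       (suc zero) = sym (identityˡ _)
  of-order-2-homomorphic e (suc zero) zero       = sym (identityʳ _)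
  of-order-2-homomorphic e (suc zero) (suc zero) = sym e

  of-order-3 : Carrier → Fin 3 → Carrier
  of-order-3 g zero             = ε
  of-order-3 g (suc zero)       = g
  of-order-3 g (suc (suc zero)) = g ∙ g

  of-order-3-homomorphic : ∀ {g} → g ∙ (g ∙ g) ≡ ε → Homomorphic C₃ G (of-order-3 g)
  of-order-3-homomorphic e zero             zero             = sym (identityˡ _)
  of-order-3-homomorphic e zero             (suc zero)       = sym (identityˡ _)
  of-order-3-homomorphic e zero             (suc (suc zero)) = sym (identityˡ _)
  of-order-3-homomorphic e (suc zero)       zero             = sym (identityʳ _)
  of-order-3-homomorphic e (suc zero)       (suc zero)       = refl
  of-order-3-homomorphic e (suc zero)       (suc (suc zero)) = sym e
  of-order-3-homomorphic e (suc (suc zero)) zero             = sym (identityʳ _)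
  of-order-3-homomorphic e (suc (suc zero)) (suc zero)       = sym (trans (assoc _ _ _) e)
  of-order-3-homomorphic {g} e (suc (suc zero)) (suc (suc zero)) =
    sym (trans (assoc _ _ _) (trans (cong (g ∙_) e) (identityʳ g)))

  product-homomorphic : ∀ {H K h k} → (∀ g g′ → g ∙ g′ ≡ g′ ∙ g) → Homomorphic H G h → Homomorphic K G k →
                        Homomorphic (H ⊗ K) G (λ (p , q) → h p ∙ k q)
  product-homomorphic {H} {K} {h} {k} comm hh hk (p , q) (p′ , q′) = begin
    h (p H.∙ p′) ∙ k (q K.∙ q′)      ≡⟨ cong₂ _∙_ (hh p p′) (hk q q′) ⟩
    (h p ∙ h p′) ∙ (k q ∙ k q′)      ≡⟨ assoc _ _ _ ⟩
    h p ∙ (h p′ ∙ (k q ∙ k q′))      ≡⟨ cong (h p ∙_) (sym (assoc _ _ _)) ⟩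
    h p ∙ ((h p′ ∙ k q) ∙ k q′)      ≡⟨ cong (λ g → h p ∙ (g ∙ k q′)) (comm _ _) ⟩
    h p ∙ ((k q ∙ h p′) ∙ k q′)      ≡⟨ cong (h p ∙_) (assoc _ _ _) ⟩
    h p ∙ (k q ∙ (h p′ ∙ k q′))      ≡⟨ sym (assoc _ _ _) ⟩
    (h p ∙ k q) ∙ (h p′ ∙ k q′)      ∎
    where
    open ≡-Reasoning
    module H = FiniteGroup H
    module K = FiniteGroup K

  module _ {ρ : ℕ → Carrier} (fam : Family ρ 2) where
    open Family fam
    open GroupWords G ρ
    open Pairs G using (Inverting)
    private
      x y : Expr
      x = var 0
      y = var 1

    elementary-9 : ρ 0 ∙ ρ 1 ≡ ρ 1 ∙ ρ 0 → ρ 0 ∙ (ρ 0 ∙ ρ 0) ≡ ε → ρ 1 ∙ (ρ 1 ∙ ρ 1) ≡ ε → G ≅ C₃×C₃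
    elementary-9 c x³ y³ = isomorphism C₃×C₃ h
      (product-homomorphic {C₃} {C₃} comm (of-order-3-homomorphic x³) (of-order-3-homomorphic y³)) kernel generated
      λ { 0 _ → (f1 , f0) , identityʳ _ ; 1 _ → (f0 , f1) , identityˡ _ ; (suc (suc _)) (s≤s (s≤s ())) }
      where
      comm : ∀ g g′ → g ∙ g′ ≡ g′ ∙ g
      comm = abelian generated λ { 0 0 _ _ → refl ; 0 1 _ _ → c ; 1 0 _ _ → sym c ; 1 1 _ _ → refl
                                 ; (suc (suc _)) _ (s≤s (s≤s ())) _ ; 0 (suc (suc _)) _ (s≤s (s≤s ()))
                                 ; 1 (suc (suc _)) _ (s≤s (s≤s ())) }
      h : Fin 3 × Fin 3 → Carrier
      h (i , j) = of-order-3 (ρ 0) i ∙ of-order-3 (ρ 1) j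
      relations : Relations
      relations = record { commuting = λ _ _ → true ; commutes = λ i j _ → comm _ _ }
      open Reduction relations
      open Decision relations
      refute : ∀ s → nontrivial (flatten s) ≡ true → ⟪ s ⟫ ≢ ε
      refute s t e = nontrivial-sound (flatten s) t (trans (eval-flatten s) e)
      kernel : ∀ p → h p ≡ ε → p ≡ (zero , zero)
      kernel (f0 , f0) _ = refl
      kernel (f0 , f1) e = ⊥-elim (refute (unit ⊙ y) refl e)
      kernel (f0 , f2) e = ⊥-elim (square 1 (s<s z<s) (trans (sym (identityˡ _)) e))
      kernel (f1 , f0) e = ⊥-elim (refute (x ⊙ unit) refl e)
      kernel (f1 , f1) e = ⊥-elim (refute (x ⊙ y) refl e)
      kernel (f1 , f2) e = ⊥-elim (refute (x ⊙ (y ⊙ y)) refl e)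
      kernel (f2 , f0) e = ⊥-elim (square 0 z<s (trans (sym (identityʳ _)) e))
      kernel (f2 , f1) e = ⊥-elim (refute ((x ⊙ x) ⊙ y) refl e)
      -- No letter of x² y² occurs once, but the cubes turn x² y² = 1 into x y = 1, where both do.
      kernel (f2 , f2) e = ⊥-elim (refute (x ⊙ y) refl (deduce (x ⊙ y) unit
        (([] , relator (x ⊙ (x ⊙ x)) unit x³) ∷ ([] , relator (y ⊙ (y ⊙ y)) unit y³) ∷
         ([] , relator unit ((x ⊙ x) ⊙ (y ⊙ y)) (sym e)) ∷ []) refl))

    -- The two relations present Q₈, with x² in the role of -1; i, j and k go to x, y and x y.
    quaternion : Inverting (ρ 0) (ρ 1) → ρ 0 ∙ ρ 0 ≡ ρ 1 ∙ ρ 1 → G ≅ Q₈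
    quaternion i s = isomorphism Q₈ h homomorphic kernel generated
      λ { 0 _ → (f0 , f1) , identityˡ _ ; 1 _ → (f0 , f2) , identityˡ _ ; (suc (suc _)) (s≤s (s≤s ())) }
      where
      open Quat using (unitMul; _⊕_; _·_)
      open Reduction free
      open Decision free
      signᴱ : Fin 2 → Expr
      signᴱ zero       = unit
      signᴱ (suc zero) = x ⊙ x
      unitᴱ : Fin 4 → Expr
      unitᴱ f0 = unit
      unitᴱ f1 = x
      unitᴱ f2 = y
      unitᴱ f3 = x ⊙ y
      h : Fin 2 × Fin 4 → Carrier
      h (s , u) = ⟪ signᴱ s ⟫ ∙ ⟪ unitᴱ u ⟫
      I S I⁻ S⁻ : Relator
      I  = relator (x ⊙ y) (y ⊙ x ⁻) i
      I⁻ = relator (y ⊙ x ⁻) (x ⊙ y) (sym i)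
      S  = relator (x ⊙ x) (y ⊙ y) s
      S⁻ = relator (y ⊙ y) (x ⊙ x) (sym s)
      -- Conjugation by y inverts x² and, since x² = y², also fixes it.
      x⁴ : ⟪ (x ⊙ x) ⊙ (x ⊙ x) ⟫ ≡ ε
      x⁴ = deduce ((x ⊙ x) ⊙ (x ⊙ x)) unit
        ((X ∷ [] , I) ∷ ([] , I) ∷ (Y⁻ ∷ [] , S⁻) ∷ (Y⁻ ∷ Y⁻ ∷ [] , S) ∷ []) refl
      signs : ∀ a b → ⟪ signᴱ a ⟫ ∙ ⟪ signᴱ b ⟫ ≡ ⟪ signᴱ (a ⊕ b) ⟫
      signs zero       b          = identityˡ _
      signs (suc zero) zero       = identityʳ _
      signs (suc zero) (suc zero) = x⁴
      central : ∀ u a → ⟪ unitᴱ u ⟫ ∙ ⟪ signᴱ a ⟫ ≡ ⟪ signᴱ a ⟫ ∙ ⟪ unitᴱ u ⟫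
      central u  zero       = trans (identityʳ _) (sym (identityˡ _))
      central f0 (suc zero) = trans (identityˡ _) (sym (identityʳ _))
      central f1 (suc zero) = deduce (x ⊙ (x ⊙ x)) ((x ⊙ x) ⊙ x) [] refl
      central f2 (suc zero) = deduce (y ⊙ (x ⊙ x)) ((x ⊙ x) ⊙ y) ((Y ∷ [] , S) ∷ ([] , S⁻) ∷ []) refl
      central f3 (suc zero) = deduce ((x ⊙ y) ⊙ (x ⊙ x)) ((x ⊙ x) ⊙ (x ⊙ y))
        ((X ∷ Y ∷ [] , S) ∷ (X ∷ [] , S⁻) ∷ []) refl
      units : ∀ u v → ⟪ unitᴱ u ⟫ ∙ ⟪ unitᴱ v ⟫ ≡ ⟪ signᴱ (proj₁ (unitMul u v)) ⟫ ∙ ⟪ unitᴱ (proj₂ (unitMul u v)) ⟫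
      units u v = deduce (unitᴱ u ⊙ unitᴱ v) (signᴱ (proj₁ (unitMul u v)) ⊙ unitᴱ (proj₂ (unitMul u v))) (certificate u v) (checked u v)
        where
        certificate : Fin 4 → Fin 4 → List (Word × Relator)
        certificate f2 f1 = (X⁻ ∷ [] , I) ∷ ([] , relator unit ((x ⊙ x) ⊙ (x ⊙ x)) (sym x⁴)) ∷ []
        certificate f2 f2 = ([] , S⁻) ∷ []
        certificate f2 f3 = (X⁻ ∷ [] , I) ∷ (X⁻ ∷ [] , S⁻) ∷ []
        certificate f3 f1 = ([] , I) ∷ []
        certificate f3 f2 = (X ∷ [] , S⁻) ∷ []
        certificate f3 f3 = ([] , I) ∷ ([] , S⁻) ∷ []
        certificate _  _  = []
        correct : Fin 4 → Fin 4 → Bool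
        correct u v = trivial (conjugates (certificate u v) ++
          inv (flatten (unitᴱ u ⊙ unitᴱ v) ++ inv (flatten (signᴱ (proj₁ (unitMul u v)) ⊙ unitᴱ (proj₂ (unitMul u v))))))
        checked : ∀ u v → correct u v ≡ true
        checked u v = every-sound (correct u) (every-sound (λ u → every (correct u)) refl u) v
      homomorphic : Homomorphic Q₈ G h
      homomorphic (a , u) (b , v) = sym (begin
        (⟪ signᴱ a ⟫ ∙ ⟪ unitᴱ u ⟫) ∙ (⟪ signᴱ b ⟫ ∙ ⟪ unitᴱ v ⟫)
          ≡⟨ trans (assoc _ _ _) (cong (⟪ signᴱ a ⟫ ∙_) (sym (assoc _ _ _))) ⟩
        ⟪ signᴱ a ⟫ ∙ ((⟪ unitᴱ u ⟫ ∙ ⟪ signᴱ b ⟫) ∙ ⟪ unitᴱ v ⟫)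
          ≡⟨ cong (λ g → ⟪ signᴱ a ⟫ ∙ (g ∙ ⟪ unitᴱ v ⟫)) (central u b) ⟩
        ⟪ signᴱ a ⟫ ∙ ((⟪ signᴱ b ⟫ ∙ ⟪ unitᴱ u ⟫) ∙ ⟪ unitᴱ v ⟫)
          ≡⟨ trans (cong (⟪ signᴱ a ⟫ ∙_) (assoc _ _ _)) (sym (assoc _ _ _)) ⟩
        (⟪ signᴱ a ⟫ ∙ ⟪ signᴱ b ⟫) ∙ (⟪ unitᴱ u ⟫ ∙ ⟪ unitᴱ v ⟫)
          ≡⟨ cong₂ _∙_ (signs a b) (units u v) ⟩
        ⟪ signᴱ (a ⊕ b) ⟫ ∙ (⟪ signᴱ (proj₁ (unitMul u v)) ⟫ ∙ ⟪ unitᴱ (proj₂ (unitMul u v)) ⟫)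
          ≡⟨ trans (sym (assoc _ _ _)) (cong (_∙ ⟪ unitᴱ (proj₂ (unitMul u v)) ⟫) (signs (a ⊕ b) (proj₁ (unitMul u v)))) ⟩
        h ((a , u) · (b , v)) ∎)
        where open ≡-Reasoning
      refute : ∀ s → nontrivial (flatten s) ≡ true → ⟪ s ⟫ ≢ ε
      refute t p e = nontrivial-sound (flatten t) p (trans (eval-flatten t) e)
      kernel : ∀ p → h p ≡ ε → p ≡ (zero , zero)
      kernel (f0 , f0) _ = refl
      kernel (f0 , f1) e = ⊥-elim (refute (unit ⊙ x) refl e)
      kernel (f0 , f2) e = ⊥-elim (refute (unit ⊙ y) refl e)
      kernel (f0 , f3) e = ⊥-elim (refute (unit ⊙ (x ⊙ y)) refl e)
      kernel (f1 , f0) e = ⊥-elim (square 0 z<s (trans (sym (identityʳ _)) e))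
      kernel (f1 , f1) e = ⊥-elim (refute x refl (deduce x unit
        (([] , relator ((x ⊙ x) ⊙ (x ⊙ x)) unit x⁴) ∷ ([] , relator unit ((x ⊙ x) ⊙ x) (sym e)) ∷ []) refl))
      kernel (f1 , f2) e = ⊥-elim (refute ((x ⊙ x) ⊙ y) refl e)
      kernel (f1 , f3) e = ⊥-elim (refute ((x ⊙ x) ⊙ (x ⊙ y)) refl e)

  module _ {ρ : ℕ → Carrier} (fam : Family ρ 3) (exception : AllTriples.Exception G ρ) where
    open Family fam
    open GroupWords G ρ
    open AllTriples.Exception exception
    private
      x y z : Expr
      x = var 0
      y = var 1
      z = var 2

    exceptional-24 : eval (Y ∷ Y ∷ Y ∷ []) ≢ ε → G ≅ C₃×C₂³
    exceptional-24 y³≢ε = isomorphism C₃×C₂³ h homomorphic kernel generated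
      -- Up to y⁶ = 1, x is y² · y³ · (y x), z is y² · y³ · (y z), and y is (y²)² · y³.
      λ { 0 _ → (f1 , f1 , f1 , f0) , deduce (elementᴱ (f1 , f1 , f1 , f0)) x (Y⁶ ∷ []) refl
        ; 1 _ → (f2 , f1 , f0 , f0) , deduce (elementᴱ (f2 , f1 , f0 , f0)) y (Y⁶ ∷ []) refl
        ; 2 _ → (f1 , f1 , f0 , f1) , deduce (elementᴱ (f1 , f1 , f0 , f1)) z (Y⁶ ∷ []) refl
        ; (suc (suc (suc _))) (s≤s (s≤s (s≤s ()))) }
      where
      table : ∀ i j → i < 3 → j < 3 → ρ i ∙ ρ j ≡ ρ j ∙ ρ i
      table 0 0 _ _ = refl
      table 0 1 _ _ = xy≡yx
      table 0 2 _ _ = sym zx≡xz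
      table 1 0 _ _ = sym xy≡yx
      table 1 1 _ _ = refl
      table 1 2 _ _ = yz≡zy
      table 2 0 _ _ = zx≡xz
      table 2 1 _ _ = sym yz≡zy
      table 2 2 _ _ = refl
      table (suc (suc (suc _))) _ (s≤s (s≤s (s≤s ()))) _
      table 0 (suc (suc (suc _))) _ (s≤s (s≤s (s≤s ())))
      table 1 (suc (suc (suc _))) _ (s≤s (s≤s (s≤s ())))
      table 2 (suc (suc (suc _))) _ (s≤s (s≤s (s≤s ())))
      comm : ∀ g g′ → g ∙ g′ ≡ g′ ∙ g
      comm = abelian generated table
      relations : Relations
      relations = record { commuting = λ _ _ → true ; commutes = λ i j _ → comm _ _ }
      open Reduction relations
      open Decision relations
      y² y³ : Expr
      y² = y ⊙ y
      y³ = y ⊙ (y ⊙ y)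
      order-2ᴱ : Expr → Fin 2 → Expr
      order-2ᴱ t zero       = unit
      order-2ᴱ t (suc zero) = t
      order-3ᴱ : Expr → Fin 3 → Expr
      order-3ᴱ t zero             = unit
      order-3ᴱ t (suc zero)       = t
      order-3ᴱ t (suc (suc zero)) = t ⊙ t
      elementᴱ : FiniteGroup.Carrier C₃×C₂³ → Expr
      elementᴱ (c , α , β , γ) = order-3ᴱ y² c ⊙ (order-2ᴱ y³ α ⊙ (order-2ᴱ (y ⊙ x) β ⊙ order-2ᴱ (y ⊙ z) γ))
      h : FiniteGroup.Carrier C₃×C₂³ → Carrier
      h p = ⟪ elementᴱ p ⟫
      Y⁶ Y⁻⁶ : Word × Relator
      Y⁶  = [] , ((Y ∷ Y ∷ Y ∷ Y ∷ Y ∷ Y ∷ [] , []) by y⁶≡ε)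
      Y⁻⁶ = [] , (([] , Y ∷ Y ∷ Y ∷ Y ∷ Y ∷ Y ∷ []) by sym y⁶≡ε)
      order-2 : ∀ t i → of-order-2 ⟪ t ⟫ i ≡ ⟪ order-2ᴱ t i ⟫
      order-2 t zero       = refl
      order-2 t (suc zero) = refl
      order-3 : ∀ t i → of-order-3 ⟪ t ⟫ i ≡ ⟪ order-3ᴱ t i ⟫
      order-3 t zero             = refl
      order-3 t (suc zero)       = refl
      order-3 t (suc (suc zero)) = refl
      h′ : FiniteGroup.Carrier C₃×C₂³ → Carrier
      h′ (c , α , β , γ) = of-order-3 ⟪ y² ⟫ c ∙ (of-order-2 ⟪ y³ ⟫ α ∙ (of-order-2 ⟪ y ⊙ x ⟫ β ∙ of-order-2 ⟪ y ⊙ z ⟫ γ))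
      h′≡h : ∀ p → h′ p ≡ h p
      h′≡h (c , α , β , γ) = cong₂ _∙_ (order-3 y² c) (cong₂ _∙_ (order-2 y³ α) (cong₂ _∙_ (order-2 (y ⊙ x) β) (order-2 (y ⊙ z) γ)))
      homomorphic′ : Homomorphic C₃×C₂³ G h′
      homomorphic′ = product-homomorphic {C₃} {C₂ ⊗ (C₂ ⊗ C₂)} comm
        (of-order-3-homomorphic (deduce (y² ⊙ (y² ⊙ y²)) unit (Y⁶ ∷ []) refl))
        (product-homomorphic {C₂} {C₂ ⊗ C₂} comm (of-order-2-homomorphic (deduce (y³ ⊙ y³) unit (Y⁶ ∷ []) refl))
          (product-homomorphic {C₂} {C₂} comm (of-order-2-homomorphic yx²≡ε) (of-order-2-homomorphic yz²≡ε)))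
      homomorphic : Homomorphic C₃×C₂³ G h
      homomorphic p q = trans (sym (h′≡h (FiniteGroup._∙_ C₃×C₂³ p q))) (trans (homomorphic′ p q) (cong₂ _∙_ (h′≡h p) (h′≡h q)))
      facts : List Fact
      facts = ne (Y ∷ Y ∷ []) ∷ ne (Y ∷ Y ∷ Y ∷ []) ∷ []
      hold : All Holds facts
      hold = (λ e → square 1 (s<s z<s) (trans (cong (ρ 1 ∙_) (sym (identityʳ _))) e)) ∷ y³≢ε ∷ []
      isFalse : Maybe Bool → Bool
      isFalse (just false) = true
      isFalse _            = false
      refute : ∀ w → isFalse (verdict facts w) ≡ true → eval w ≢ ε
      refute w e with verdict facts w in q
      ... | just false = proj₂ (verdict-sound facts hold w false q) refl
      isZero : FiniteGroup.Carrier C₃×C₂³ → Bool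
      isZero (f0 , f0 , f0 , f0) = true
      isZero _                   = false
      isZero-sound : ∀ p → isZero p ≡ true → p ≡ (zero , zero , zero , zero)
      isZero-sound (f0 , f0 , f0 , f0) _ = refl
      -- Up to the relation y⁶ = 1 an element is y^k, y^k x, y^k z or y^k x z with |k| ≤ 3.
      settled : FiniteGroup.Carrier C₃×C₂³ → Bool
      settled p = isZero p ∨ (isFalse (verdict facts (flatten (elementᴱ p))) ∨
                              isFalse (verdict facts (conjugates (Y⁻⁶ ∷ []) ++ flatten (elementᴱ p))))
      open Exhaustible (×-exhaustible (fin-exhaustible {3}) (×-exhaustible (fin-exhaustible {2})
        (×-exhaustible (fin-exhaustible {2}) (fin-exhaustible {2}))))
      kernel : ∀ p → h p ≡ ε → p ≡ (zero , zero , zero , zero)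
      kernel p e with ∨-true {isZero p} (all-sound settled refl p)
      ... | inj₁ q = isZero-sound p q
      ... | inj₂ q with ∨-true {isFalse (verdict facts (flatten (elementᴱ p)))} q
      ...   | inj₁ r = ⊥-elim (refute (flatten (elementᴱ p)) r (trans (eval-flatten (elementᴱ p)) e))
      ...   | inj₂ r = ⊥-elim (refute (conjugates (Y⁻⁶ ∷ []) ++ flatten (elementᴱ p)) r
              (trans (eval-++ (conjugates (Y⁻⁶ ∷ [])) (flatten (elementᴱ p)))
                (trans (cong₂ _∙_ (eval-conjugates (Y⁻⁶ ∷ [])) (trans (eval-flatten (elementᴱ p)) e)) (identityˡ ε))))

-- Assembly by the number of generators

module _ (G : FiniteGroup) where
  open FiniteGroup G
  open Families G
  open SmallSets G
  open Pairs G
  open Isomorphisms G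

  family-admits : ¬ (G ≅ Q₈) → ¬ (G ≅ C₃×C₂³) → ¬ (G ≅ C₃×C₃) → ∀ ℓ {ρ} → Family ρ ℓ →
    (∀ e → suc e < ℓ → (ρ (suc e) ∙ ρ e ⁻¹) ∙ (ρ (suc e) ∙ ρ e ⁻¹) ≢ ε) → AdmitsORR G
  family-admits _ _ _ 0 fam _ = empty-family fam
  family-admits _ _ _ 1 fam _ = single-family fam
  family-admits ¬Q₈ _ ¬C₃×C₃ 2 fam sq with pair fam (sq 0 (s<s z<s))
  ... | inj₁ orr                   = orr
  ... | inj₂ (inj₁ (i , r))        =
    ⊥-elim (¬Q₈ (quaternion fam i (PairFacts.equal-squares (Family.separation fam) i r)))
  ... | inj₂ (inj₂ (c , x³ , y³))  = ⊥-elim (¬C₃×C₃ (elementary-9 fam c x³ y³))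
  family-admits _ ¬C₃×C₂³ _ 3 fam sq with AllTriples.triples G fam (sq 0 (s<s z<s)) (sq 1 (s<s (s<s z<s)))
  ... | inj₁ orr = orr
  ... | inj₂ exc = ⊥-elim (¬C₃×C₂³ (exceptional-24 fam exc
          (CommutingTriples.Abelian.y³≢ε G fam (sq 0 (s<s z<s)) (sq 1 (s<s (s<s z<s))) xy≡yx yz≡zy zx≡xz yx²≡ε yz²≡ε)))
    where open AllTriples.Exception exc
  family-admits _ _ _ (suc (suc (suc (suc k)))) {ρ} fam sq with commuting? (ρ 1) (ρ 0)
  ... | yes c = ForkedSet.forked fam
          (λ { zero _ → inverted-quotient (ρ 0) (ρ 1) (sq 0 (s<s z<s)) ; (suc e) p → sq (suc e) (s<s p) })
          c (s<s (s<s z<s))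
  -- The path has at least three edges here, which voids the outcomes of `straight` that demand one
  -- or two.
  ... | no ¬c with StraightSet.straight fam (λ e p → sq e (s<s p)) z<s (inj₁ (λ c → ¬c (commuting-sym (ρ 0) (ρ 1) c)))
  ...   | inj₁ orr             = orr
  ...   | inj₂ (inj₁ (() , _))
  ...   | inj₂ (inj₂ (() , _))

theorem5p4 : (G : FiniteGroup) (ℓ : ℕ) (a : Fin ℓ → FiniteGroup.Carrier G) →
    Injective _≡_ _≡_ a →
    Generates G a →
    FiveProductAvoiding G a →
    (∀ i → FiniteGroup.OrderGT2 G (a i)) →
    (∀ i j → toℕ j ≡ suc (toℕ i) →
    FiniteGroup.OrderGT2 G (FiniteGroup._∙_ G (a j) (FiniteGroup._⁻¹ G (a i)))) →
    AdmitsORR G ⇔ (¬ (G ≅ Q₈) × ¬ (G ≅ C₃×C₂³) × ¬ (G ≅ C₃×C₃))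
theorem5p4 G ℓ a a-injective generates avoiding a-order quotient-order = mk⇔
  (λ orr → Q₈-no-ORR G orr , C₃×C₂³-no-ORR G orr , C₃×C₃-no-ORR G orr)
  (λ (¬Q₈ , ¬C₃×C₂³ , ¬C₃×C₃) → family-admits G ¬Q₈ ¬C₃×C₂³ ¬C₃×C₃ ℓ
    (Families.tuple-family G a a-injective generates avoiding a-order) quotient-square≢ε)
  where
  open FiniteGroup G
  open Tuple G a a-injective avoiding a-order
  quotient-square≢ε : ∀ e → suc e < ℓ → (A (suc e) ∙ A e ⁻¹) ∙ (A (suc e) ∙ A e ⁻¹) ≢ ε
  quotient-square≢ε e p = subst₂ (λ g h → (g ∙ h ⁻¹) ∙ (g ∙ h ⁻¹) ≢ ε) (A-at p) (A-at q)
    (order>2⇒square≢ε G (quotient-order (Fin.fromℕ< q) (Fin.fromℕ< p)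
      (trans (Finₚ.toℕ-fromℕ< p) (cong suc (sym (Finₚ.toℕ-fromℕ< q))))))
    where
    q : e < ℓ
    q = ℕₚ.<-trans (ℕₚ.n<1+n e) p
    A-at : ∀ {k} (k<ℓ : k < ℓ) → a (Fin.fromℕ< k<ℓ) ≡ A k
    A-at k<ℓ = trans (sym (A-toℕ (Fin.fromℕ< k<ℓ))) (cong A (Finₚ.toℕ-fromℕ< k<ℓ))
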